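{- Let $D$ be a predilator such that $\overline D(\omega^2)$ is well-founded. Then at least one of the following holds: (i) $\mathsf{RCA}_0\vDash_\omega\text{``$D$ is a dilator''}$; (ii) $D$ has a thread.
   Context: Linear orders have underlying set $\subseteq\mathbb N$. A (coded) predilator is a monotone functor $D$ ($f\le g$ pointwise implies $D(f)\le D(g)$) from the category $\mathsf{Nat}$ of finite orders $n=\{0,\ldots,n-1\}$ with embeddings to the category of linear orders with embeddings, with a natural transformation $\mathrm{supp}:D\Rightarrow[\cdot]^{<\omega}$ to the finite-powerset functor such that for every $f:m\to n$, every $\tau\in D(n)$ with $\mathrm{supp}_n(\tau)\subseteq\mathrm{rng}(f)$ lies in $\mathrm{rng}(D(f))$; it is coded by a subset of $\mathbb N$. For a finite order $a$ let $\mathrm{en}_a:|a|\to a$ be its increasing enumeration and for embeddings $f:a\to b$ of finite orders let $|f|$ satisfy $\mathrm{en}_b\circ|f|=f\circ\mathrm{en}_a$. For a linear order $\alpha$, $\overline D(\alpha)$ is the set of pairs $(\sigma,a)$ with $a\subseteq\alpha$ finite, $\sigma\in D(|a|)$, $\mathrm{supp}_{|a|}(\sigma)=\{0,\ldots,|a|-1\}$, ordered by $(\sigma,a)\le(\tau,b)$ iff $D(|\iota_a|)(\sigma)\le D(|\iota_b|)(\tau)$ (inclusions into $a\cup b$); for an embedding $f:\alpha\to\beta$, $\overline D(f)(\sigma,a)=(\sigma,f[a])$. $D$ is a dilator if $\overline D(\alpha)$ is well-founded for all well orders $\alpha$. $\omega^2$ is the order of pairs $\omega\cdot m+n$ ($m,n\in\mathbb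 N$) compared lexicographically with $m$ first. $\mathsf T\vDash_\omega\varphi(X_1,\ldots,X_n)$ means there is $Y\subseteq\mathbb N$ with $\mathcal M\vDash\varphi(X_1,\ldots,X_n)$ for every $\omega$-model $\mathcal M\vDash\mathsf T$ containing $X_1,\ldots,X_n,Y$. For a linear order $L=(\mathbb N,\le_L)$, let $\pi^L_n$ be the permutation of $\{0,\ldots,n-1\}$ with $\pi^L_n(i)\le\pi^L_n(j)\Leftrightarrow i\le_Lj$, and $\sigma^L_i=\sigma(\pi^L_{l(\sigma)}(i))$ for a finite sequence $\sigma$ of length $l(\sigma)$. $D_L(\alpha)$ is the set of strictly increasing finite sequences in $\alpha$ with $\sigma<\tau$ iff either some $j<\min(l(\sigma),l(\tau))$ has $\sigma^L_j<\tau^L_j$ and $\sigma^L_i=\tau^L_i$ for $i<j$, or $l(\sigma)<l(\tau)$ and $\sigma^L_i=\tau^L_i$ for $i<l(\sigma)$; $D_L(f)$ acts entrywise. For a linear order $\alpha$, $\omega\cdot(1+\alpha)$ has elements $\omega\cdot0+n$ and $\omega\cdot(1+x)+n$ ($x\in\alpha$, $n\in\mathbb N$), ordered lexicographically with $0<1+x<1+y$ for $x<y$; an embedding $f$ induces $\omega\cdot(1+f)$ fixing $\omega\cdot0+n$ and sending $\omega\cdot(1+x)+n$ to $\omega\cdot(1+f(x))+n$. A linear order $L=(\mathbb N,\le_L)$ is a thread of $D$ if there is a family of order embeddings $\eta_\alpha:D_L(\alpha)\to\overline D(\omega\cdot(1+\alpha))$, $\alpha$ ranging over linear orders, natural in the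 sense that $\eta_\beta\circ D_L(f)=\overline D(\omega\cdot(1+f))\circ\eta_\alpha$ for all embeddings $f:\alpha\to\beta$. -}

module Defs where

open import Data.Nat using (ℕ; zero; suc; _+_; _≤_; _<_; _≡ᵇ_)
open import Data.Bool using (Bool; true; false)
open import Data.Fin using (Fin; toℕ)
open import Data.Vec using (Vec; []; _∷_; lookup; allFin)
import Data.Vec as Vec
open import Data.List using (List)
open import Data.Bool.ListAction using (any)
import Data.List as List
open import Data.List.Membership.Propositional using (_∈_)
open import Data.Maybe using (Maybe; just; nothing)
open import Data.Product using (Σ; _×_; _,_; proj₁; proj₂)
open import Data.Sum using (_⊎_; inj₁; inj₂)
open import Data.Empty using (⊥; ⊥-elim)
open import Data.Unit using (⊤; tt)
open import Relation.Nullary using (¬_)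
open import Relation.Binary.PropositionalEquality using (_≡_; _≢_)
open import Function using (_∘_)

Iff : Set → Set → Set
Iff A B = (A → B) × (B → A)

tri : ℕ → ℕ
tri zero = 0
tri (suc k) = suc k + tri k

pair : ℕ → ℕ → ℕ
pair m n = tri (m + n) + n

codeFn : {k : ℕ} → (Fin k → ℕ) → ℕ
codeFn {zero} u = 0
codeFn {suc k} u = suc (pair (u Fin.zero) (codeFn (u ∘ Fin.suc)))
  where import Data.Fin as Fin

-- a morphism m → n of the category Nat: a vector of length m in Fin n,
-- required to be strictly increasing
IsEmb : {m n : ℕ} → Vec (Fin n) m → Set
IsEmb {m} f = ∀ (i j : Fin m) → toℕ i < toℕ j → toℕ (lookup f i) < toℕ (lookup f j)

compEmb : {m n k : ℕ} → Vec (Fin k) n → Vec (Fin n) m → Vec (Fin k) m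
compEmb g f = Vec.map (lookup g) f

-- Coded predilators.  D(n) is the set {σ | mem n σ ≡ true} ⊆ ℕ with order
-- leq n; act f is D(f); supp n σ is supp_n(σ) (a finite subset of n).

record Predilator : Set where
  field
    mem  : ℕ → ℕ → Bool
    leq  : ℕ → ℕ → ℕ → Bool
    act  : {m n : ℕ} → Vec (Fin n) m → ℕ → ℕ
    supp : (n : ℕ) → ℕ → List (Fin n)
    leq-refl    : ∀ n σ → mem n σ ≡ true → leq n σ σ ≡ true
    leq-antisym : ∀ n σ τ → mem n σ ≡ true → mem n τ ≡ true →
                  leq n σ τ ≡ true → leq n τ σ ≡ true → σ ≡ τ
    leq-trans   : ∀ n σ τ ρ → mem n σ ≡ true → mem n τ ≡ true → mem n ρ ≡ true →
                  leq n σ τ ≡ true → leq n τ ρ ≡ true → leq n σ ρ ≡ true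
    leq-total   : ∀ n σ τ → mem n σ ≡ true → mem n τ ≡ true →
                  (leq n σ τ ≡ true) ⊎ (leq n τ σ ≡ true)
    act-mem : ∀ {m n} (f : Vec (Fin n) m) σ → IsEmb f → mem m σ ≡ true → mem n (act f σ) ≡ true
    act-leq : ∀ {m n} (f : Vec (Fin n) m) σ τ → IsEmb f → mem m σ ≡ true → mem m τ ≡ true →
              Iff (leq m σ τ ≡ true) (leq n (act f σ) (act f τ) ≡ true)
    act-id   : ∀ n σ → mem n σ ≡ true → act (allFin n) σ ≡ σ
    act-comp : ∀ {m n k} (g : Vec (Fin k) n) (f : Vec (Fin n) m) σ → IsEmb g → IsEmb f →
               mem m σ ≡ true → act (compEmb g f) σ ≡ act g (act f σ)
    act-mono : ∀ {m n} (f g : Vec (Fin n) m) σ → IsEmb f → IsEmb g →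
               (∀ i → toℕ (lookup f i) ≤ toℕ (lookup g i)) → mem m σ ≡ true →
               leq n (act f σ) (act g σ) ≡ true
    supp-nat : ∀ {m n} (f : Vec (Fin n) m) σ → IsEmb f → mem m σ ≡ true → ∀ (i : Fin n) →
               Iff (i ∈ supp n (act f σ)) (Σ (Fin m) λ j → (j ∈ supp m σ) × (lookup f j ≡ i))
    supp-cond : ∀ {m n} (f : Vec (Fin n) m) τ → IsEmb f → mem n τ ≡ true →
                (∀ i → i ∈ supp n τ → Σ (Fin m) λ j → lookup f j ≡ i) →
                Σ ℕ λ σ → (mem m σ ≡ true) × (act f σ ≡ τ)

open Predilator public

record Ord : Set₁ where
  field
    Car : Set
    _≼_ : Car → Car → Set

open Ord public

Le : (A : Ord) → Car A → Car A → Set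
Le A x y = Ord._≼_ A x y

Lt : (A : Ord) → Car A → Car A → Set
Lt A x y = Le A x y × ¬ Le A y x

Eqv : (A : Ord) → Car A → Car A → Set
Eqv A x y = Le A x y × Le A y x

record OrdEmb (A B : Ord) : Set where
  field
    fun  : Car A → Car B
    mono : ∀ {x y} → Le A x y → Le B (fun x) (fun y)
    refl : ∀ {x y} → Le B (fun x) (fun y) → Le A x y

lex : Ord → Ord → Ord
lex A B = record
  { Car = Car A × Car B
  ; _≼_ = λ p q → Lt A (proj₁ p) (proj₁ q) ⊎ (Eqv A (proj₁ p) (proj₁ q) × Le B (proj₂ p) (proj₂ q)) }

lexMap : {A A' B B' : Ord} → OrdEmb A A' → OrdEmb B B' → OrdEmb (lex A B) (lex A' B')
lexMap {A} {A'} {B} {B'} h k = record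
  { fun = λ p → OrdEmb.fun h (proj₁ p) , OrdEmb.fun k (proj₂ p)
  ; mono = mo
  ; refl = re }
  where
  mo : ∀ {x y} → Le (lex A B) x y → Le (lex A' B') _ _
  mo (inj₁ (l , n)) = inj₁ (OrdEmb.mono h l , λ z → n (OrdEmb.refl h z))
  mo (inj₂ ((l₁ , l₂) , l)) = inj₂ ((OrdEmb.mono h l₁ , OrdEmb.mono h l₂) , OrdEmb.mono k l)
  re : ∀ {x y} → Le (lex A' B') (OrdEmb.fun h (proj₁ x) , OrdEmb.fun k (proj₂ x))
                                (OrdEmb.fun h (proj₁ y) , OrdEmb.fun k (proj₂ y)) → Le (lex A B) x y
  re (inj₁ (l , n)) = inj₁ (OrdEmb.refl h l , λ z → n (OrdEmb.mono h z))
  re (inj₂ ((l₁ , l₂) , l)) = inj₂ ((OrdEmb.refl h l₁ , OrdEmb.refl h l₂) , OrdEmb.refl k l)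

ωO : Ord
ωO = record { Car = ℕ ; _≼_ = _≤_ }

idω : OrdEmb ωO ωO
idω = record { fun = λ n → n ; mono = λ l → l ; refl = λ l → l }

-- ω²  (ω·m + n  as  (m , n))
ω² : Ord
ω² = lex ωO ωO

record LinOrdℕ : Set₁ where
  field
    elem : ℕ → Set
    rel  : ℕ → ℕ → Set
    rel-elem : ∀ {x y} → rel x y → elem x × elem y
    rel-refl : ∀ {x} → elem x → rel x x
    rel-antisym : ∀ {x y} → rel x y → rel y x → x ≡ y
    rel-trans : ∀ {x y z} → rel x y → rel y z → rel x z
    rel-total : ∀ {x y} → elem x → elem y → rel x y ⊎ rel y x

open LinOrdℕ public

Ltℕ : (α : LinOrdℕ) → ℕ → ℕ → Set
Ltℕ α x y = rel α x y × x ≢ y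

record LinEmb (α β : LinOrdℕ) : Set where
  field
    fn : ℕ → ℕ
    fn-elem : ∀ {x} → elem α x → elem β (fn x)
    fn-rel : ∀ {x y} → elem α x → elem α y → Iff (rel α x y) (rel β (fn x) (fn y))

onePlus : LinOrdℕ → Ord
onePlus α = record { Car = Maybe (Σ ℕ (elem α)) ; _≼_ = le }
  where
  le : Maybe (Σ ℕ (elem α)) → Maybe (Σ ℕ (elem α)) → Set
  le nothing _ = ⊤
  le (just _) nothing = ⊥
  le (just x) (just y) = rel α (proj₁ x) (proj₁ y)

onePlusMap : {α β : LinOrdℕ} → LinEmb α β → OrdEmb (onePlus α) (onePlus β)
onePlusMap {α} {β} f = record { fun = fu ; mono = λ {x} {y} → mo x y ; refl = λ {x} {y} → re x y }
  where
  fu : Maybe (Σ ℕ (elem α)) → Maybe (Σ ℕ (elem β))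
  fu nothing = nothing
  fu (just (x , p)) = just (LinEmb.fn f x , LinEmb.fn-elem f p)
  mo : ∀ x y → Le (onePlus α) x y → Le (onePlus β) (fu x) (fu y)
  mo nothing y l = tt
  mo (just x) nothing ()
  mo (just (x , p)) (just (y , q)) l = proj₁ (LinEmb.fn-rel f p q) l
  re : ∀ x y → Le (onePlus β) (fu x) (fu y) → Le (onePlus α) x y
  re nothing y l = tt
  re (just x) nothing ()
  re (just (x , p)) (just (y , q)) l = proj₂ (LinEmb.fn-rel f p q) l

-- ω·(1+α): elements (nothing , n) = ω·0+n and (just x , n) = ω·(1+x)+n
ω1+ : LinOrdℕ → Ord
ω1+ α = lex (onePlus α) ωO

ω1+map : {α β : LinOrdℕ} → LinEmb α β → OrdEmb (ω1+ α) (ω1+ β)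
ω1+map f = lexMap (onePlusMap f) idω

record BarElt (D : Predilator) (A : Ord) : Set where
  field
    len : ℕ
    el  : Fin len → Car A
    el-inc : ∀ (i j : Fin len) → toℕ i < toℕ j → Lt A (el i) (el j)
    sig : ℕ
    sig-mem : mem D len sig ≡ true
    sig-supp : ∀ (i : Fin len) → i ∈ supp D len sig

open BarElt public

-- (σ,a) ≤ (τ,b): with c = a ∪ b (enumerated increasingly), f = |ι_a|, g = |ι_b|,
-- D(f)(σ) ≤ D(g)(τ) in D(|c|).
record BarLeq (D : Predilator) (A : Ord) (x y : BarElt D A) : Set where
  field
    lc : ℕ
    c  : Fin lc → Car A
    c-inc : ∀ (i j : Fin lc) → toℕ i < toℕ j → Lt A (c i) (c j)
    f  : Vec (Fin lc) (len x)
    g  : Vec (Fin lc) (len y)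
    f-emb : IsEmb f
    g-emb : IsEmb g
    f-ok : ∀ i → Eqv A (c (lookup f i)) (el x i)
    g-ok : ∀ j → Eqv A (c (lookup g j)) (el y j)
    cover : ∀ p → (Σ (Fin (len x)) λ i → lookup f i ≡ p) ⊎ (Σ (Fin (len y)) λ j → lookup g j ≡ p)
    cmp : leq D lc (act D f (sig x)) (act D g (sig y)) ≡ true

BarLt : (D : Predilator) (A : Ord) → BarElt D A → BarElt D A → Set
BarLt D A x y = BarLeq D A x y × ¬ BarLeq D A y x

BarEq : (D : Predilator) (A : Ord) → BarElt D A → BarElt D A → Set
BarEq D A x y = BarLeq D A x y × BarLeq D A y x

barMap : {D : Predilator} {A B : Ord} → OrdEmb A B → BarElt D A → BarElt D B
barMap {D} {A} {B} h x = record
  { len = len x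
  ; el = OrdEmb.fun h ∘ el x
  ; el-inc = λ i j p → OrdEmb.mono h (proj₁ (el-inc x i j p)) ,
                       λ z → proj₂ (el-inc x i j p) (OrdEmb.refl h z)
  ; sig = sig x
  ; sig-mem = sig-mem x
  ; sig-supp = sig-supp x }

BarWF : Predilator → Ord → Set
BarWF D A = ¬ (Σ (ℕ → BarElt D A) λ s → ∀ n → BarLt D A (s (suc n)) (s n))

record DLElt (α : LinOrdℕ) : Set where
  field
    slen : ℕ
    seq  : Fin slen → ℕ
    seq-elem : ∀ i → elem α (seq i)
    seq-inc  : ∀ (i j : Fin slen) → toℕ i < toℕ j → Ltℕ α (seq i) (seq j)

open DLElt public

DLmap : {α β : LinOrdℕ} → LinEmb α β → DLElt α → DLElt β
DLmap {α} {β} f x = record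
  { slen = slen x
  ; seq = LinEmb.fn f ∘ seq x
  ; seq-elem = λ i → LinEmb.fn-elem f (seq-elem x i)
  ; seq-inc = λ i j p →
      let r = proj₁ (seq-inc x i j p)
          ne = proj₂ (seq-inc x i j p)
          pi = seq-elem x i
          pj = seq-elem x j
      in proj₁ (LinEmb.fn-rel f pi pj) r ,
         λ e → ne (rel-antisym α r (proj₂ (LinEmb.fn-rel f pj pi)
                     (Relation.Binary.PropositionalEquality.subst
                        (λ z → rel β z (LinEmb.fn f (seq x i))) e
                        (rel-refl β (LinEmb.fn-elem f pi))))) }
  where import Relation.Binary.PropositionalEquality

IsPermL : (L : LinOrdℕ) (n : ℕ) → (Fin n → Fin n) → Set
IsPermL L n π = ∀ (i j : Fin n) → Iff (toℕ (π i) ≤ toℕ (π j)) (rel L (toℕ i) (toℕ j))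

LexLt : (α : LinOrdℕ) {l₁ l₂ : ℕ} → (Fin l₁ → ℕ) → (Fin l₂ → ℕ) → Set
LexLt α {l₁} {l₂} u v =
  (Σ (Fin l₁) λ j → Σ (Fin l₂) λ j' → (toℕ j ≡ toℕ j') × Ltℕ α (u j) (v j') ×
     (∀ (i : Fin l₁) (i' : Fin l₂) → toℕ i ≡ toℕ i' → toℕ i < toℕ j → u i ≡ v i'))
  ⊎ ((l₁ < l₂) × (∀ (i : Fin l₁) (i' : Fin l₂) → toℕ i ≡ toℕ i' → u i ≡ v i'))

DLLt : (L α : LinOrdℕ) → DLElt α → DLElt α → Set
DLLt L α x y = Σ (Fin (slen x) → Fin (slen x)) λ π → Σ (Fin (slen y) → Fin (slen y)) λ π' →
  IsPermL L (slen x) π × IsPermL L (slen y) π' × LexLt α (seq x ∘ π) (seq y ∘ π')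

record Thread (D : Predilator) (L : LinOrdℕ) : Set₁ where
  field
    η : (α : LinOrdℕ) → DLElt α → BarElt D (ω1+ α)
    η-emb : ∀ α x y → Iff (DLLt L α x y) (BarLt D (ω1+ α) (η α x) (η α y))
    η-nat : ∀ α β (f : LinEmb α β) (x : DLElt α) →
            BarEq D (ω1+ β) (η β (DLmap f x)) (barMap (ω1+map f) (η α x))

HasThread : Predilator → Set₁
HasThread D = Σ LinOrdℕ λ L → (∀ n → elem L n) × Thread D L

-- ω-models of RCA₀ = Turing ideals; oracle computation via μ-recursion

data Prog : ℕ → Set where
  pzero : ∀ {k} → Prog k
  psuc  : Prog 1
  pproj : ∀ {k} → Fin k → Prog k
  porc  : Prog 1
  pcomp : ∀ {k j} → Prog j → Vec (Prog k) j → Prog k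
  prec  : ∀ {k} → Prog k → Prog (suc (suc k)) → Prog (suc k)
  pmu   : ∀ {k} → Prog (suc k) → Prog k

b2n : Bool → ℕ
b2n true = 1
b2n false = 0

data Eval (X : ℕ → Bool) : {k : ℕ} → Prog k → Vec ℕ k → ℕ → Set
data EvalAll (X : ℕ → Bool) : {k j : ℕ} → Vec (Prog k) j → Vec ℕ k → Vec ℕ j → Set

data Eval X where
  ezero : ∀ {k} {xs : Vec ℕ k} → Eval X pzero xs 0
  esuc  : ∀ {x} → Eval X psuc (x ∷ []) (suc x)
  eproj : ∀ {k} {i : Fin k} {xs : Vec ℕ k} → Eval X (pproj i) xs (lookup xs i)
  eorc  : ∀ {x} → Eval X porc (x ∷ []) (b2n (X x))
  ecomp : ∀ {k j} {g : Prog j} {hs : Vec (Prog k) j} {xs : Vec ℕ k} {ys : Vec ℕ j} {y} →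
          EvalAll X hs xs ys → Eval X g ys y → Eval X (pcomp g hs) xs y
  erec0 : ∀ {k} {g : Prog k} {h : Prog (suc (suc k))} {xs : Vec ℕ k} {y} →
          Eval X g xs y → Eval X (prec g h) (0 ∷ xs) y
  erecS : ∀ {k} {g : Prog k} {h : Prog (suc (suc k))} {xs : Vec ℕ k} {n y z} →
          Eval X (prec g h) (n ∷ xs) y → Eval X h (n ∷ y ∷ xs) z → Eval X (prec g h) (suc n ∷ xs) z
  emu   : ∀ {k} {p : Prog (suc k)} {xs : Vec ℕ k} {z} →
          Eval X p (z ∷ xs) 0 → (∀ i → i < z → Σ ℕ λ v → Eval X p (i ∷ xs) (suc v)) →
          Eval X (pmu p) xs z

data EvalAll X where
  [] : ∀ {k} {xs : Vec ℕ k} → EvalAll X [] xs []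
  _∷_ : ∀ {k j} {h : Prog k} {hs : Vec (Prog k) j} {xs : Vec ℕ k} {y} {ys : Vec ℕ j} →
        Eval X h xs y → EvalAll X hs xs ys → EvalAll X (h ∷ hs) xs (y ∷ ys)

_≤T_ : (ℕ → Bool) → (ℕ → Bool) → Set
X ≤T Y = Σ (Prog 1) λ p → ∀ n → Eval Y p (n ∷ []) (b2n (X n))

join : (ℕ → Bool) → (ℕ → Bool) → ℕ → Bool
join X Y zero = X 0
join X Y (suc zero) = Y 0
join X Y (suc (suc k)) = join (X ∘ suc) (Y ∘ suc) k

-- ω-model of RCA₀ (given by its second-order part M ⊆ P(ℕ))
record IsOmegaModelRCA₀ (M : (ℕ → Bool) → Set) : Set₁ where
  field
    nonempty : Σ (ℕ → Bool) M
    join-closed : ∀ X Y → M X → M Y → M (join X Y)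
    down-closed : ∀ X Y → X ≤T Y → M Y → M X

FunIn : ((ℕ → Bool) → Set) → (ℕ → ℕ) → Set
FunIn M f = Σ (ℕ → Bool) λ Y → M Y × (∀ n m → Y (pair n m) ≡ (f n ≡ᵇ m))

codeVec : {m n : ℕ} → Vec (Fin n) m → ℕ
codeVec [] = 0
codeVec (x ∷ xs) = suc (pair (toℕ x) (codeVec xs))

_∈ᵇ_ : ℕ → List ℕ → Bool
i ∈ᵇ xs = any (λ j → i ≡ᵇ j) xs

ContainsD : ((ℕ → Bool) → Set) → Predilator → Set
ContainsD M D = Σ (ℕ → Bool) λ Y → M Y ×
  ((∀ n σ → Y (pair 0 (pair n σ)) ≡ mem D n σ) ×
   (∀ n σ τ → mem D n σ ≡ true → mem D n τ ≡ true →
      Y (pair 1 (pair n (pair σ τ))) ≡ leq D n σ τ) ×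
   (∀ m n (f : Vec (Fin n) m) σ τ → IsEmb f → mem D m σ ≡ true →
      Y (pair 2 (pair m (pair n (pair (codeVec f) (pair σ τ))))) ≡ (act D f σ ≡ᵇ τ)) ×
   (∀ n σ i → mem D n σ ≡ true →
      Y (pair 3 (pair n (pair σ i))) ≡ (i ∈ᵇ List.map toℕ (supp D n σ))))

fieldX : (ℕ → Bool) → ℕ → Set
fieldX X i = X (pair i i) ≡ true

relX : (ℕ → Bool) → ℕ → ℕ → Set
relX X i j = X (pair i j) ≡ true

IsLinOrdCode : (ℕ → Bool) → Set
IsLinOrdCode X =
  (∀ i j → relX X i j → fieldX X i × fieldX X j) ×
  (∀ i j → relX X i j → relX X j i → i ≡ j) ×
  (∀ i j k → relX X i j → relX X j k → relX X i k) ×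
  (∀ i j → fieldX X i → fieldX X j → relX X i j ⊎ relX X j i)

ordX : (ℕ → Bool) → Ord
ordX X = record { Car = Σ ℕ (fieldX X) ; _≼_ = λ x y → relX X (proj₁ x) (proj₁ y) }

WFinM : ((ℕ → Bool) → Set) → (ℕ → Bool) → Set
WFinM M X = ¬ (Σ (ℕ → ℕ) λ f → FunIn M f × (∀ n → fieldX X (f n)) ×
                  (∀ n → relX X (f (suc n)) (f n) × f (suc n) ≢ f n))

codeBarX : {D : Predilator} {X : ℕ → Bool} → BarElt D (ordX X) → ℕ
codeBarX x = pair (sig x) (codeFn (λ i → proj₁ (el x i)))

BarWFinM : ((ℕ → Bool) → Set) → Predilator → (ℕ → Bool) → Set
BarWFinM M D X = ¬ (Σ (ℕ → BarElt D (ordX X)) λ s → FunIn M (λ n → codeBarX {D} {X} (s n)) ×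
                     (∀ n → BarLt D (ordX X) (s (suc n)) (s n)))

SatDilator : ((ℕ → Bool) → Set) → Predilator → Set
SatDilator M D = ∀ X → M X → IsLinOrdCode X → WFinM M X → BarWFinM M D X

RCA₀⊨ωDilator : Predilator → Set₁
RCA₀⊨ωDilator D = Σ (ℕ → Bool) λ Y → ∀ (M : (ℕ → Bool) → Set) →
  IsOmegaModelRCA₀ M → ContainsD M D → M Y → SatDilator M D

module Submission where

-- Fix an element (σ , a) of D̄(α).  By monotonicity the positions of σ carry a priority order: placements of σ
-- are compared lexicographically, most important letter first.  Suppose D̄(X) has a descending sequence in an
-- ω-model M in which X is well-founded.  Each sequence of k-th most important letters is (once the earlier ones
-- are constant) weakly descending in X, and with an oracle for the priorities M can enumerate its changes; hence
-- it is eventually constant, with limit x_k.  Well-foundedness of D̄(ω²) rules out that infinitely many steps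
-- are decided by the traces alone after k letters.  So the traces of late members of the sequence compare via their
-- letters 0, …, k, and they form a thread for the order i ≤_L j ⇔ x_i ≤ x_j: give the first k letters the values
-- ω·(1+x) and squeeze all other positions right above the preceding letter.

open import Defs
open import Data.Sum using (_⊎_)
open import Axiom.ExcludedMiddle using (ExcludedMiddle)
open import Data.Nat using (ℕ; zero; suc; _+_; _*_; _≤_; _<_; z≤n; s≤s; s≤s⁻¹; _⊓_; _⊔_; _≤ᵇ_; _<ᵇ_; _≡ᵇ_)
open import Data.Nat.Properties
open import Data.Nat.Solver using (module +-*-Solver)
open import Data.Bool using (Bool; true; false; T; _∧_)
open import Data.Bool.Properties using (T-∧)
open import Data.Fin using (Fin; zero; suc; toℕ; inject₁; fromℕ<; punchOut)
open import Data.Fin.Properties using (toℕ-injective; toℕ-inject₁; toℕ<n; toℕ-fromℕ<; fromℕ<-toℕ; injective⇒≤; punchOut-injective)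
open import Data.Vec using (Vec; []; _∷_; lookup; tabulate)
open import Data.Vec.Properties using (lookup∘tabulate; tabulate∘lookup; tabulate-∘; tabulate-cong)
open import Data.Vec.Functional using () renaming (_∷_ to _◂_)
open import Data.List.Membership.Propositional using (_∈_)
open import Data.Maybe using (Maybe; just; nothing)
open import Data.Product using (Σ; _×_; _,_; proj₁; proj₂)
open import Data.Sum using (inj₁; inj₂; [_,_]′)
open import Data.Empty using (⊥; ⊥-elim)
open import Data.Unit using (⊤; tt)
open import Relation.Nullary using (¬_; Dec; yes; no; recompute)
open import Relation.Binary.Definitions using (tri<; tri≈; tri>)
open import Relation.Binary.PropositionalEquality using (_≡_; _≢_; refl; sym; trans; cong; cong₂; subst; subst₂)
open import Function using (_∘_)
open import Function.Bundles using (module Equivalence)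

-- Why a priority exists: if the free positions of σ are perturbed slightly, the joint order type of
-- the old and the new placement depends only on which positions move up, so each direction of
-- movement either always increases the value or never does. Raising every free position increases
-- it, raising none does not; where this flips, one position outweighs all others. Interpolation in
-- small steps and monotonicity extend this to large moves. Why either letters or traces decide:
-- suppose two placements agree on the first k letters but compare against the order of letter k.
-- Squeezing shows that the trace on top then stays on top in every such placement. Along a
-- descending sequence ω² forbids an endless chain of this kind: the first k letters take fixed
-- natural numbers as values, and the rest is squeezed into ω·(1+ω). So some member dominates no
-- later one; all later traces are tied to it and, through it, to each other. Why one oracle serves
-- all models: which position is letter k of a trace depends on D alone, but it is found by excluded
-- middle rather than computed from D.

module Priorities (lem : ∀ {ℓ} → ExcludedMiddle ℓ) (D : Predilator) where

  -- Classical logic and total preorders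

  dec : ∀ {ℓ} (P : Set ℓ) → Dec P
  dec P = lem

  by-contra : ∀ {ℓ} {P : Set ℓ} → ¬ ¬ P → P
  by-contra {P = P} nn with dec P
  ... | yes p = p
  ... | no np = ⊥-elim (nn np)

  -- Antisymmetry is left out because points such as those of `Σ ℕ (elem α)` carry proofs; `Eqv`
  -- plays the role of equality throughout.
  record Tot (A : Ord) : Set where
    field
      ≼-refl  : ∀ {x} → Le A x x
      ≼-trans : ∀ {x y z} → Le A x y → Le A y z → Le A x z
      ≼-total : ∀ x y → Le A x y ⊎ Le A y x

  open Tot public

  ωO-tot : Tot ωO
  ωO-tot = record { ≼-refl = ≤-refl ; ≼-trans = ≤-trans ; ≼-total = ≤-total }

  module _ {A : Ord} (T : Tot A) where

    ⋠⇒≺ : ∀ {x y} → ¬ Le A y x → Lt A x y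
    ⋠⇒≺ {x} {y} n with ≼-total T x y
    ... | inj₁ p = p , n
    ... | inj₂ q = ⊥-elim (n q)

    ≺-≼-trans : ∀ {x y z} → Lt A x y → Le A y z → Lt A x z
    ≺-≼-trans (p , n) q = ≼-trans T p q , λ r → n (≼-trans T q r)

    ≼-≺-trans : ∀ {x y z} → Le A x y → Lt A y z → Lt A x z
    ≼-≺-trans p (q , n) = ≼-trans T p q , λ r → n (≼-trans T r p)

    ≈-trans : ∀ {x y z} → Eqv A x y → Eqv A y z → Eqv A x z
    ≈-trans (p , q) (r , s) = ≼-trans T p r , ≼-trans T s q

  ≡⇒≈ : ∀ {A} → Tot A → ∀ {x y : Car A} → x ≡ y → Eqv A x y
  ≡⇒≈ T {x} refl = ≼-refl T {x} , ≼-refl T {x}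

  ≈-sym : ∀ (A : Ord) {x y} → Eqv A x y → Eqv A y x
  ≈-sym A (p , q) = q , p

  lex-tot : ∀ {A B} → Tot A → Tot B → Tot (lex A B)
  lex-tot {A} {B} S T = record
    { ≼-refl  = inj₂ ((≼-refl S , ≼-refl S) , ≼-refl T)
    ; ≼-trans = tr
    ; ≼-total = to }
    where
    tr : ∀ {x y z} → Le (lex A B) x y → Le (lex A B) y z → Le (lex A B) x z
    tr (inj₁ p) (inj₁ q) = inj₁ (≺-≼-trans S p (proj₁ q))
    tr (inj₁ p) (inj₂ (q , _)) = inj₁ (≺-≼-trans S p (proj₁ q))
    tr (inj₂ (p , _)) (inj₁ q) = inj₁ (≼-≺-trans S (proj₁ p) q)
    tr (inj₂ (p , r)) (inj₂ (q , s)) = inj₂ (≈-trans S p q , ≼-trans T r s)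
    to : ∀ x y → Le (lex A B) x y ⊎ Le (lex A B) y x
    to (a , b) (a' , b') with dec (Le A a a') | dec (Le A a' a)
    ... | no n  | _     = inj₂ (inj₁ (⋠⇒≺ S n))
    ... | yes _ | no n  = inj₁ (inj₁ (⋠⇒≺ S n))
    ... | yes p | yes q with ≼-total T b b'
    ...   | inj₁ r = inj₁ (inj₂ ((p , q) , r))
    ...   | inj₂ r = inj₂ (inj₂ ((q , p) , r))

  lex-≺ : ∀ A B (x y : Car (lex A B)) → Lt A (proj₁ x) (proj₁ y) → Lt (lex A B) x y
  lex-≺ A B x y p = inj₁ p , λ { (inj₁ q) → proj₂ p (proj₁ q) ; (inj₂ (q , _)) → proj₂ p (proj₁ q) }

  lex-≈≺ : ∀ A B (x y : Car (lex A B)) → Eqv A (proj₁ x) (proj₁ y) → Lt B (proj₂ x) (proj₂ y) → Lt (lex A B) x y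
  lex-≈≺ A B x y e p = inj₂ (e , proj₁ p) , λ { (inj₁ q) → proj₂ q (proj₁ e) ; (inj₂ (_ , q)) → proj₂ p q }

  -- Finite increasing families and their unions

  Inc : (A : Ord) {n : ℕ} → (Fin n → Car A) → Set
  Inc A {n} a = ∀ (i j : Fin n) → toℕ i < toℕ j → Lt A (a i) (a j)

  IncF : {n l : ℕ} → (Fin n → Fin l) → Set
  IncF {n} f = ∀ (i j : Fin n) → toℕ i < toℕ j → toℕ (f i) < toℕ (f j)

  <⇒≺ω : ∀ {x y} → x < y → Lt ωO x y
  <⇒≺ω p = <⇒≤ p , <⇒≱ p

  ≺ω⇒< : ∀ {x y} → Lt ωO x y → x < y
  ≺ω⇒< (_ , n) = ≰⇒> n

  module _ (A : Ord) {n : ℕ} {a : Fin n → Car A} (ia : Inc A a) where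

    inc-≼⁻ : ∀ i j → Le A (a i) (a j) → toℕ i ≤ toℕ j
    inc-≼⁻ i j p with <-cmp (toℕ i) (toℕ j)
    ... | tri< l _ _ = <⇒≤ l
    ... | tri≈ _ e _ = subst (toℕ i ≤_) e ≤-refl
    ... | tri> _ _ g = ⊥-elim (proj₂ (ia j i g) p)

    inc-≺⁻ : Tot A → ∀ i j → Lt A (a i) (a j) → toℕ i < toℕ j
    inc-≺⁻ T i j (p , n) with <-cmp (toℕ i) (toℕ j)
    ... | tri< l _ _ = l
    ... | tri≈ _ e _ = ⊥-elim (n (subst (λ k → Le A (a k) (a i)) (toℕ-injective e) (≼-refl T)))
    ... | tri> _ _ g = ⊥-elim (proj₂ (ia j i g) p)

    inc-≈⁻ : ∀ i j → Eqv A (a i) (a j) → i ≡ j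
    inc-≈⁻ i j (p , q) = toℕ-injective (≤-antisym (inc-≼⁻ i j p) (inc-≼⁻ j i q))

    inc-≼ : Tot A → ∀ i j → toℕ i ≤ toℕ j → Le A (a i) (a j)
    inc-≼ T i j p with dec (Le A (a i) (a j))
    ... | yes q = q
    ... | no nq = ⊥-elim (<⇒≱ (inc-≺⁻ T j i (⋠⇒≺ T nq)) p)

  -- The union a ∪ b with its two inclusions, up to `Eqv`: the data of `BarLeq` with functions in
  -- place of vectors.
  record Amalgam (A : Ord) {n m : ℕ} (a : Fin n → Car A) (b : Fin m → Car A) : Set where
    field
      size    : ℕ
      pts     : Fin size → Car A
      pts-inc : Inc A pts
      ι₁      : Fin n → Fin size
      ι₂      : Fin m → Fin size
      ι₁-ok   : ∀ i → Eqv A (pts (ι₁ i)) (a i)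
      ι₂-ok   : ∀ j → Eqv A (pts (ι₂ j)) (b j)
      cover   : ∀ p → (Σ (Fin n) λ i → ι₁ i ≡ p) ⊎ (Σ (Fin m) λ j → ι₂ j ≡ p)

  open Amalgam

  swap : ∀ {A n m} {a : Fin n → Car A} {b : Fin m → Car A} → Amalgam A a b → Amalgam A b a
  swap M = record
    { size = size M ; pts = pts M ; pts-inc = pts-inc M ; ι₁ = ι₂ M ; ι₂ = ι₁ M
    ; ι₁-ok = ι₂-ok M ; ι₂-ok = ι₁-ok M
    ; cover = λ p → [ inj₂ , inj₁ ]′ (cover M p) }

  module _ {A : Ord} (T : Tot A) where

    push : ∀ {n m} (x : Car A) {a : Fin n → Car A} {b : Fin m → Car A} (M : Amalgam A a b) →
           (∀ i → Lt A x (a i)) → (∀ j → Lt A x (b j)) → Inc A (x ◂ pts M)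
    push x M la lb zero (suc q) _ with cover M q
    ... | inj₁ (i , refl) = ≺-≼-trans T (la i) (proj₂ (ι₁-ok M i))
    ... | inj₂ (j , refl) = ≺-≼-trans T (lb j) (proj₂ (ι₂-ok M j))
    push x M la lb (suc p) (suc q) (s≤s l) = pts-inc M p q l

    merge-left : ∀ {n m} (a : Fin (suc n) → Car A) (b : Fin m → Car A) → Inc A a →
                 (∀ j → Lt A (a zero) (b j)) → Amalgam A (a ∘ suc) b → Amalgam A a b
    merge-left a b ia lb M = record
      { size = suc (size M)
      ; pts = a zero ◂ pts M
      ; pts-inc = push (a zero) M (λ i → ia zero (suc i) (s≤s z≤n)) lb
      ; ι₁ = λ { zero → zero ; (suc i) → suc (ι₁ M i) }
      ; ι₂ = λ j → suc (ι₂ M j)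
      ; ι₁-ok = λ { zero → ≼-refl T , ≼-refl T ; (suc i) → ι₁-ok M i }
      ; ι₂-ok = ι₂-ok M
      ; cover = λ { zero → inj₁ (zero , refl)
                  ; (suc p) → [ (λ (i , e) → inj₁ (suc i , cong suc e))
                                  , (λ (j , e) → inj₂ (j , cong suc e)) ]′ (cover M p) } }

    merge-both : ∀ {n m} (a : Fin (suc n) → Car A) (b : Fin (suc m) → Car A) → Inc A a → Inc A b →
                 Eqv A (a zero) (b zero) → Amalgam A (a ∘ suc) (b ∘ suc) → Amalgam A a b
    merge-both a b ia ib e M = record
      { size = suc (size M)
      ; pts = a zero ◂ pts M
      ; pts-inc = push (a zero) M (λ i → ia zero (suc i) (s≤s z≤n))
                                      (λ j → ≼-≺-trans T (proj₁ e) (ib zero (suc j) (s≤s z≤n)))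
      ; ι₁ = λ { zero → zero ; (suc i) → suc (ι₁ M i) }
      ; ι₂ = λ { zero → zero ; (suc j) → suc (ι₂ M j) }
      ; ι₁-ok = λ { zero → ≼-refl T , ≼-refl T ; (suc i) → ι₁-ok M i }
      ; ι₂-ok = λ { zero → e ; (suc j) → ι₂-ok M j }
      ; cover = λ { zero → inj₁ (zero , refl)
                  ; (suc p) → [ (λ (i , e) → inj₁ (suc i , cong suc e))
                                  , (λ (j , e) → inj₂ (suc j , cong suc e)) ]′ (cover M p) } }

    merge : ∀ {n m} (a : Fin n → Car A) (b : Fin m → Car A) → Inc A a → Inc A b → Amalgam A a b
    merge {zero} {zero} a b ia ib = record
      { size = 0 ; pts = λ () ; pts-inc = λ () ; ι₁ = λ () ; ι₂ = λ ()
      ; ι₁-ok = λ () ; ι₂-ok = λ () ; cover = λ () }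
    merge {suc n} {zero} a b ia ib =
      merge-left a b ia (λ ()) (merge (a ∘ suc) b (λ i j l → ia (suc i) (suc j) (s≤s l)) ib)
    merge {zero} {suc m} a b ia ib =
      swap (merge-left b a ib (λ ()) (swap (merge a (b ∘ suc) ia (λ i j l → ib (suc i) (suc j) (s≤s l)))))
    merge {suc n} {suc m} a b ia ib
      with dec (Le A (a zero) (b zero)) | dec (Le A (b zero) (a zero))
    ... | yes p | yes q =
          merge-both a b ia ib (p , q)
            (merge (a ∘ suc) (b ∘ suc) (λ i j l → ia (suc i) (suc j) (s≤s l))
                                               (λ i j l → ib (suc i) (suc j) (s≤s l)))
    ... | yes p | no q =
          merge-left a b ia (λ j → ≺-≼-trans T (p , q) (inc-≼ A ib T zero j z≤n))
            (merge (a ∘ suc) b (λ i j l → ia (suc i) (suc j) (s≤s l)) ib)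
    ... | no p | _ =
          swap (merge-left b a ib (λ j → ≺-≼-trans T (⋠⇒≺ T p) (inc-≼ A ia T zero j z≤n))
            (swap (merge a (b ∘ suc) ia (λ i j l → ib (suc i) (suc j) (s≤s l)))))

    ι-inc : ∀ {n l} {a : Fin n → Car A} {c : Fin l → Car A} → Inc A a → Inc A c →
            (ι : Fin n → Fin l) → (∀ i → Eqv A (c (ι i)) (a i)) → IncF ι
    ι-inc ia ic ι ok i j l =
      inc-≺⁻ A ic T (ι i) (ι j)
        (≼-≺-trans T (proj₁ (ok i)) (≺-≼-trans T (ia i j l) (proj₂ (ok j))))

  -- The order of D̄(A) on placements

  actF : {m n : ℕ} → (Fin m → Fin n) → ℕ → ℕ
  actF f = act D (tabulate f)

  tab-emb : ∀ {m n} {f : Fin m → Fin n} → IncF f → IsEmb (tabulate f)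
  tab-emb {f = f} h i j l =
    subst₂ (λ u v → toℕ u < toℕ v) (sym (lookup∘tabulate f i)) (sym (lookup∘tabulate f j)) (h i j l)

  actF-cong : ∀ {m n} {f g : Fin m → Fin n} → (∀ i → f i ≡ g i) → ∀ σ → actF f σ ≡ actF g σ
  actF-cong e σ = cong (λ v → act D v σ) (tabulate-cong e)

  actF-mem : ∀ {m n} {f : Fin m → Fin n} → IncF f → ∀ {σ} → mem D m σ ≡ true → mem D n (actF f σ) ≡ true
  actF-mem h = act-mem D _ _ (tab-emb h)

  actF-comp : ∀ {m n k} {g : Fin n → Fin k} {f : Fin m → Fin n} → IncF g → IncF f → ∀ {σ} →
              mem D m σ ≡ true → actF (g ∘ f) σ ≡ actF g (actF f σ)
  actF-comp {g = g} {f} hg hf {σ} mσ =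
    trans (cong (λ v → act D v σ)
            (trans (tabulate-cong (λ i → sym (lookup∘tabulate g (f i)))) (tabulate-∘ (lookup (tabulate g)) f)))
          (act-comp D _ _ σ (tab-emb hg) (tab-emb hf) mσ)

  Leq : (A : Ord) {n m : ℕ} → ℕ → (Fin n → Car A) → ℕ → (Fin m → Car A) → Set
  Leq A σ a τ b = Σ (Amalgam A a b) λ M → leq D (size M) (actF (ι₁ M) σ) (actF (ι₂ M) τ) ≡ true

  module _ {A : Ord} (T : Tot A) {n m : ℕ} {a : Fin n → Car A} {b : Fin m → Car A}
           (ia : Inc A a) (ib : Inc A b) {σ τ : ℕ}
           (mσ : mem D n σ ≡ true) (mτ : mem D m τ ≡ true)
           {l : ℕ} {c : Fin l → Car A} (ic : Inc A c)
           {f : Fin n → Fin l} {g : Fin m → Fin l}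
           (fok : ∀ i → Eqv A (c (f i)) (a i)) (gok : ∀ j → Eqv A (c (g j)) (b j)) where

    private
      -- Every point of the amalgam comes from a or b, so it embeds into any family c that contains
      -- both; D of that embedding preserves and reflects ≤. Hence any common finite superset may be
      -- used for a comparison.
      through : (M : Amalgam A a b) → Iff (leq D (size M) (actF (ι₁ M) σ) (actF (ι₂ M) τ) ≡ true)
                                          (leq D l (actF f σ) (actF g τ) ≡ true)
      through M = subst (λ z → Iff (leq D (size M) (actF (ι₁ M) σ) (actF (ι₂ M) τ) ≡ true) (z ≡ true)) (cong₂ (leq D l) (sym eσ) (sym eτ))
                    (act-leq D (tabulate h) _ _ (tab-emb hinc) (actF-mem inc₁ mσ) (actF-mem inc₂ mτ))
        where
        h : Fin (size M) → Fin l
        h p with cover M p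
        ... | inj₁ (i , _) = f i
        ... | inj₂ (j , _) = g j
        h-ok : ∀ p → Eqv A (c (h p)) (pts M p)
        h-ok p with cover M p
        ... | inj₁ (i , refl) = ≈-trans T (fok i) (≈-sym A (ι₁-ok M i))
        ... | inj₂ (j , refl) = ≈-trans T (gok j) (≈-sym A (ι₂-ok M j))
        hinc = ι-inc T (pts-inc M) ic h h-ok
        inc₁ = ι-inc T ia (pts-inc M) (ι₁ M) (ι₁-ok M)
        inc₂ = ι-inc T ib (pts-inc M) (ι₂ M) (ι₂-ok M)
        eσ : actF f σ ≡ actF h (actF (ι₁ M) σ)
        eσ = trans (actF-cong (λ i → inc-≈⁻ A ic _ _ (≈-trans T (fok i)
                      (≈-sym A (≈-trans T (h-ok (ι₁ M i)) (ι₁-ok M i))))) σ)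
                   (actF-comp hinc inc₁ mσ)
        eτ : actF g τ ≡ actF h (actF (ι₂ M) τ)
        eτ = trans (actF-cong (λ i → inc-≈⁻ A ic _ _ (≈-trans T (gok i)
                      (≈-sym A (≈-trans T (h-ok (ι₂ M i)) (ι₂-ok M i))))) τ)
                   (actF-comp hinc inc₂ mτ)

    Leq⇒leq : Leq A σ a τ b → leq D l (actF f σ) (actF g τ) ≡ true
    Leq⇒leq (M , p) = proj₁ (through M) p

    leq⇒Leq : leq D l (actF f σ) (actF g τ) ≡ true → Leq A σ a τ b
    leq⇒Leq p = merge T a b ia ib , proj₂ (through (merge T a b ia ib)) p

  _⊑_ : {A : Ord} → BarElt D A → BarElt D A → Set
  _⊑_ {A} x y = Leq A (sig x) (el x) (sig y) (el y)

  -- The strict order in negated form: it implies ⊑ by totality and feeds directly into arguments by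
  -- contradiction.
  _⊏_ : {A : Ord} → BarElt D A → BarElt D A → Set
  x ⊏ y = ¬ (y ⊑ x)

  infix 4 _⊑_ _⊏_

  Bar⇒⊑ : ∀ {A} {x y : BarElt D A} → BarLeq D A x y → x ⊑ y
  Bar⇒⊑ {A} {x} {y} r = record
    { size = lc ; pts = c ; pts-inc = c-inc ; ι₁ = lookup f ; ι₂ = lookup g
    ; ι₁-ok = f-ok ; ι₂-ok = g-ok ; cover = BarLeq.cover r }
    , trans (cong₂ (λ u v → leq D lc (act D u (sig x)) (act D v (sig y))) (tabulate∘lookup f) (tabulate∘lookup g)) cmp
    where open BarLeq r

  ⊑⇒Bar : ∀ {A} → Tot A → {x y : BarElt D A} → x ⊑ y → BarLeq D A x y
  ⊑⇒Bar {A} T {x} {y} (M , p) = record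
    { lc = size M ; c = pts M ; c-inc = pts-inc M ; f = tabulate (ι₁ M) ; g = tabulate (ι₂ M)
    ; f-emb = tab-emb (ι-inc T (el-inc x) (pts-inc M) (ι₁ M) (ι₁-ok M))
    ; g-emb = tab-emb (ι-inc T (el-inc y) (pts-inc M) (ι₂ M) (ι₂-ok M))
    ; f-ok = λ i → subst (λ q → Eqv A (pts M q) (el x i)) (sym (lookup∘tabulate (ι₁ M) i)) (ι₁-ok M i)
    ; g-ok = λ i → subst (λ q → Eqv A (pts M q) (el y i)) (sym (lookup∘tabulate (ι₂ M) i)) (ι₂-ok M i)
    ; cover = λ q → [ (λ (i , e) → inj₁ (i , trans (lookup∘tabulate (ι₁ M) i) e))
                    , (λ (i , e) → inj₂ (i , trans (lookup∘tabulate (ι₂ M) i) e)) ]′ (cover M q)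
    ; cmp = p }

  module _ {A : Ord} (T : Tot A) where

    ⊑-total : (x y : BarElt D A) → x ⊑ y ⊎ y ⊑ x
    ⊑-total x y with merge T (el x) (el y) (el-inc x) (el-inc y)
    ... | M with leq-total D (size M) (actF (ι₁ M) (sig x)) (actF (ι₂ M) (sig y))
                   (actF-mem (ι-inc T (el-inc x) (pts-inc M) (ι₁ M) (ι₁-ok M)) (sig-mem x))
                   (actF-mem (ι-inc T (el-inc y) (pts-inc M) (ι₂ M) (ι₂-ok M)) (sig-mem y))
    ... | inj₁ p = inj₁ (M , p)
    ... | inj₂ p = inj₂ (swap M , p)

    -- The union of the two given amalgams contains all three families, and there the claim is
    -- transitivity in a single D(n).
    ⊑-trans : (x y z : BarElt D A) → x ⊑ y → y ⊑ z → x ⊑ z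
    ⊑-trans x y z (M , p) (N , q) with merge T (pts M) (pts N) (pts-inc M) (pts-inc N)
    ... | K = leq⇒Leq T (el-inc x) (el-inc z) (sig-mem x) (sig-mem z) (pts-inc K) okx okz
                (leq-trans D _ _ _ _ (mm x okx) (mm y oky) (mm z okz)
                  (Leq⇒leq T (el-inc x) (el-inc y) (sig-mem x) (sig-mem y) (pts-inc K) okx oky (M , p))
                  (Leq⇒leq T (el-inc y) (el-inc z) (sig-mem y) (sig-mem z) (pts-inc K) oky okz (N , q)))
      where
      okx : ∀ i → Eqv A (pts K (ι₁ K (ι₁ M i))) (el x i)
      okx i = ≈-trans T (ι₁-ok K _) (ι₁-ok M i)
      oky : ∀ i → Eqv A (pts K (ι₁ K (ι₂ M i))) (el y i)
      oky i = ≈-trans T (ι₁-ok K _) (ι₂-ok M i)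
      okz : ∀ i → Eqv A (pts K (ι₂ K (ι₂ N i))) (el z i)
      okz i = ≈-trans T (ι₂-ok K _) (ι₂-ok N i)
      mm : (w : BarElt D A) → ∀ {ι : Fin (len w) → Fin (size K)} → (∀ i → Eqv A (pts K (ι i)) (el w i)) →
           mem D (size K) (actF ι (sig w)) ≡ true
      mm w ok = actF-mem (ι-inc T (el-inc w) (pts-inc K) _ ok) (sig-mem w)

  -- Only comparisons across the two families are recorded; those inside each family are fixed by
  -- `Inc`.
  record SameType (A B : Ord) {n m : ℕ} (a : Fin n → Car A) (b : Fin m → Car A)
                  (a' : Fin n → Car B) (b' : Fin m → Car B) : Set where
    field
      fwd : ∀ i j → Iff (Le A (a i) (b j)) (Le B (a' i) (b' j))
      bwd : ∀ i j → Iff (Le A (b j) (a i)) (Le B (b' j) (a' i))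

  module _ {A B : Ord} {n m : ℕ} {a : Fin n → Car A} {b : Fin m → Car A}
           {a' : Fin n → Car B} {b' : Fin m → Car B} (S : SameType A B a b a' b') where

    open SameType S

    type-sym : SameType B A a' b' a b
    type-sym = record { fwd = λ i j → proj₂ (fwd i j) , proj₁ (fwd i j)
                      ; bwd = λ i j → proj₂ (bwd i j) , proj₁ (bwd i j) }

    type-swap : SameType A B b a b' a'
    type-swap = record { fwd = λ i j → bwd j i ; bwd = λ i j → fwd j i }

    type-≺ : ∀ {i j} → Lt A (a i) (b j) → Lt B (a' i) (b' j)
    type-≺ {i} {j} (p , q) = proj₁ (fwd i j) p , λ z → q (proj₂ (bwd i j) z)

    type-≻ : ∀ {i j} → Lt A (b j) (a i) → Lt B (b' j) (a' i)
    type-≻ {i} {j} (p , q) = proj₁ (bwd i j) p , λ z → q (proj₂ (fwd i j) z)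

    type-≈ : ∀ {i j} → Eqv A (a i) (b j) → Eqv B (a' i) (b' j)
    type-≈ {i} {j} (p , q) = proj₁ (fwd i j) p , proj₁ (bwd i j) q

  type-trans : ∀ {A B C n m} {a : Fin n → Car A} {b : Fin m → Car A} {a' : Fin n → Car B} {b' : Fin m → Car B}
               {a'' : Fin n → Car C} {b'' : Fin m → Car C} →
               SameType A B a b a' b' → SameType B C a' b' a'' b'' → SameType A C a b a'' b''
  type-trans S R = record
    { fwd = λ i j → (λ p → proj₁ (fwd R i j) (proj₁ (fwd S i j) p)) , (λ p → proj₂ (fwd S i j) (proj₂ (fwd R i j) p))
    ; bwd = λ i j → (λ p → proj₁ (bwd R i j) (proj₁ (bwd S i j) p)) , (λ p → proj₂ (bwd S i j) (proj₂ (bwd R i j) p)) }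
    where open SameType

  module _ {A B : Ord} (S : Tot A) (T : Tot B) {n m : ℕ} {a : Fin n → Car A} {b : Fin m → Car A}
           {a' : Fin n → Car B} {b' : Fin m → Car B} (st : SameType A B a b a' b')
           (ia : Inc A a) (ib : Inc A b) (ia' : Inc B a') (ib' : Inc B b') where

    -- The index set and the inclusions of an amalgam depend only on the joint type, so the same
    -- ones work once each point is replaced by its counterpart.
    transfer : ∀ {σ τ} → Leq A σ a τ b → Leq B σ a' τ b'
    transfer (M , p) = record
      { size = size M ; pts = pts' ; pts-inc = λ p q → inc p q (cover M p) (cover M q)
      ; ι₁ = ι₁ M ; ι₂ = ι₂ M
      ; ι₁-ok = λ i → ok₁ i (cover M (ι₁ M i)) ; ι₂-ok = λ j → ok₂ j (cover M (ι₂ M j))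
      ; cover = cover M } , p
      where
      Cov : Fin (size M) → Set
      Cov p = (Σ (Fin n) λ i → ι₁ M i ≡ p) ⊎ (Σ (Fin m) λ j → ι₂ M j ≡ p)
      at : ∀ p → Cov p → Car B
      at p (inj₁ (i , _)) = a' i
      at p (inj₂ (j , _)) = b' j
      pts' : Fin (size M) → Car B
      pts' p = at p (cover M p)
      o₁ = ι₁-ok M
      o₂ = ι₂-ok M
      sandwich : ∀ {x y u v} → Eqv A u x → Eqv A v y → Lt A u v → Lt A x y
      sandwich e d l = ≼-≺-trans S (proj₂ e) (≺-≼-trans S l (proj₁ d))
      inc : ∀ p q (u : Cov p) (v : Cov q) → toℕ p < toℕ q → Lt B (at p u) (at q v)
      inc _ _ (inj₁ (i , refl)) (inj₁ (j , refl)) l =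
        ia' i j (inc-≺⁻ A ia S i j (sandwich (o₁ i) (o₁ j) (pts-inc M _ _ l)))
      inc _ _ (inj₁ (i , refl)) (inj₂ (j , refl)) l = type-≺ st (sandwich (o₁ i) (o₂ j) (pts-inc M _ _ l))
      inc _ _ (inj₂ (i , refl)) (inj₁ (j , refl)) l = type-≻ st (sandwich (o₂ i) (o₁ j) (pts-inc M _ _ l))
      inc _ _ (inj₂ (i , refl)) (inj₂ (j , refl)) l =
        ib' i j (inc-≺⁻ A ib S i j (sandwich (o₂ i) (o₂ j) (pts-inc M _ _ l)))
      eqv : ∀ {x y u v} → Eqv A u x → Eqv A v y → u ≡ v → Eqv A x y
      eqv e d refl = ≈-trans S (≈-sym A e) d
      ok₁ : ∀ i (u : Cov (ι₁ M i)) → Eqv B (at _ u) (a' i)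
      ok₁ i (inj₁ (j , e)) with inc-≈⁻ A ia j i (eqv (o₁ j) (o₁ i) (cong (pts M) e))
      ... | refl = ≼-refl T , ≼-refl T
      ok₁ i (inj₂ (j , e)) = ≈-sym B (type-≈ st (≈-sym A (eqv (o₂ j) (o₁ i) (cong (pts M) e))))
      ok₂ : ∀ i (u : Cov (ι₂ M i)) → Eqv B (at _ u) (b' i)
      ok₂ i (inj₁ (j , e)) = type-≈ st (eqv (o₁ j) (o₂ i) (cong (pts M) e))
      ok₂ i (inj₂ (j , e)) with inc-≈⁻ A ib j i (eqv (o₂ j) (o₂ i) (cong (pts M) e))
      ... | refl = ≼-refl T , ≼-refl T

  module _ {A : Ord} (T : Tot A) {n : ℕ} {a b : Fin n → Car A} (ia : Inc A a) (ib : Inc A b)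
           {σ : ℕ} (mσ : mem D n σ ≡ true) where

    private
      M = merge T a b ia ib
      inc₁ = ι-inc T ia (pts-inc M) (ι₁ M) (ι₁-ok M)
      inc₂ = ι-inc T ib (pts-inc M) (ι₂ M) (ι₂-ok M)

      leq-mono : ∀ {l} {f g : Fin n → Fin l} → IncF f → IncF g → (∀ i → toℕ (f i) ≤ toℕ (g i)) →
                 leq D l (actF f σ) (actF g σ) ≡ true
      leq-mono {f = f} {g} hf hg le =
        act-mono D _ _ σ (tab-emb hf) (tab-emb hg)
          (λ i → subst₂ (λ u v → toℕ u ≤ toℕ v) (sym (lookup∘tabulate f i)) (sym (lookup∘tabulate g i)) (le i)) mσ

    Leq-mono : (∀ i → Le A (a i) (b i)) → Leq A σ a σ b
    Leq-mono le = M , leq-mono inc₁ inc₂ (λ i → inc-≼⁻ A (pts-inc M) _ _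
        (≼-trans T (proj₁ (ι₁-ok M i)) (≼-trans T (le i) (proj₂ (ι₂-ok M i)))))

  -- Traces and strict monotonicity

  inc-≥ : ∀ {n l} (h : Fin n → Fin l) → IncF h → ∀ j → toℕ j ≤ toℕ (h j)
  inc-≥ h ih zero = z≤n
  inc-≥ {suc n} h ih (suc j) =
    ≤-<-trans (inc-≥ (h ∘ inject₁) (λ i k p → ih _ _ (subst₂ _<_ (sym (toℕ-inject₁ i)) (sym (toℕ-inject₁ k)) p)) j)
              (ih (inject₁ j) (suc j) (s≤s (subst (_≤ toℕ j) (sym (toℕ-inject₁ j)) ≤-refl)))

  -- The proofs are irrelevant, so that a trace is determined by its two numbers, on which decoding
  -- relies; excluded middle recovers them when needed.
  record Trace : Set where
    field
      ar : ℕ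
      sg : ℕ
      .mem-sg  : mem D ar sg ≡ true
      .supp-sg : ∀ (i : Fin ar) → i ∈ supp D ar sg

  open Trace public

  trace-mem : (t : Trace) → mem D (ar t) (sg t) ≡ true
  trace-mem record { mem-sg = m } = recompute lem m

  trace-supp : (t : Trace) → ∀ (i : Fin (ar t)) → i ∈ supp D (ar t) (sg t)
  trace-supp record { supp-sg = s } = recompute lem s

  place : ∀ {A} (t : Trace) (a : Fin (ar t) → Car A) → Inc A a → BarElt D A
  place t a ia = record
    { len = ar t ; el = a ; el-inc = ia ; sig = sg t ; sig-mem = trace-mem t ; sig-supp = trace-supp t }

  traceOf : ∀ {A} → BarElt D A → Trace
  traceOf x = record { ar = len x ; sg = sig x ; mem-sg = sig-mem x ; supp-sg = sig-supp x }

  -- If the two placements had equal values, naturality of supports would make their ranges coincide.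
  strict : ∀ {A} → Tot A → (t : Trace) {a b : Fin (ar t) → Car A} → Inc A a → Inc A b →
           (∀ i → Le A (a i) (b i)) → ∀ j → Lt A (a j) (b j) → ¬ Leq A (sg t) b (sg t) a
  strict {A} T t {a} {b} ia ib le j lt (M , p) = <⇒≱ ι₂j<ι₁j (subst (toℕ (ι₁ M j) ≤_) (cong toℕ (proj₂ (back j))) (mono-le j (proj₁ (back j)) (inc-≥ h h-inc j)))
    where
    inc₁ = ι-inc T ib (pts-inc M) (ι₁ M) (ι₁-ok M)
    inc₂ = ι-inc T ia (pts-inc M) (ι₂ M) (ι₂-ok M)
    ι₂≤ι₁ : ∀ i → toℕ (ι₂ M i) ≤ toℕ (ι₁ M i)
    ι₂≤ι₁ i = inc-≼⁻ A (pts-inc M) _ _ (≼-trans T (proj₁ (ι₂-ok M i)) (≼-trans T (le i) (proj₂ (ι₁-ok M i))))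
    ι₂j<ι₁j : toℕ (ι₂ M j) < toℕ (ι₁ M j)
    ι₂j<ι₁j = inc-≺⁻ A (pts-inc M) T _ _ (≼-≺-trans T (proj₁ (ι₂-ok M j)) (≺-≼-trans T lt (proj₂ (ι₁-ok M j))))
    m = trace-mem t
    same : actF (ι₂ M) (sg t) ≡ actF (ι₁ M) (sg t)
    same = leq-antisym D _ _ _ (actF-mem inc₂ m) (actF-mem inc₁ m)
             (act-mono D _ _ _ (tab-emb inc₂) (tab-emb inc₁)
               (λ i → subst₂ (λ u v → toℕ u ≤ toℕ v) (sym (lookup∘tabulate (ι₂ M) i)) (sym (lookup∘tabulate (ι₁ M) i)) (ι₂≤ι₁ i)) m)
             p
    back : ∀ i → Σ (Fin (ar t)) λ k → ι₁ M k ≡ ι₂ M i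
    back i with proj₁ (supp-nat D (tabulate (ι₁ M)) (sg t) (tab-emb inc₁) m (ι₂ M i))
                  (subst (λ z → ι₂ M i ∈ supp D (size M) z) same
                    (proj₂ (supp-nat D (tabulate (ι₂ M)) (sg t) (tab-emb inc₂) m (ι₂ M i))
                      (i , trace-supp t i , lookup∘tabulate (ι₂ M) i)))
    ... | k , _ , e = k , trans (sym (lookup∘tabulate (ι₁ M) k)) e
    -- Being increasing, `h` satisfies j ≤ h j, so ι₁ j ≤ ι₁ (h j) = ι₂ j, against ι₂ j < ι₁ j.
    h = λ i → proj₁ (back i)
    mono-le : ∀ i k → toℕ i ≤ toℕ k → toℕ (ι₁ M i) ≤ toℕ (ι₁ M k)
    mono-le i k l = inc-≼⁻ A (pts-inc M) _ _ (≼-trans T (proj₁ (ι₁-ok M i)) (≼-trans T (inc-≼ A ib T i k l) (proj₂ (ι₁-ok M k))))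
    h-inc : IncF h
    h-inc i k l with <-cmp (toℕ (h i)) (toℕ (h k))
    ... | tri< q _ _ = q
    ... | tri≈ _ e _ = ⊥-elim (<-irrefl (cong toℕ (trans (sym (proj₂ (back i))) (trans (cong (ι₁ M) (toℕ-injective e)) (proj₂ (back k))))) (inc₂ i k l))
    ... | tri> _ _ g = ⊥-elim (<-asym (inc₂ i k l) (subst₂ (λ u v → toℕ u < toℕ v) (proj₂ (back k)) (proj₂ (back i)) (inc₁ _ _ g)))

  -- Reduces every comparison to placements in ℕ.
  module _ {A : Ord} (T : Tot A) {n m : ℕ} {a : Fin n → Car A} {b : Fin m → Car A} (ia : Inc A a) (ib : Inc A b) where

    private M = merge T a b ia ib

    toN₁ : Fin n → ℕ
    toN₁ i = toℕ (ι₁ M i)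

    toN₂ : Fin m → ℕ
    toN₂ j = toℕ (ι₂ M j)

    toN₁-inc : Inc ωO toN₁
    toN₁-inc i j l = <⇒≺ω (ι-inc T ia (pts-inc M) (ι₁ M) (ι₁-ok M) i j l)

    toN₂-inc : Inc ωO toN₂
    toN₂-inc i j l = <⇒≺ω (ι-inc T ib (pts-inc M) (ι₂ M) (ι₂-ok M) i j l)

    toN-type : SameType A ωO a b toN₁ toN₂
    toN-type = record { fwd = λ i j → iff (ι₁-ok M i) (ι₂-ok M j) ; bwd = λ i j → iff (ι₂-ok M j) (ι₁-ok M i) }
      where
      iff : ∀ {x y p q} → Eqv A (pts M p) x → Eqv A (pts M q) y → Iff (Le A x y) (toℕ p ≤ toℕ q)
      iff e d = (λ l → inc-≼⁻ A (pts-inc M) _ _ (≼-trans T (proj₁ e) (≼-trans T l (proj₂ d))))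
              , (λ l → ≼-trans T (proj₂ e) (≼-trans T (inc-≼ A (pts-inc M) T _ _ l) (proj₁ d)))

  -- Arithmetic of placements in ℕ

  incN : ∀ {n} {a : Fin n → ℕ} → (∀ i j → toℕ i < toℕ j → a i < a j) → Inc ωO a
  incN h i j l = <⇒≺ω (h i j l)

  ltN : ∀ {n} {a : Fin n → ℕ} → Inc ωO a → ∀ i j → toℕ i < toℕ j → a i < a j
  ltN h i j l = ≺ω⇒< (h i j l)

  both : ∀ {P Q : Set} → P → Q → Iff P Q
  both p q = (λ _ → q) , (λ _ → p)

  neither : ∀ {P Q : Set} → ¬ P → ¬ Q → Iff P Q
  neither p q = (λ x → ⊥-elim (p x)) , (λ x → ⊥-elim (q x))

  bound : ∀ {n} (a : Fin n → ℕ) → Σ ℕ λ B → ∀ i → a i ≤ B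
  bound {zero} a = 0 , λ ()
  bound {suc n} a with bound (a ∘ suc)
  ... | B , h = a zero ⊔ B , λ { zero → m≤m⊔n _ _ ; (suc i) → ≤-trans (h i) (m≤n⊔m (a zero) B) }

  first-failure : (Q : ℕ → Set) → ∀ n → Q 0 → ¬ Q n → Σ ℕ λ t → t < n × Q t × ¬ Q (suc t)
  first-failure Q zero q0 nq = ⊥-elim (nq q0)
  first-failure Q (suc n) q0 nq with dec (Q n)
  ... | yes q = n , ≤-refl , q , nq
  ... | no nq' with first-failure Q n q0 nq'
  ...   | t , l , r = t , m≤n⇒m≤1+n l , r

  -- In base k + 1 a last digit d ≤ k cannot carry; this is the room in which points are perturbed
  -- independently of each other.
  digits : ∀ k {x y d e} → d ≤ k → x < y → suc k * x + d < suc k * y + e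
  digits k {x} {y} {d} {e} d≤k x<y = begin-strict
    suc k * x + d         ≤⟨ +-monoʳ-≤ (suc k * x) d≤k ⟩
    suc k * x + k         <⟨ +-monoʳ-< (suc k * x) (n<1+n k) ⟩
    suc k * x + suc k     ≡⟨ +-comm (suc k * x) (suc k) ⟩
    suc k + suc k * x     ≡⟨ sym (*-suc (suc k) x) ⟩
    suc k * suc x         ≤⟨ *-monoʳ-≤ (suc k) x<y ⟩
    suc k * y             ≤⟨ m≤m+n _ e ⟩
    suc k * y + e         ∎
    where open ≤-Reasoning

  -- Comparisons may be moved to a stretched copy, whose gaps then allow perturbations.
  affine-type : ∀ k c {n m} (a : Fin n → ℕ) (b : Fin m → ℕ) →
                SameType ωO ωO a b (λ i → suc k * a i + c) (λ j → suc k * b j + c)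
  affine-type k c a b = record { fwd = λ i j → iff (a i) (b j) ; bwd = λ i j → iff (b j) (a i) }
    where
    iff : ∀ x y → Iff (x ≤ y) (suc k * x + c ≤ suc k * y + c)
    iff x y = (λ l → +-monoˡ-≤ c (*-monoʳ-≤ (suc k) l))
            , (λ l → *-cancelˡ-≤ (suc k) (+-cancelʳ-≤ c (suc k * x) (suc k * y) l))

  affine-inc : ∀ k c {n} {a : Fin n → ℕ} → Inc ωO a → Inc ωO (λ i → suc k * a i + c)
  affine-inc k c ia = incN (λ i j l → +-monoˡ-< c (*-monoʳ-< (suc k) (ltN ia i j l)))

  -- Existence of a dictating position

  Agree : ∀ {n} → (Fin n → Bool) → (Fin n → ℕ) → (Fin n → ℕ) → Set
  Agree S a b = ∀ s → S s ≡ true → a s ≡ b s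

  -- The position i dictates: with S fixed, raising i increases the value whatever the remaining
  -- positions do.
  Dict : (t : Trace) → (Fin (ar t) → Bool) → Fin (ar t) → Set
  Dict t S i = ∀ a b → Inc ωO a → Inc ωO b → Agree S a b → a i < b i → ¬ Leq ωO (sg t) b (sg t) a

  module _ (t : Trace) where

    private
      n = ar t
      _≤ₜ_ : (Fin n → ℕ) → (Fin n → ℕ) → Set
      a ≤ₜ b = Leq ωO (sg t) a (sg t) b

      ≤ₜ-trans : ∀ {a b c} → Inc ωO a → Inc ωO b → Inc ωO c → a ≤ₜ b → b ≤ₜ c → a ≤ₜ c
      ≤ₜ-trans ia ib ic = ⊑-trans ωO-tot (place t _ ia) (place t _ ib) (place t _ ic)

      ≤ₜ-total : ∀ {a b} → Inc ωO a → Inc ωO b → ¬ b ≤ₜ a → a ≤ₜ b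
      ≤ₜ-total ia ib nq with ⊑-total ωO-tot (place t _ ia) (place t _ ib)
      ... | inj₁ p = p
      ... | inj₂ q = ⊥-elim (nq q)

      ≤ₜ-mono : ∀ {a b} → Inc ωO a → Inc ωO b → (∀ i → a i ≤ b i) → a ≤ₜ b
      ≤ₜ-mono ia ib = Leq-mono ωO-tot ia ib (trace-mem t)

    module _ (S : Fin n → Bool) where

      -- A small move. No position passes another one, so the joint type of x and y is determined by
      -- S and the set U of raised positions.
      record Near (U : Fin n → Set) (x y : Fin n → ℕ) : Set where
        field
          fixed : ∀ j → S j ≡ true → x j ≡ y j
          raised : ∀ j → S j ≡ false → U j → x j < y j
          lowered : ∀ j → S j ≡ false → ¬ U j → y j < x j
          apart : ∀ j k → toℕ j < toℕ k → x j < y k × y j < x k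

      near-type : ∀ {U x y x' y'} → Near U x y → Near U x' y' → SameType ωO ωO x y x' y'
      near-type {U} {x} {y} {x'} {y'} N N' = record { fwd = λ i j → proj₁ (go i j) ; bwd = λ i j → proj₂ (go i j) }
        where
        open Near
        go : ∀ i j → Iff (x i ≤ y j) (x' i ≤ y' j) × Iff (y j ≤ x i) (y' j ≤ x' i)
        go i j with <-cmp (toℕ i) (toℕ j)
        ... | tri< l _ _ = both (<⇒≤ (proj₁ (apart N i j l))) (<⇒≤ (proj₁ (apart N' i j l)))
                         , neither (<⇒≱ (proj₁ (apart N i j l))) (<⇒≱ (proj₁ (apart N' i j l)))
        ... | tri> _ _ l = neither (<⇒≱ (proj₂ (apart N j i l))) (<⇒≱ (proj₂ (apart N' j i l)))
                         , both (<⇒≤ (proj₂ (apart N j i l))) (<⇒≤ (proj₂ (apart N' j i l)))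
        ... | tri≈ _ e _ with toℕ-injective e
        ... | refl with S i in s
        ... | true = both (≤-reflexive (fixed N i s)) (≤-reflexive (fixed N' i s))
                   , both (≤-reflexive (sym (fixed N i s))) (≤-reflexive (sym (fixed N' i s)))
        ... | false with dec (U i)
        ...   | yes u = both (<⇒≤ (raised N i s u)) (<⇒≤ (raised N' i s u))
                      , neither (<⇒≱ (raised N i s u)) (<⇒≱ (raised N' i s u))
        ...   | no u = neither (<⇒≱ (lowered N i s u)) (<⇒≱ (lowered N' i s u))
                     , both (<⇒≤ (lowered N i s u)) (<⇒≤ (lowered N' i s u))

      -- A property of U alone: by `near-type` a single sample move decides all of them.
      Increases : (Fin n → Set) → Set
      Increases U = ∀ x y → Inc ωO x → Inc ωO y → Near U x y → ¬ y ≤ₜ x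

      private
        data Pos (p j : ℕ) : Set where
          below : j < p → Pos p j
          here  : j ≡ p → Pos p j
          above : p < j → Pos p j

        pos : ∀ p j → Pos p j
        pos p j with <-cmp j p
        ... | tri< l _ _ = below l
        ... | tri≈ _ e _ = here e
        ... | tri> _ _ g = above g

        pick : ∀ {p j} → ℕ → ℕ → ℕ → Bool → Pos p j → ℕ
        pick a b c true  _         = 5
        pick a b c false (below _) = a
        pick a b c false (here _)  = b
        pick a b c false (above _) = c

        -- Base points 10 j + 5; only the last digit is perturbed.
        pert : ℕ → ℕ → ℕ → ℕ → Fin n → ℕ
        pert a b c p j = 10 * toℕ j + pick a b c (S j) (pos p (toℕ j))

        -- Boolean, so that the bounds for literal digits hold by computation.
        Digits : ℕ → ℕ → ℕ → Set
        Digits a b c = T ((a ≤ᵇ 9) ∧ (b ≤ᵇ 9) ∧ (c ≤ᵇ 9))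

        pick≤ : ∀ {p j} a b c → Digits a b c → ∀ s (q : Pos p j) → pick a b c s q ≤ 9
        pick≤ a b c h s q with Equivalence.to T-∧ h
        ... | ha , h' with Equivalence.to T-∧ h'
        ... | hb , hc = go s q
          where
          go : ∀ {p j} s (q : Pos p j) → pick a b c s q ≤ 9
          go true _ = s≤s (s≤s (s≤s (s≤s (s≤s z≤n))))
          go false (below _) = ≤ᵇ⇒≤ a 9 ha
          go false (here _) = ≤ᵇ⇒≤ b 9 hb
          go false (above _) = ≤ᵇ⇒≤ c 9 hc

        pert-inc : ∀ a b c p {h : Digits a b c} → Inc ωO (pert a b c p)
        pert-inc a b c p {h} = incN (λ j k → digits 9 (pick≤ a b c h (S j) (pos p (toℕ j))))

        pert-near : ∀ {U : Fin n → Set} a b c d e f p {h : Digits a b c} {h' : Digits d e f} →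
                    (∀ j (q : Pos p (toℕ j)) → (U j × pick a b c false q < pick d e f false q)
                                             ⊎ (¬ U j × pick d e f false q < pick a b c false q)) →
                    Near U (pert a b c p) (pert d e f p)
        pert-near {U} a b c d e f p {h} {h'} cond = record
          { fixed = λ j s → cong (10 * toℕ j +_) (fx (S j) s (pos p (toℕ j)))
          ; raised = λ j s u → +-monoʳ-< (10 * toℕ j) (ra j (S j) s u (pos p (toℕ j)) )
          ; lowered = λ j s u → +-monoʳ-< (10 * toℕ j) (lo j (S j) s u (pos p (toℕ j)))
          ; apart = λ j k l → digits 9 (pick≤ a b c h (S j) (pos p (toℕ j))) l
                            , digits 9 (pick≤ d e f h' (S j) (pos p (toℕ j))) l }
          where
          fx : ∀ s {j} → s ≡ true → (q : Pos p j) → pick a b c s q ≡ pick d e f s q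
          fx true _ q = refl
          ra : ∀ j s → s ≡ false → U j → (q : Pos p (toℕ j)) → pick a b c s q < pick d e f s q
          ra j false _ u q with cond j q
          ... | inj₁ (_ , l) = l
          ... | inj₂ (nu , _) = ⊥-elim (nu u)
          lo : ∀ j s → s ≡ false → ¬ U j → (q : Pos p (toℕ j)) → pick d e f s q < pick a b c s q
          lo j false _ u q with cond j q
          ... | inj₁ (v , _) = ⊥-elim (u v)
          ... | inj₂ (_ , l) = l

      Increases? : ∀ {U} {x y : Fin n → ℕ} → Inc ωO x → Inc ωO y → Near U x y → ¬ y ≤ₜ x → Increases U
      Increases? ix iy N h x' y' ix' iy' N' l = h (transfer ωO-tot ωO-tot (type-swap (near-type N' N)) iy' ix' iy ix l)

      -- The step from x to m raises the positions ≥ p; the step from m to y lowers the positions > p and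
      -- raises the others.  Altogether p moves up and every other free position moves down.
      record Steps (p : ℕ) : Set where
        field
          x m y : Fin n → ℕ
          ix    : Inc ωO x
          im    : Inc ωO m
          iy    : Inc ωO y
          Nxm   : Near (λ j → p ≤ toℕ j) x m
          Nym   : Near (λ j → suc p ≤ toℕ j) y m
          Nxy   : Near (λ j → toℕ j ≡ p) x y

      steps : ∀ p → Steps p
      steps p = record
        -- The three digits are for positions below, at and above p. They realise m < y < x as 1, 2,
        -- 5 below p, x < m < y as 5, 6, 7 at p, and y < x < m as 4, 5, 6 above p; marked positions
        -- always keep the digit 5.
        { x = pert 5 5 5 p ; m = pert 1 6 6 p ; y = pert 2 7 4 p
        ; ix = pert-inc 5 5 5 p ; im = pert-inc 1 6 6 p ; iy = pert-inc 2 7 4 p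
        ; Nxm = pert-near 5 5 5 1 6 6 p λ
            { j (below l) → inj₂ (<⇒≱ l , lt 1 5) ; j (here e) → inj₁ (≤-reflexive (sym e) , lt 5 6)
            ; j (above l) → inj₁ (<⇒≤ l , lt 5 6) }
        ; Nym = pert-near 2 7 4 1 6 6 p λ
            { j (below l) → inj₂ (<-asym l , lt 1 2) ; j (here e) → inj₂ (<-irrefl (sym e) , lt 6 7)
            ; j (above l) → inj₁ (l , lt 4 6) }
        ; Nxy = pert-near 5 5 5 2 7 4 p λ
            { j (below l) → inj₂ ((λ e → <-irrefl e l) , lt 2 5) ; j (here e) → inj₁ (e , lt 5 7)
            ; j (above l) → inj₂ ((λ e → <-irrefl (sym e) l) , lt 4 5) } }
        where
        lt : ∀ a b {h : T (a <ᵇ b)} → a < b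
        lt a b {h} = <ᵇ⇒< a b h

      -- The free position makes the increase strict.
      raise-all : (Σ (Fin n) λ j → S j ≡ false) → Increases (λ j → 0 ≤ toℕ j)
      raise-all (j₀ , free₀) x y ix iy N = strict ωO-tot t ix iy le j₀ (<⇒≺ω (Near.raised N j₀ free₀ z≤n))
        where
        le : ∀ i → x i ≤ y i
        le i with S i in s
        ... | true = ≤-reflexive (Near.fixed N i s)
        ... | false = <⇒≤ (Near.raised N i s z≤n)

      -- No position is ≥ n, so every free one moves down and monotonicity forbids an increase.
      lower-all : ¬ Increases (λ j → n ≤ toℕ j)
      lower-all h with steps n
      ... | record { x = x ; m = m ; ix = ix ; im = im ; Nxm = N } = h x m ix im N (≤ₜ-mono im ix le)
        where
        le : ∀ i → m i ≤ x i
        le i with S i in s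
        ... | true = ≤-reflexive (sym (Near.fixed N i s))
        ... | false = <⇒≤ (Near.lowered N i s (<⇒≱ (toℕ<n i)))

      -- If S fixed p, raising from p on and raising from p + 1 on would be the same move.
      pivot-free : ∀ p → Increases (λ j → p ≤ toℕ j) → ¬ Increases (λ j → suc p ≤ toℕ j) →
                   ∀ i → toℕ i ≡ p → S i ≡ false
      pivot-free p inc-p ninc i i≡p with S i in s
      ... | false = refl
      ... | true = ⊥-elim (ninc λ x y ix iy N → inc-p x y ix iy record
              { fixed = Near.fixed N
              ; raised = λ j f l → Near.raised N j f (≤∧≢⇒< l (absurd j f))
              ; lowered = λ j f l → Near.lowered N j f (λ l' → l (<⇒≤ l'))
              ; apart = Near.apart N })
        where
        absurd : ∀ j → S j ≡ false → p ≢ toℕ j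
        absurd j f e with toℕ-injective (trans i≡p e)
        ... | refl with trans (sym s) f
        ... | ()

      -- The move from y to m, which raises exactly the free positions above p, is not an increase,
      -- so m ≤ y. With x < m this gives x < y, where p alone is raised.
      pivot-increases : ∀ p → Increases (λ j → p ≤ toℕ j) → ¬ Increases (λ j → suc p ≤ toℕ j) →
                        Increases (λ j → toℕ j ≡ p)
      pivot-increases p inc-p ninc with steps p
      ... | record { x = x ; m = m ; y = y ; ix = ix ; im = im ; iy = iy ; Nxm = Nxm ; Nym = Nym ; Nxy = Nxy } =
        Increases? ix iy Nxy λ y≤x → inc-p x m ix im Nxm (≤ₜ-trans {m} {y} {x} im iy ix m≤y y≤x)
        where
        m≤y : m ≤ₜ y
        m≤y = by-contra λ nle → ninc (Increases? iy im Nym nle)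

      -- The raised set shrinks from all positions at p = 0 to none at p = n, so `Increases` has to
      -- fail between some p and p + 1.
      pivot : (Σ (Fin n) λ j → S j ≡ false) → Σ (Fin n) λ i → S i ≡ false × Increases (λ j → toℕ j ≡ toℕ i)
      pivot free = finish (first-failure (λ p → Increases (λ j → p ≤ toℕ j)) n (raise-all free) lower-all)
        where
        finish : (Σ ℕ λ p → p < n × Increases (λ j → p ≤ toℕ j) × ¬ Increases (λ j → suc p ≤ toℕ j)) →
                 Σ (Fin n) λ i → S i ≡ false × Increases (λ j → toℕ j ≡ toℕ i)
        finish (p , p<n , inc-p , ninc) =
          fromℕ< p<n , pivot-free p inc-p ninc _ (toℕ-fromℕ< p<n)
          , subst (λ z → Increases (λ j → toℕ j ≡ z)) (sym (toℕ-fromℕ< p<n)) (pivot-increases p inc-p ninc)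

      module _ {i : Fin n} (free-i : S i ≡ false) (incr : Increases (λ j → toℕ j ≡ toℕ i)) where

        private
          path : (Fin n → ℕ) → (Fin n → ℕ) → ℕ → ℕ → Fin n → ℕ
          path a b p q j = p * a j + q * b j

          scaled-gap : ∀ p {u v} → u < v → p + p * u ≤ p * v
          scaled-gap p {u} {v} l = subst (_≤ p * v) (*-suc p u) (*-monoʳ-≤ p l)

        -- Linear interpolation in K steps, each of which is small with respect to the gaps.
        interpolate : ∀ a b → Inc ωO a → Inc ωO b → Agree S a b → a i < b i →
                      (∀ j → S j ≡ false → j ≢ i → b j < a j) → ¬ b ≤ₜ a
        interpolate a b ia ib ag lt-i gt b≤a with bound a | bound b
        -- Scaled by K, the assumption b ≤ a yields K b ≤ K a ≤ `path a b 1 k`, which contradicts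
        -- the last small step from `path a b 1 k` up to K b.
        ... | A , a≤A | B , b≤B = step (path-inc 1 k (s≤s z≤n)) (path-inc 0 K (s≤s z≤n)) (near 0 k refl)
                (≤ₜ-trans (path-inc 0 K (s≤s z≤n)) (path-inc K 0 (s≤s z≤n)) (path-inc 1 k (s≤s z≤n)) end (chain k 1 (+-comm k 1)))
          where
          -- Neighbouring paths share a part `path a b p q` with p + q = k, whose gaps are at least
          -- k; the remaining summand a j or b j is at most k, so positions never cross.
          k = A + B
          K = suc k
          path-gap : ∀ p q {j l} → toℕ j < toℕ l → p + q + path a b p q j ≤ path a b p q l
          path-gap p q {j} {l} lt = begin
            p + q + (p * a j + q * b j)   ≡⟨ solve 4 (λ p q x y → p :+ q :+ (x :+ y) := p :+ x :+ (q :+ y)) refl p q (p * a j) (q * b j) ⟩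
            p + p * a j + (q + q * b j)   ≤⟨ +-mono-≤ (scaled-gap p (ltN ia j l lt)) (scaled-gap q (ltN ib j l lt)) ⟩
            p * a l + q * b l             ∎
            where open ≤-Reasoning
                  open +-*-Solver
          path-inc : ∀ p q → 0 < p + q → Inc ωO (path a b p q)
          path-inc p q pos = incN λ j l lt → ≤-trans (+-monoˡ-≤ (path a b p q j) pos) (path-gap p q lt)
          step : ∀ {x y} → Inc ωO x → Inc ωO y → Near (λ j → toℕ j ≡ toℕ i) x y → ¬ y ≤ₜ x
          step = incr _ _
          shift₁ : ∀ p q j → path a b (suc p) q j ≡ path a b p q j + a j
          shift₁ p q j = solve 4 (λ p q x y → (con 1 :+ p) :* x :+ q :* y := p :* x :+ q :* y :+ x) refl p q (a j) (b j)
            where open +-*-Solver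
          shift₂ : ∀ p q j → path a b p (suc q) j ≡ path a b p q j + b j
          shift₂ p q j = solve 4 (λ p q x y → p :* x :+ (con 1 :+ q) :* y := p :* x :+ q :* y :+ y) refl p q (a j) (b j)
            where open +-*-Solver
          far : ∀ p q → p + q ≡ k → ∀ j l {u v} → u ≤ k → 0 < v → toℕ j < toℕ l → path a b p q j + u < path a b p q l + v
          far p q e j l {u} {v} u≤k 0<v lt = begin-strict
            path a b p q j + u         ≤⟨ +-monoʳ-≤ (path a b p q j) u≤k ⟩
            path a b p q j + k         ≡⟨ trans (+-comm _ k) (cong (_+ path a b p q j) (sym e)) ⟩
            p + q + path a b p q j     ≤⟨ path-gap p q lt ⟩
            path a b p q l             <⟨ m<m+n _ 0<v ⟩
            path a b p q l + v         ∎
            where open ≤-Reasoning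
          near : ∀ p q → p + q ≡ k → Near (λ j → toℕ j ≡ toℕ i) (path a b (suc p) q) (path a b p (suc q))
          near p q e = record
            { fixed = λ j s → trans (shift₁ p q j) (trans (cong (path a b p q j +_) (ag j s)) (sym (shift₂ p q j)))
            ; raised = λ j s e → subst₂ _<_ (sym (shift₁ p q j)) (sym (shift₂ p q j))
                (+-monoʳ-< (path a b p q j) (subst (λ l → a l < b l) (sym (toℕ-injective e)) lt-i))
            ; lowered = λ j s ne → subst₂ _<_ (sym (shift₂ p q j)) (sym (shift₁ p q j)) (+-monoʳ-< (path a b p q j) (gt j s (λ e → ne (cong toℕ e))))
            ; apart = λ j l lt →
                subst₂ _<_ (sym (shift₁ p q j)) (sym (shift₂ p q l))
                  (far p q e j l (≤-trans (a≤A j) (m≤m+n A B)) (≤-<-trans z≤n (ltN ib j l lt)) lt)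
              , subst₂ _<_ (sym (shift₂ p q j)) (sym (shift₁ p q l))
                  (far p q e j l (≤-trans (b≤B j) (m≤n+m B A)) (≤-<-trans z≤n (ltN ia j l lt)) lt) }
          chain : ∀ q p → q + p ≡ K → path a b K 0 ≤ₜ path a b p q
          chain zero p refl = ≤ₜ-mono (path-inc K 0 (s≤s z≤n)) (path-inc K 0 (s≤s z≤n)) (λ _ → ≤-refl)
          chain (suc q) p e = ≤ₜ-trans (path-inc K 0 (s≤s z≤n)) (path-inc (suc p) q (s≤s z≤n)) i₂
              (chain q (suc p) (trans (+-suc q p) e))
              (≤ₜ-total (path-inc (suc p) q (s≤s z≤n)) i₂ (step (path-inc (suc p) q (s≤s z≤n)) i₂ (near p q (suc-injective (trans (cong suc (+-comm p q)) e)))))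
            where i₂ = path-inc p (suc q) (subst (0 <_) (sym (+-suc p q)) (s≤s z≤n))
          end : path a b 0 K ≤ₜ path a b K 0
          end = transfer ωO-tot ωO-tot st ib ia (path-inc 0 K (s≤s z≤n)) (path-inc K 0 (s≤s z≤n)) b≤a
            where
            st : SameType ωO ωO b a (path a b 0 K) (path a b K 0)
            st = record
              { fwd = λ i j → (λ l → subst (K * b i ≤_) (sym (+-identityʳ (K * a j))) (*-monoʳ-≤ K l))
                            , (λ l → *-cancelˡ-≤ K (subst (K * b i ≤_) (+-identityʳ (K * a j)) l))
              ; bwd = λ i j → (λ l → subst (_≤ K * b i) (sym (+-identityʳ (K * a j))) (*-monoʳ-≤ K l))
                            , (λ l → *-cancelˡ-≤ K (subst (_≤ K * b i) (+-identityʳ (K * a j)) l)) }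

        -- Interpolation needs every other free position to drop. A general b lies above some b⁻ of
        -- this kind, and monotonicity passes from b⁻ to b.
        dict-of-increases : Dict t S i
        dict-of-increases a b ia ib ag lt b≤a =
          interpolate a⁺ b⁻ ia⁺ b⁻-inc ag' lt' gt' (≤ₜ-trans {b⁻} {b⁺} {a⁺} b⁻-inc ib⁺ ia⁺ b⁻≤b⁺ b⁺≤a⁺)
          where
          a⁺ b⁺ : Fin n → ℕ
          a⁺ j = 3 * a j + 1
          b⁺ j = 3 * b j + 1
          ia⁺ : Inc ωO a⁺
          ia⁺ = affine-inc 2 1 ia
          ib⁺ : Inc ωO b⁺
          ib⁺ = affine-inc 2 1 ib
          b⁺≤a⁺ : b⁺ ≤ₜ a⁺
          b⁺≤a⁺ = transfer ωO-tot ωO-tot (affine-type 2 1 b a) ib ia ib⁺ ia⁺ b≤a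
          -- Relative to the residue 1 of a⁺, residue 1 keeps agreement on S, 2 raises i, and 0
          -- makes the other free positions drop strictly. At i the value 3 a i + 2 still lies below
          -- b⁺ i because a i < b i.
          off : ∀ j → Bool → Dec (j ≡ i) → ℕ
          off j true  _       = 1
          off j false (yes _) = 2
          off j false (no _)  = 0
          b⁻ : Fin n → ℕ
          b⁻ j = 3 * (a j ⊓ b j) + off j (S j) (dec (j ≡ i))
          off≤2 : ∀ j s d → off j s d ≤ 2
          off≤2 j true d = s≤s z≤n
          off≤2 j false (yes _) = ≤-refl
          off≤2 j false (no _) = z≤n
          b⁻-inc : Inc ωO b⁻
          b⁻-inc = incN λ j l lt → digits 2 (off≤2 j (S j) (dec (j ≡ i)))
                     (⊓-pres-m< (≤-<-trans (m⊓n≤m (a j) (b j)) (ltN ia j l lt)) (≤-<-trans (m⊓n≤n (a j) (b j)) (ltN ib j l lt)))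
          b⁻≤ : ∀ j → b⁻ j ≤ b⁺ j
          b⁻≤ j with S j in s | dec (j ≡ i)
          ... | true | _ = +-monoˡ-≤ 1 (*-monoʳ-≤ 3 (m⊓n≤n (a j) (b j)))
          ... | false | no _ = +-mono-≤ (*-monoʳ-≤ 3 (m⊓n≤n (a j) (b j))) z≤n
          ... | false | yes refl = ≤-trans (+-monoˡ-≤ 2 (*-monoʳ-≤ 3 (m⊓n≤m (a i) (b i)))) (<⇒≤ (digits 2 ≤-refl lt))
          b⁻≤b⁺ : b⁻ ≤ₜ b⁺
          b⁻≤b⁺ = ≤ₜ-mono {b⁻} {b⁺} b⁻-inc ib⁺ b⁻≤
          off-mark : ∀ j {s} d → s ≡ true → off j s d ≡ 1
          off-mark j d refl = refl
          off-i : ∀ {s} d → s ≡ false → off i s d ≡ 2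
          off-i (yes _) refl = refl
          off-i (no ne) refl = ⊥-elim (ne refl)
          off-other : ∀ j {s} d → s ≡ false → j ≢ i → off j s d ≡ 0
          off-other j (yes e) refl ne = ⊥-elim (ne e)
          off-other j (no _) refl ne = refl
          ag' : Agree S a⁺ b⁻
          ag' j s = cong₂ (λ u v → 3 * u + v) (trans (sym (⊓-idem (a j))) (cong (a j ⊓_) (ag j s))) (sym (off-mark j _ s))
          lt' : a⁺ i < b⁻ i
          lt' = subst₂ (λ u v → a⁺ i < 3 * u + v) (sym (m≤n⇒m⊓n≡m (<⇒≤ lt))) (sym (off-i _ free-i)) (+-monoʳ-< (3 * a i) ≤-refl)
          gt' : ∀ j → S j ≡ false → j ≢ i → b⁻ j < a⁺ j
          gt' j s ne = subst (λ v → 3 * (a j ⊓ b j) + v < a⁺ j) (sym (off-other j _ s ne))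
                         (+-mono-≤-< (*-monoʳ-≤ 3 (m⊓n≤m (a j) (b j))) (s≤s z≤n))

      dict-exists : (Σ (Fin n) λ j → S j ≡ false) → Σ (Fin n) λ i → S i ≡ false × Dict t S i
      dict-exists free = finish (pivot free)
        where
        finish : (Σ (Fin n) λ i → S i ≡ false × Increases (λ j → toℕ j ≡ toℕ i)) →
                 Σ (Fin n) λ i → S i ≡ false × Dict t S i
        finish (i , fi , incr) = i , fi , dict-of-increases fi incr

  dictA : ∀ {A} → Tot A → (t : Trace) {S : Fin (ar t) → Bool} {i : Fin (ar t)} → Dict t S i →
          {a b : Fin (ar t) → Car A} → Inc A a → Inc A b → (∀ s → S s ≡ true → Eqv A (a s) (b s)) →
          Lt A (a i) (b i) → ¬ Leq A (sg t) b (sg t) a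
  dictA T t d ia ib ag lt l =
    d (toN₁ T ia ib) (toN₂ T ia ib) (toN₁-inc T ia ib) (toN₂-inc T ia ib)
      (λ s e → let q = type-≈ (toN-type T ia ib) (ag s e) in ≤-antisym (proj₁ q) (proj₂ q))
      (≺ω⇒< (type-≺ (toN-type T ia ib) lt))
      (transfer T ωO-tot (type-swap (toN-type T ia ib)) ib ia (toN₂-inc T ia ib) (toN₁-inc T ia ib) l)

  uip : ∀ {X : Set} {x y : X} (p q : x ≡ y) → p ≡ q
  uip refl refl = refl

  -- Priority of positions, as in Girard's theory of dilators

  chosen : ∀ {n} {P : Fin n → Set} → Dec (Σ (Fin n) P) → Maybe (Fin n)
  chosen (yes (i , _)) = just i
  chosen (no _) = nothing

  chosen-just : ∀ {n} {P : Fin n → Set} (d : Dec (Σ (Fin n) P)) {i} → chosen d ≡ just i → P i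
  chosen-just (yes (i , p)) refl = p

  chosen-nothing : ∀ {n} {P : Fin n → Set} (d : Dec (Σ (Fin n) P)) → chosen d ≡ nothing → ∀ i → ¬ P i
  chosen-nothing (no h) _ i p = h (i , p)

  truth : ∀ {P : Set} → Dec P → Bool
  truth (yes _) = true
  truth (no _) = false

  truth-yes : ∀ {P : Set} (d : Dec P) → truth d ≡ true → P
  truth-yes (yes p) _ = p

  yes-truth : ∀ {P : Set} (d : Dec P) → P → truth d ≡ true
  yes-truth (yes _) _ = refl
  yes-truth (no n) p = ⊥-elim (n p)

  module _ (t : Trace) where

    -- `marks k` collects the letters with index below k, and `letter k` is a position that dictates
    -- once these are fixed. The choice depends on the trace alone, so all placements of a trace
    -- share their letters.
    marks  : ℕ → Fin (ar t) → Bool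
    letter : ℕ → Maybe (Fin (ar t))

    marks zero p = false
    marks (suc k) p = truth (dec (marks k p ≡ true ⊎ letter k ≡ just p))
    letter k = chosen (dec (Σ (Fin (ar t)) λ i → marks k i ≡ false × Dict t (marks k) i))

    letter-just : ∀ k {i} → letter k ≡ just i → marks k i ≡ false × Dict t (marks k) i
    letter-just k = chosen-just (dec (Σ (Fin (ar t)) λ i → marks k i ≡ false × Dict t (marks k) i))

    bool : ∀ (b : Bool) → b ≡ true ⊎ b ≡ false
    bool true = inj₁ refl
    bool false = inj₂ refl

    -- By `dict-exists` the letters run out only when no free position is left.
    letter-nothing : ∀ {k} → letter k ≡ nothing → ∀ p → marks k p ≡ true
    letter-nothing {k} e p = [ (λ q → q) , (λ q → ⊥-elim (none (dict-exists t (marks k) (p , q)))) ]′ (bool (marks k p))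
      where
      none : ¬ (Σ (Fin (ar t)) λ i → marks k i ≡ false × Dict t (marks k) i)
      none (i , h) = chosen-nothing (dec (Σ (Fin (ar t)) λ i → marks k i ≡ false × Dict t (marks k) i)) e i h

    marks-inv : ∀ k {p} → marks (suc k) p ≡ true → marks k p ≡ true ⊎ letter k ≡ just p
    marks-inv k {p} = truth-yes (dec (marks k p ≡ true ⊎ letter k ≡ just p))

    marks-intro : ∀ k {p} → marks k p ≡ true ⊎ letter k ≡ just p → marks (suc k) p ≡ true
    marks-intro k {p} = yes-truth (dec (marks k p ≡ true ⊎ letter k ≡ just p))

    marks⇒letter : ∀ k {p} → marks k p ≡ true → Σ ℕ λ r → r < k × letter r ≡ just p
    marks⇒letter (suc k) {p} e = [ (λ m → let (r , l , q) = marks⇒letter k m in r , m≤n⇒m≤1+n l , q)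
                                  , (λ q → k , ≤-refl , q) ]′ (marks-inv k e)

    letter⇒marks : ∀ {r p} → letter r ≡ just p → ∀ k → r < k → marks k p ≡ true
    letter⇒marks {r} {p} e (suc k) (s≤s l) = marks-intro k
      ([ (λ r<k → inj₁ (letter⇒marks e k r<k)) , (λ { refl → inj₂ e }) ]′ (m≤n⇒m<n∨m≡n l))

    letter-fresh : ∀ {r k p} → letter k ≡ just p → letter r ≡ just p → ¬ r < k
    letter-fresh {r} {k} ek er r<k with trans (sym (letter⇒marks er k r<k)) (proj₁ (letter-just k ek))
    ... | ()

    letter-injective : ∀ {r k p} → letter r ≡ just p → letter k ≡ just p → r ≡ k
    letter-injective {r} {k} er ek with <-cmp r k
    ... | tri< l _ _ = ⊥-elim (letter-fresh ek er l)
    ... | tri≈ _ e _ = e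
    ... | tri> _ _ l = ⊥-elim (letter-fresh er ek l)

    Alive : ℕ → Set
    Alive k = ∀ r → r < k → Σ (Fin (ar t)) λ p → letter r ≡ just p

  just-injective : ∀ {X : Set} {x y : X} → just x ≡ just y → x ≡ y
  just-injective refl = refl

  -- Squeezing: distinguished positions receive prescribed values x ∈ α, placed at ω·(1+x), and every other
  -- position is placed right above the preceding distinguished one.

  onePlus-tot : (α : LinOrdℕ) → Tot (onePlus α)
  onePlus-tot α = record { ≼-refl = λ {x} → re x ; ≼-trans = λ {x} {y} {z} → tr x y z ; ≼-total = to }
    where
    re : ∀ x → Le (onePlus α) x x
    re nothing = tt
    re (just (x , e)) = rel-refl α e
    tr : ∀ x y z → Le (onePlus α) x y → Le (onePlus α) y z → Le (onePlus α) x z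
    tr nothing y z p q = tt
    tr (just x) (just y) (just z) p q = rel-trans α p q
    to : ∀ x y → Le (onePlus α) x y ⊎ Le (onePlus α) y x
    to nothing y = inj₁ tt
    to (just x) nothing = inj₂ tt
    to (just (x , e)) (just (y , d)) = rel-total α e d

  ω1+-tot : (α : LinOrdℕ) → Tot (ω1+ α)
  ω1+-tot α = lex-tot (onePlus-tot α) ωO-tot

  module _ {n : ℕ} (M : Fin n → Bool) where

    data Prev (k : ℕ) : Set where
      none : (∀ q → M q ≡ true → ¬ toℕ q < k) → Prev k
      some : ∀ q → M q ≡ true → toℕ q < k → (∀ q' → M q' ≡ true → toℕ q' < k → toℕ q' ≤ toℕ q) → Prev k

    prev : ∀ k → Prev k
    prev zero = none (λ _ _ ())
    prev (suc k) = go (dec (Σ (Fin n) λ q → toℕ q ≡ k × M q ≡ true)) (prev k)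
      where
      go : Dec (Σ (Fin n) λ q → toℕ q ≡ k × M q ≡ true) → Prev k → Prev (suc k)
      go (yes (q , e , m)) _ = some q m (s≤s (≤-reflexive e))
        (λ q' _ l → ≤-trans (s≤s⁻¹ l) (≤-reflexive (sym e)))
      go (no h) (none f) = none λ q m l → [ f q m , (λ e → h (q , suc-injective e , m)) ]′ (m≤n⇒m<n∨m≡n' l)
        where
        m≤n⇒m<n∨m≡n' : ∀ {x} → suc x ≤ suc k → x < k ⊎ suc x ≡ suc k
        m≤n⇒m<n∨m≡n' (s≤s l) = [ inj₁ , (λ e → inj₂ (cong suc e)) ]′ (m≤n⇒m<n∨m≡n l)
      go (no h) (some q m l mx) = some q m (m≤n⇒m≤1+n l) λ q' m' l' →
        [ mx q' m' , (λ e → ⊥-elim (h (q' , e , m'))) ]′ (m≤n⇒m<n∨m≡n (s≤s⁻¹ l'))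

    -- Marks start a block at offset 0. The offset p + 1 puts other positions strictly above the
    -- start, in their own order, and depends on the position only.
    offset : Bool → ℕ → ℕ
    offset true p = 0
    offset false p = suc p

    module _ {α : LinOrdℕ} (v : ∀ p → M p ≡ true → Σ ℕ (elem α)) where

      tag : ∀ {k} → Prev k → Car (onePlus α)
      tag (none _) = nothing
      tag (some q m _ _) = just (v q m)

      squeeze : Fin n → Car (ω1+ α)
      squeeze p = tag (prev (suc (toℕ p))) , offset (M p) (toℕ p)

      squeeze-main : ∀ {p} (m : M p ≡ true) → squeeze p ≡ (just (v p m) , 0)
      squeeze-main {p} m = cong₂ _,_ (go (prev (suc (toℕ p)))) (cong (λ b → offset b (toℕ p)) m)
        where
        go : (w : Prev (suc (toℕ p))) → tag w ≡ just (v p m)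
        go (none f) = ⊥-elim (f p m ≤-refl)
        go (some q m' (s≤s l) mx) with toℕ-injective (≤-antisym l (mx p m ≤-refl))
        ... | refl = cong (λ z → just (v p z)) (uip m' m)

      squeeze-below : ∀ p {y : Σ ℕ (elem α)} → (∀ q (m : M q ≡ true) → toℕ q ≤ toℕ p → Lt (onePlus α) (just (v q m)) (just y)) →
                      Lt (ω1+ α) (squeeze p) (just y , 0)
      squeeze-below p {y} h = lex-≺ (onePlus α) ωO (squeeze p) (just y , 0) (go (prev (suc (toℕ p))))
        where
        go : (w : Prev (suc (toℕ p))) → Lt (onePlus α) (tag w) (just y)
        go (none f) = tt , λ ()
        go (some q m (s≤s l) _) = h q m l

      MainInc : Set
      MainInc = ∀ p q (mp : M p ≡ true) (mq : M q ≡ true) → toℕ p < toℕ q → Lt (onePlus α) (just (v p mp)) (just (v q mq))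

      squeeze-inc : MainInc → Inc (ω1+ α) squeeze
      squeeze-inc vi p p' lt = go (prev (suc (toℕ p))) (prev (suc (toℕ p')))
        where
        go : (w : Prev (suc (toℕ p))) (w' : Prev (suc (toℕ p'))) →
             Lt (ω1+ α) (tag w , offset (M p) (toℕ p)) (tag w' , offset (M p') (toℕ p'))
        off : M p' ≡ false → ∀ b → offset b (toℕ p) < offset (M p') (toℕ p')
        off e b rewrite e = s≤s (le b)
          where
          le : ∀ b → offset b (toℕ p) ≤ toℕ p'
          le true = z≤n
          le false = lt
        -- If p and p' lie in the same block, the later one is not a mark, so its offset exceeds
        -- that of p.
        not-main : (∀ q → M q ≡ true → toℕ q < suc (toℕ p') → toℕ q ≤ toℕ p) → M p' ≡ false
        not-main h with M p' in e
        ... | false = refl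
        ... | true = ⊥-elim (<⇒≱ lt (h p' e ≤-refl))
        go (none f) (none g) = lex-≈≺ (onePlus α) ωO (nothing , offset (M p) (toℕ p)) (nothing , offset (M p') (toℕ p')) (tt , tt)
          (<⇒≺ω (off (not-main (λ q m l → ⊥-elim (g q m l))) (M p)))
        go (none f) (some q m _ _) = lex-≺ (onePlus α) ωO (nothing , offset (M p) (toℕ p)) (just (v q m) , offset (M p') (toℕ p')) (tt , λ ())
        go (some q m l mx) (none f) = ⊥-elim (f q m (<-trans l (s≤s lt)))
        go (some q m l mx) (some q' m' l' mx') with <-cmp (toℕ q) (toℕ q')
        ... | tri< qq' _ _ = lex-≺ (onePlus α) ωO (just (v q m) , offset (M p) (toℕ p)) (just (v q' m') , offset (M p') (toℕ p')) (vi q q' m m' qq')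
        ... | tri> _ _ gt = ⊥-elim (<⇒≱ gt (mx' q m (<-trans l (s≤s lt))))
        ... | tri≈ _ e _ with toℕ-injective e
        ... | refl = lex-≈≺ (onePlus α) ωO (just (v q m) , offset (M p) (toℕ p)) (just (v q m') , offset (M p') (toℕ p'))
                (≡⇒≈ (onePlus-tot α) (cong (λ z → just (v q z)) (uip m m')))
                (<⇒≺ω (off (not-main (λ r m l' → ≤-trans (mx' r m l') (s≤s⁻¹ l))) (M p)))

  lex-iff : ∀ (A B C : Ord) (x y : Car A) (x' y' : Car B) {u v : Car C} →
            Iff (Le A x y) (Le B x' y') → Iff (Le A y x) (Le B y' x') →
            Iff (Le (lex A C) (x , u) (y , v)) (Le (lex B C) (x' , u) (y' , v))
  lex-iff A B C x y x' y' (f , g) (h , k) =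
      [ (λ (p , n) → inj₁ (f p , λ z → n (k z))) , (λ ((p , q) , r) → inj₂ ((f p , h q) , r)) ]′
    , [ (λ (p , n) → inj₁ (g p , λ z → n (h z))) , (λ ((p , q) , r) → inj₂ ((g p , k q) , r)) ]′

  module _ {n m : ℕ} (M : Fin n → Bool) (N : Fin m → Bool) {α β : LinOrdℕ}
           (v : ∀ p → M p ≡ true → Σ ℕ (elem α)) (w : ∀ q → N q ≡ true → Σ ℕ (elem α))
           (v' : ∀ p → M p ≡ true → Σ ℕ (elem β)) (w' : ∀ q → N q ≡ true → Σ ℕ (elem β))
           (same : ∀ p q mp mq →
              Iff (rel α (proj₁ (v p mp)) (proj₁ (w q mq))) (rel β (proj₁ (v' p mp)) (proj₁ (w' q mq)))
              × Iff (rel α (proj₁ (w q mq)) (proj₁ (v p mp))) (rel β (proj₁ (w' q mq)) (proj₁ (v' p mp)))) where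

    -- Blocks are ordered by the marked values, and offsets inside a block do not involve values, so
    -- the joint type depends only on how the marked values compare.
    squeeze-type : SameType (ω1+ α) (ω1+ β) (squeeze M {α} v) (squeeze N {α} w) (squeeze M {β} v') (squeeze N {β} w')
    squeeze-type = record
      { fwd = λ i j → let (f , g) = go (prev M (suc (toℕ i))) (prev N (suc (toℕ j)))
                      in lex-iff (onePlus α) (onePlus β) ωO (proj₁ (squeeze M {α} v i)) (proj₁ (squeeze N {α} w j)) (proj₁ (squeeze M {β} v' i)) (proj₁ (squeeze N {β} w' j)) f g
      ; bwd = λ i j → let (f , g) = go (prev M (suc (toℕ i))) (prev N (suc (toℕ j)))
                      in lex-iff (onePlus α) (onePlus β) ωO (proj₁ (squeeze N {α} w j)) (proj₁ (squeeze M {α} v i)) (proj₁ (squeeze N {β} w' j)) (proj₁ (squeeze M {β} v' i)) g f }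
      where
      go : ∀ {k l} (x : Prev M k) (y : Prev N l) →
           Iff (Le (onePlus α) (tag M {α} v x) (tag N {α} w y)) (Le (onePlus β) (tag M {β} v' x) (tag N {β} w' y))
           × Iff (Le (onePlus α) (tag N {α} w y) (tag M {α} v x)) (Le (onePlus β) (tag N {β} w' y) (tag M {β} v' x))
      go (none _) (none _) = both tt tt , both tt tt
      go (none _) (some _ _ _ _) = both tt tt , neither (λ ()) (λ ())
      go (some _ _ _ _) (none _) = neither (λ ()) (λ ()) , both tt tt
      go (some p mp _ _) (some q mq _ _) = same p q mp mq

  ⊏⇒⊑ : ∀ {A} → Tot A → (x y : BarElt D A) → x ⊏ y → x ⊑ y
  ⊏⇒⊑ T x y n = [ (λ p → p) , (λ p → ⊥-elim (n p)) ]′ (⊑-total T x y)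

  natO : LinOrdℕ
  natO = record
    { elem = λ _ → ⊤ ; rel = _≤_ ; rel-elem = λ _ → tt , tt ; rel-refl = λ _ → ≤-refl
    ; rel-antisym = ≤-antisym ; rel-trans = ≤-trans ; rel-total = λ {x} {y} _ _ → ≤-total x y }

  -- The order ω·(1+ω), which embeds into ω² via 1+ω → ω; each point ω·(1+x) has a block above it
  -- for squeezing.
  U : Ord
  U = ω1+ natO

  TU : Tot U
  TU = ω1+-tot natO

  at : ℕ → Car U
  at x = just (x , tt) , 0

  at-≺ : ∀ {x y} → x < y → Lt U (at x) (at y)
  at-≺ {x} {y} l = lex-≺ (onePlus natO) ωO (at x) (at y) (<⇒≺ω l)

  at-iff : ∀ x y → Iff (x ≤ y) (Le U (at x) (at y))
  at-iff x y = (λ l → [ (λ l' → proj₁ (at-≺ l')) , (λ { refl → ≼-refl TU {at x} }) ]′ (m≤n⇒m<n∨m≡n l))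
             , [ (λ p → proj₁ p) , (λ p → proj₁ (proj₁ p)) ]′

  emb : ∀ {n} → (Fin n → ℕ) → Fin n → Car U
  emb a p = at (3 * a p + 1)

  emb-inc : ∀ {n} {a : Fin n → ℕ} → Inc ωO a → Inc U (emb a)
  emb-inc ia i j l = at-≺ (≺ω⇒< (affine-inc 2 1 ia i j l))

  emb-type : ∀ {n m} (a : Fin n → ℕ) (b : Fin m → ℕ) → SameType ωO U a b (emb a) (emb b)
  emb-type a b = type-trans {b' = λ j → 3 * b j + 1} (affine-type 2 1 a b)
    (record { fwd = λ i j → at-iff (3 * a i + 1) (3 * b j + 1) ; bwd = λ i j → at-iff (3 * b j + 1) (3 * a i + 1) })

  emb-Leq : ∀ {n m σ τ} {a : Fin n → ℕ} {b : Fin m → ℕ} → Inc ωO a → Inc ωO b →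
            Iff (Leq ωO σ a τ b) (Leq U σ (emb a) τ (emb b))
  emb-Leq {a = a} {b} ia ib =
      transfer ωO-tot TU (emb-type a b) ia ib (emb-inc ia) (emb-inc ib)
    , transfer TU ωO-tot (type-sym (emb-type a b)) (emb-inc ia) (emb-inc ib) ia ib

  -- The values 3 x + 1 of the first k letters leave room for the value z of letter k on either side.
  module _ (t : Trace) (k : ℕ) {i : Fin (ar t)} (li : letter t k ≡ just i) (f : Fin (ar t) → ℕ) (z : ℕ) where

    private
      sel : ∀ {p} → Dec (p ≡ i) → ℕ → ℕ
      sel (yes _) y = z
      sel (no _)  y = y

    val : Fin (ar t) → ℕ
    val p = sel (dec (p ≡ i)) (3 * f p + 1)

    val-i : val i ≡ z
    val-i = go (dec (i ≡ i))
      where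
      go : (d : Dec (i ≡ i)) → sel d (3 * f i + 1) ≡ z
      go (yes _) = refl
      go (no n) = ⊥-elim (n refl)

    val-other : ∀ {p} → marks t k p ≡ true → val p ≡ 3 * f p + 1
    val-other {p} m = go (dec (p ≡ i))
      where
      go : (d : Dec (p ≡ i)) → sel d (3 * f p + 1) ≡ 3 * f p + 1
      go (no _) = refl
      go (yes refl) with trans (sym m) (proj₁ (letter-just t k li))
      ... | ()

    main-cases : ∀ {p} → marks t (suc k) p ≡ true → marks t k p ≡ true ⊎ p ≡ i
    main-cases m = [ inj₁ , (λ e → inj₂ (just-injective (trans (sym e) li))) ]′ (marks-inv t k m)

    valU : ∀ p → marks t (suc k) p ≡ true → Σ ℕ (elem natO)
    valU p _ = val p , tt

    sq : Fin (ar t) → Car U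
    sq = squeeze (marks t (suc k)) {natO} valU

    sq-mark : ∀ {p} → marks t k p ≡ true → sq p ≡ emb f p
    sq-mark {p} m = trans (squeeze-main (marks t (suc k)) {natO} valU (marks-intro t k (inj₁ m))) (cong at (val-other m))

    sq-letter : sq i ≡ at z
    sq-letter = trans (squeeze-main (marks t (suc k)) {natO} valU (marks-intro t k (inj₂ li))) (cong at val-i)

    module _ (below : ∀ p → marks t k p ≡ true → toℕ p < toℕ i → 3 * f p + 1 < z)
             (above : ∀ p → marks t k p ≡ true → toℕ i < toℕ p → z < 3 * f p + 1) where

      sq-inc : (∀ p q → marks t k p ≡ true → marks t k q ≡ true → toℕ p < toℕ q → f p < f q) → Inc U sq
      sq-inc fi = squeeze-inc (marks t (suc k)) {natO} valU λ p q mp mq l → <⇒≺ω (go p q (main-cases mp) (main-cases mq) l)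
        where
        go : ∀ p q → marks t k p ≡ true ⊎ p ≡ i → marks t k q ≡ true ⊎ q ≡ i → toℕ p < toℕ q → val p < val q
        go p q (inj₁ mp) (inj₁ mq) l = subst₂ _<_ (sym (val-other mp)) (sym (val-other mq)) (digits 2 (s≤s z≤n) (fi p q mp mq l))
        go p q (inj₁ mp) (inj₂ refl) l = subst₂ _<_ (sym (val-other mp)) (sym val-i) (below p mp l)
        go p q (inj₂ refl) (inj₁ mq) l = subst₂ _<_ (sym val-i) (sym (val-other mq)) (above q mq l)
        go p q (inj₂ refl) (inj₂ refl) l = ⊥-elim (<-irrefl refl l)

      module _ (fi : Inc ωO f) where

        sq-inc-all : Inc U sq
        sq-inc-all = sq-inc (λ p q _ _ → ltN fi p q)

        private D-i = proj₂ (letter-just t k li)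

        sq<emb : z < 3 * f i + 1 → ¬ Leq U (sg t) (emb f) (sg t) sq
        sq<emb l = dictA TU t D-i sq-inc-all (emb-inc fi) (λ s m → ≡⇒≈ TU (sq-mark m))
                     (subst (λ x → Lt U x (emb f i)) (sym sq-letter) (at-≺ l))

        emb<sq : 3 * f i + 1 < z → ¬ Leq U (sg t) sq (sg t) (emb f)
        emb<sq l = dictA TU t D-i (emb-inc fi) sq-inc-all (λ s m → ≡⇒≈ TU (sym (sq-mark m)))
                     (subst (Lt U (emb f i)) (sym sq-letter) (at-≺ l))

  -- Comparison of two traces: domination or ties

  data Cmp (x y x' y' : ℕ) : Set where
    lt : x < y → x' < y' → Cmp x y x' y'
    eq : x ≡ y → x' ≡ y' → Cmp x y x' y'
    gt : y < x → y' < x' → Cmp x y x' y'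

  cmp-iff : ∀ {x y x' y'} → Cmp x y x' y' → Iff (x ≤ y) (x' ≤ y') × Iff (y ≤ x) (y' ≤ x')
  cmp-iff (lt l l') = both (<⇒≤ l) (<⇒≤ l') , neither (<⇒≱ l) (<⇒≱ l')
  cmp-iff (eq refl refl) = both ≤-refl ≤-refl , both ≤-refl ≤-refl
  cmp-iff (gt l l') = neither (<⇒≱ l) (<⇒≱ l') , both (<⇒≤ l) (<⇒≤ l')

  cmp-≡ : ∀ {x y x' y' X Y X' Y'} → X ≡ x → Y ≡ y → X' ≡ x' → Y' ≡ y' → Cmp x y x' y' → Cmp X Y X' Y'
  cmp-≡ refl refl refl refl c = c

  -- Positions are paired by letter index, not by their place in the traces.
  Match : ℕ → (t u : Trace) → (Fin (ar t) → ℕ) → (Fin (ar u) → ℕ) → Set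
  Match k t u a b = ∀ r → r < k → ∀ p q → letter t r ≡ just p → letter u r ≡ just q → a p ≡ b q

  match-sym : ∀ {k t u a b} → Match k t u a b → Match k u t b a
  match-sym h r l p q e d = sym (h r l q p d e)

  -- The case in which the traces decide a comparison before letter k is consulted.
  Dominates : ℕ → (t u : Trace) → Set
  Dominates k t u = ∀ c d → Inc ωO c → Inc ωO d → Match k t u c d → ¬ Leq ωO (sg t) c (sg u) d

  inc⁻ : ∀ {n} {a : Fin n → ℕ} → Inc ωO a → ∀ p q → a p < a q → toℕ p < toℕ q
  inc⁻ ia p q l = inc-≺⁻ ωO ia ωO-tot p q (<⇒≺ω l)

  module Compare (k : ℕ) (t u : Trace) (At : Alive t k) (Au : Alive u k)
           {i : Fin (ar t)} {j : Fin (ar u)} (li : letter t k ≡ just i) (lj : letter u k ≡ just j) where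

    record Partner (a : Fin (ar t) → ℕ) (b : Fin (ar u) → ℕ) (c : Fin (ar t) → ℕ) (d : Fin (ar u) → ℕ)
                   (p : Fin (ar t)) (q : Fin (ar u)) : Set where
      field
        mp : marks t k p ≡ true
        mq : marks u k q ≡ true
        ab : a p ≡ b q
        cd : c p ≡ d q

    module _ {a b c d} (ab : Match k t u a b) (cd : Match k t u c d) where

      partner₁ : ∀ p → marks t k p ≡ true → Σ (Fin (ar u)) (Partner a b c d p)
      partner₁ p m = let (r , l , e) = marks⇒letter t k m
                         (q , e') = Au r l
                     in q , record { mp = m ; mq = letter⇒marks u e' k l ; ab = ab r l p q e e' ; cd = cd r l p q e e' }

      partner₂ : ∀ q → marks u k q ≡ true → Σ (Fin (ar t)) (λ p → Partner a b c d p q)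
      partner₂ q m = let (r , l , e) = marks⇒letter u k m
                         (p , e') = At r l
                     in p , record { mp = letter⇒marks t e' k l ; mq = m ; ab = ab r l p q e' e ; cd = cd r l p q e' e }

    -- If (u , b) ≤ (t , a) although letter k of (t , a) is smaller, move letter k of t up and letter k of u
    -- down, and squeeze the rest.  The resulting joint type also lies between any other (u , d) and (t , c).
    module _ {a b c d} (ia : Inc ωO a) (ib : Inc ωO b) (ic : Inc ωO c) (id : Inc ωO d)
             (ab : Match k t u a b) (cd : Match k t u c d) (ai<bj : a i < b j)
             (b≤a : Leq ωO (sg u) b (sg t) a) where

      private
        -- Since a i < b j, an earlier letter left of i is also left of j, and one right of j is
        -- also right of i. This keeps `lo` and `hi` from passing matched letters of c and d.
        up : ∀ {p q} → Partner a b c d p q → toℕ p < toℕ i → toℕ q < toℕ j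
        up {p} {q} P l = inc⁻ ib q j (subst (_< b j) (Partner.ab P) (<-trans (ltN ia p i l) ai<bj))

        dn : ∀ {p q} → Partner a b c d p q → toℕ j < toℕ q → toℕ i < toℕ p
        dn {p} {q} P l = inc⁻ ia i p (<-trans ai<bj (subst (b j <_) (sym (Partner.ab P)) (ltN ib j q l)))

        lo = c i ⊓ d j
        hi = c i ⊔ d j
        -- The offsets 2 and 0 put letter k just above a i in t and just below b j in u, still in
        -- this order as a i < b j. On the other side `lo` and `hi` enforce the same order whatever
        -- c i and d j are.
        v = val t k li a (3 * a i + 2)
        w = val u k lj b (3 * b j + 0)
        v' = val t k li c (3 * lo + 0)
        w' = val u k lj d (3 * hi + 2)

        1≤2 : 1 ≤ 2
        1≤2 = s≤s z≤n

        v-below : ∀ p → marks t k p ≡ true → toℕ p < toℕ i → 3 * a p + 1 < 3 * a i + 2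
        v-below p _ l = digits 2 1≤2 (ltN ia p i l)
        v-above : ∀ p → marks t k p ≡ true → toℕ i < toℕ p → 3 * a i + 2 < 3 * a p + 1
        v-above p _ l = digits 2 ≤-refl (ltN ia i p l)
        w-below : ∀ q → marks u k q ≡ true → toℕ q < toℕ j → 3 * b q + 1 < 3 * b j + 0
        w-below q _ l = digits 2 1≤2 (ltN ib q j l)
        w-above : ∀ q → marks u k q ≡ true → toℕ j < toℕ q → 3 * b j + 0 < 3 * b q + 1
        w-above q _ l = digits 2 z≤n (ltN ib j q l)

        c<lo : ∀ {p q} → Partner a b c d p q → toℕ p < toℕ i → c p < lo
        c<lo {p} {q} P l = ⊓-pres-m< (ltN ic p i l) (subst (_< d j) (sym (Partner.cd P)) (ltN id q j (up P l)))
        hi<d : ∀ {p q} → Partner a b c d p q → toℕ j < toℕ q → hi < d q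
        hi<d {p} {q} P l = ⊔-pres-<m (subst (c i <_) (Partner.cd P) (ltN ic i p (dn P l))) (ltN id j q l)

        v'-below : ∀ p → marks t k p ≡ true → toℕ p < toℕ i → 3 * c p + 1 < 3 * lo + 0
        v'-below p m l = digits 2 1≤2 (c<lo (proj₂ (partner₁ ab cd p m)) l)
        v'-above : ∀ p → marks t k p ≡ true → toℕ i < toℕ p → 3 * lo + 0 < 3 * c p + 1
        v'-above p _ l = digits 2 z≤n (≤-<-trans (m⊓n≤m (c i) (d j)) (ltN ic i p l))
        w'-below : ∀ q → marks u k q ≡ true → toℕ q < toℕ j → 3 * d q + 1 < 3 * hi + 2
        w'-below q _ l = digits 2 1≤2 (<-≤-trans (ltN id q j l) (m≤n⊔m (c i) (d j)))
        w'-above : ∀ q → marks u k q ≡ true → toℕ j < toℕ q → 3 * hi + 2 < 3 * d q + 1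
        w'-above q m l = digits 2 ≤-refl (hi<d (proj₂ (partner₂ ab cd q m)) l)

        fresh : ∀ {s : Trace} {l p} → letter s k ≡ just l → marks s k p ≡ true → toℕ p ≢ toℕ l
        fresh {s} e m h with toℕ-injective h
        ... | refl with trans (sym m) (proj₁ (letter-just s k e))
        ... | ()

        same : ∀ p q → marks t k p ≡ true ⊎ p ≡ i → marks u k q ≡ true ⊎ q ≡ j → Cmp (v p) (w q) (v' p) (w' q)
        same p q (inj₁ mp) (inj₁ mq) =
          cmp-≡ (val-other t k li a _ mp) (val-other u k lj b _ mq) (val-other t k li c _ mp) (val-other u k lj d _ mq)
            (go (partner₂ ab cd q mq))
          where
          go : Σ (Fin (ar t)) (λ p' → Partner a b c d p' q) → Cmp (3 * a p + 1) (3 * b q + 1) (3 * c p + 1) (3 * d q + 1)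
          go (p' , P) rewrite sym (Partner.ab P) | sym (Partner.cd P) with <-cmp (toℕ p) (toℕ p')
          ... | tri< l _ _ = lt (digits 2 1≤2 (ltN ia p p' l)) (digits 2 1≤2 (ltN ic p p' l))
          ... | tri> _ _ l = gt (digits 2 1≤2 (ltN ia p' p l)) (digits 2 1≤2 (ltN ic p' p l))
          ... | tri≈ _ e _ with toℕ-injective e
          ... | refl = eq refl refl
        same p q (inj₁ mp) (inj₂ refl) =
          cmp-≡ (val-other t k li a _ mp) (val-i u k lj b _) (val-other t k li c _ mp) (val-i u k lj d _)
            (go (partner₁ ab cd p mp))
          where
          go : Σ (Fin (ar u)) (Partner a b c d p) → Cmp (3 * a p + 1) (3 * b j + 0) (3 * c p + 1) (3 * hi + 2)
          go (q' , P) with <-cmp (toℕ q') (toℕ j)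
          ... | tri≈ _ e _ = ⊥-elim (fresh lj (Partner.mq P) e)
          ... | tri< l _ _ = lt (subst (λ x → 3 * x + 1 < 3 * b j + 0) (sym (Partner.ab P)) (w-below q' (Partner.mq P) l))
                                (subst (λ x → 3 * x + 1 < 3 * hi + 2) (sym (Partner.cd P)) (w'-below q' (Partner.mq P) l))
          ... | tri> _ _ l = gt (subst (λ x → 3 * b j + 0 < 3 * x + 1) (sym (Partner.ab P)) (w-above q' (Partner.mq P) l))
                                (subst (λ x → 3 * hi + 2 < 3 * x + 1) (sym (Partner.cd P)) (w'-above q' (Partner.mq P) l))
        same p q (inj₂ refl) (inj₁ mq) =
          cmp-≡ (val-i t k li a _) (val-other u k lj b _ mq) (val-i t k li c _) (val-other u k lj d _ mq)
            (go (partner₂ ab cd q mq))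
          where
          go : Σ (Fin (ar t)) (λ p' → Partner a b c d p' q) → Cmp (3 * a i + 2) (3 * b q + 1) (3 * lo + 0) (3 * d q + 1)
          go (p' , P) with <-cmp (toℕ i) (toℕ p')
          ... | tri≈ _ e _ = ⊥-elim (fresh li (Partner.mp P) (sym e))
          ... | tri< l _ _ = lt (subst (λ x → 3 * a i + 2 < 3 * x + 1) (Partner.ab P) (v-above p' (Partner.mp P) l))
                                (subst (λ x → 3 * lo + 0 < 3 * x + 1) (Partner.cd P) (v'-above p' (Partner.mp P) l))
          ... | tri> _ _ l = gt (subst (λ x → 3 * x + 1 < 3 * a i + 2) (Partner.ab P) (v-below p' (Partner.mp P) l))
                                (subst (λ x → 3 * x + 1 < 3 * lo + 0) (Partner.cd P) (v'-below p' (Partner.mp P) l))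
        same p q (inj₂ refl) (inj₂ refl) =
          cmp-≡ (val-i t k li a _) (val-i u k lj b _) (val-i t k li c _) (val-i u k lj d _)
            (lt (digits 2 ≤-refl ai<bj)
                (+-mono-≤-< (*-monoʳ-≤ 3 (≤-trans (m⊓n≤m (c i) (d j)) (m≤m⊔n (c i) (d j)))) (s≤s z≤n)))

        iv = sq-inc-all t k li a _ v-below v-above ia
        iw = sq-inc-all u k lj b _ w-below w-above ib
        iv' = sq-inc-all t k li c _ v'-below v'-above ic
        iw' = sq-inc-all u k lj d _ w'-below w'-above id

        T₁ : SameType U U (sq t k li a (3 * a i + 2)) (sq u k lj b (3 * b j + 0)) (sq t k li c (3 * lo + 0)) (sq u k lj d (3 * hi + 2))
        T₁ = squeeze-type (marks t (suc k)) (marks u (suc k)) {natO} {natO} _ _ _ _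
               (λ p q mp mq → cmp-iff (same p q (main-cases t k li a 0 mp) (main-cases u k lj b 0 mq)))

        W V W' V' Ea Eb Ec Ed : BarElt D U
        W = place u (sq u k lj b (3 * b j + 0)) iw
        V = place t (sq t k li a (3 * a i + 2)) iv
        W' = place u (sq u k lj d (3 * hi + 2)) iw'
        V' = place t (sq t k li c (3 * lo + 0)) iv'
        Ea = place t (emb a) (emb-inc ia)
        Eb = place u (emb b) (emb-inc ib)
        Ec = place t (emb c) (emb-inc ic)
        Ed = place u (emb d) (emb-inc id)

        W⊏Eb : W ⊏ Eb
        W⊏Eb = sq<emb u k lj b _ w-below w-above ib (+-monoʳ-< (3 * b j) (s≤s z≤n))
        Ea⊏V : Ea ⊏ V
        Ea⊏V = emb<sq t k li a _ v-below v-above ia (+-monoʳ-< (3 * a i) (s≤s (s≤s z≤n)))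
        Ed⊏W' : Ed ⊏ W'
        Ed⊏W' = emb<sq u k lj d _ w'-below w'-above id (+-mono-≤-< (*-monoʳ-≤ 3 (m≤n⊔m (c i) (d j))) (s≤s (s≤s z≤n)))
        V'⊏Ec : V' ⊏ Ec
        V'⊏Ec = sq<emb t k li c _ v'-below v'-above ic (+-mono-≤-< (*-monoʳ-≤ 3 (m⊓n≤m (c i) (d j))) (s≤s z≤n))

        W⊑V : W ⊑ V
        W⊑V = ⊑-trans TU W Eb V (⊏⇒⊑ TU W Eb W⊏Eb)
                (⊑-trans TU Eb Ea V (proj₁ (emb-Leq ib ia) b≤a) (⊏⇒⊑ TU Ea V Ea⊏V))

        W'⊑V' : W' ⊑ V'
        W'⊑V' = transfer TU TU (type-swap T₁) iw iv iw' iv' W⊑V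

      reversal : ¬ Leq ωO (sg t) c (sg u) d
      -- The comparisons Ec ≤ Ed < W' ≤ V' < Ec form a cycle.
      reversal c≤d = V'⊏Ec (⊑-trans TU Ec Ed V' (proj₁ (emb-Leq ic id) c≤d)
                       (⊑-trans TU Ed W' V' (⊏⇒⊑ TU Ed W' Ed⊏W') W'⊑V'))

  MatchA : (A : Ord) → ℕ → (t u : Trace) → (Fin (ar t) → Car A) → (Fin (ar u) → Car A) → Set
  MatchA A k t u a b = ∀ r → r < k → ∀ p q → letter t r ≡ just p → letter u r ≡ just q → Eqv A (a p) (b q)

  -- Guarantees that a value for letter k that fits among the earlier letters of one trace also fits
  -- in the other.
  Coherent : ℕ → (t u : Trace) → Fin (ar t) → Fin (ar u) → Set
  Coherent k t u i j = ∀ r → r < k → ∀ p q → letter t r ≡ just p → letter u r ≡ just q →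
                       Iff (toℕ p < toℕ i) (toℕ q < toℕ j)

  record Tied (k : ℕ) (t u : Trace) (i : Fin (ar t)) (j : Fin (ar u)) : Set where
    field
      tie-< : ∀ {a b} → Inc ωO a → Inc ωO b → Match k t u a b → a i < b j → ¬ Leq ωO (sg u) b (sg t) a
      tie-> : ∀ {a b} → Inc ωO a → Inc ωO b → Match k t u a b → b j < a i → ¬ Leq ωO (sg t) a (sg u) b

  open Tied

  module _ {k : ℕ} {t u : Trace} {i : Fin (ar t)} {j : Fin (ar u)} (tied : Tied k t u i j)
           {A : Ord} (T : Tot A) {a : Fin (ar t) → Car A} {b : Fin (ar u) → Car A}
           (ia : Inc A a) (ib : Inc A b) (m : MatchA A k t u a b) where

    private
      st = toN-type T ia ib
      ia' = toN₁-inc T ia ib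
      ib' = toN₂-inc T ia ib
      m' : Match k t u (toN₁ T ia ib) (toN₂ T ia ib)
      m' r l p q e d = let (x , y) = type-≈ st (m r l p q e d) in ≤-antisym x y

    tie-<A : Lt A (a i) (b j) → ¬ Leq A (sg u) b (sg t) a
    tie-<A l h = tie-< tied ia' ib' m' (≺ω⇒< (type-≺ st l)) (transfer T ωO-tot (type-swap st) ib ia ib' ia' h)

    tie->A : Lt A (b j) (a i) → ¬ Leq A (sg t) a (sg u) b
    tie->A l h = tie-> tied ia' ib' m' (≺ω⇒< (type-≻ st l)) (transfer T ωO-tot st ia ib ia' ib' h)

  dominatesA : ∀ {k t u} → Dominates k t u → ∀ {A} (T : Tot A) {a : Fin (ar t) → Car A} {b : Fin (ar u) → Car A} →
           Inc A a → Inc A b → MatchA A k t u a b → ¬ Leq A (sg t) a (sg u) b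
  dominatesA h T ia ib m l =
    h _ _ (toN₁-inc T ia ib) (toN₂-inc T ia ib)
      (λ r l p q e d → let (x , y) = type-≈ (toN-type T ia ib) (m r l p q e d) in ≤-antisym x y)
      (transfer T ωO-tot (toN-type T ia ib) ia ib (toN₁-inc T ia ib) (toN₂-inc T ia ib) l)

  -- Every position of t is matched to one of u, so u alone determines the joint type.
  exhausted : ∀ {k t u} → Alive t k → Alive u k → (∀ p → marks t k p ≡ true) →
              ∀ {a b c d} → Inc ωO a → Inc ωO b → Inc ωO c → Inc ωO d → Match k t u a b → Match k t u c d →
              SameType ωO ωO a b c d
  exhausted {k} {t} {u} At Au all {a} {b} {c} {d} ia ib ic id ab cd = record
    { fwd = λ p q → proj₁ (cmp-iff (go p q)) ; bwd = λ p q → proj₂ (cmp-iff (go p q)) }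
    where
    go : ∀ p q → Cmp (a p) (b q) (c p) (d q)
    go p q = by (marks⇒letter t k (all p))
      where
      by : (Σ ℕ λ r → r < k × letter t r ≡ just p) → Cmp (a p) (b q) (c p) (d q)
      by (r , l , e) = cmp-≡ (ab r l p _ e (proj₂ (Au r l))) refl (cd r l p _ e (proj₂ (Au r l))) refl (order (proj₁ (Au r l)))
        where
        order : ∀ q' → Cmp (b q') (b q) (d q') (d q)
        order q' with <-cmp (toℕ q') (toℕ q)
        ... | tri< x _ _ = lt (ltN ib q' q x) (ltN id q' q x)
        ... | tri> _ _ x = gt (ltN ib q q' x) (ltN id q q' x)
        ... | tri≈ _ x _ = eq (cong b (toℕ-injective x)) (cong d (toℕ-injective x))

  maybe-case : ∀ {X : Set} (m : Maybe X) → (Σ X λ x → m ≡ just x) ⊎ m ≡ nothing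
  maybe-case (just x) = inj₁ (x , refl)
  maybe-case nothing = inj₂ refl

  record Linked (k : ℕ) (t u : Trace) : Set where
    field
      {i} : Fin (ar t)
      {j} : Fin (ar u)
      li  : letter t k ≡ just i
      lj  : letter u k ≡ just j
      coh : Coherent k t u i j
      tie : Tied k t u i j

  module _ {k : ℕ} {t u : Trace} (At : Alive t k) (Au : Alive u k) (nb : ¬ Dominates k t u) where

    private
      -- An earlier letter that is left of one letter k and right of the other would order the two
      -- in the same way in all matched placements. Then `reversal` turns any comparison against
      -- this order into domination, and the absence of such comparisons is itself domination the
      -- other way.
      coherent : ∀ {i j} → letter t k ≡ just i → letter u k ≡ just j → ¬ Dominates k u t → Coherent k t u i j
      coherent {i} {j} li lj nb' r l p q e d = to , from
        where
        fresh : ∀ {s : Trace} {x y} → letter s r ≡ just x → letter s k ≡ just y → toℕ x ≢ toℕ y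
        fresh {s} ex ey h with toℕ-injective h
        ... | refl = <-irrefl (letter-injective s {r} {k} ex ey) l
        to : toℕ p < toℕ i → toℕ q < toℕ j
        to p<i with <-cmp (toℕ q) (toℕ j)
        ... | tri< x _ _ = x
        ... | tri≈ _ x _ = ⊥-elim (fresh d lj x)
        ... | tri> _ _ j<q = ⊥-elim (nb λ a b ia ib ab a≤b → nb' λ c f ic if cf →
                Compare.reversal k u t Au At lj li ib ia ic if (match-sym {k} {t} {u} ab) cf
                  (<-trans (ltN ib j q j<q) (subst (_< a i) (ab r l p q e d) (ltN ia p i p<i))) a≤b)
        from : toℕ q < toℕ j → toℕ p < toℕ i
        from q<j with <-cmp (toℕ p) (toℕ i)
        ... | tri< x _ _ = x
        ... | tri≈ _ x _ = ⊥-elim (fresh e li x)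
        ... | tri> _ _ i<p = ⊥-elim (nb' λ b a ib ia ba b≤a → nb λ c f ic if cf →
                Compare.reversal k t u At Au li lj ia ib ic if (match-sym {k} {u} {t} ba) cf
                  (<-trans (ltN ia i p i<p) (subst (_< b j) (ba r l q p d e) (ltN ib q j q<j))) b≤a)

    -- The comparison at hand excludes domination of t by u, the hypothesis that of u by t. Had one
    -- trace run out of letters, all matched placements would share one joint type, and a ≰ b would
    -- again give domination of u by t; a violated tie does so by `reversal`.
    linked : ∀ {a b} → Inc ωO a → Inc ωO b → Match k t u a b → Leq ωO (sg u) b (sg t) a → ¬ Leq ωO (sg t) a (sg u) b →
             Linked k t u
    linked {a} {b} ia ib ab b≤a a≰b = go (maybe-case (letter t k)) (maybe-case (letter u k))
      where
      nb' : ¬ Dominates k u t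
      nb' h = h b a ib ia (match-sym {k} {t} {u} ab) b≤a
      go : (Σ (Fin (ar t)) λ i → letter t k ≡ just i) ⊎ letter t k ≡ nothing →
           (Σ (Fin (ar u)) λ j → letter u k ≡ just j) ⊎ letter u k ≡ nothing → Linked k t u
      go (inj₁ (i , li)) (inj₁ (j , lj)) = record
        { li = li ; lj = lj ; coh = coherent li lj nb'
        ; tie = record
            { tie-< = λ ix iy xy l h → nb λ c d ic id cd → Compare.reversal k t u At Au li lj ix iy ic id xy cd l h
            ; tie-> = λ ix iy xy l h → nb' λ d c id ic dc →
                        Compare.reversal k u t Au At lj li iy ix id ic (match-sym {k} {t} {u} xy) dc l h } }
      go (inj₂ n) _ = ⊥-elim (nb λ c d ic id cd c≤d →
        a≰b (transfer ωO-tot ωO-tot (exhausted At Au (letter-nothing t {k} n) ic id ia ib cd ab) ic id ia ib c≤d))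
      go _ (inj₂ n) = ⊥-elim (nb λ c d ic id cd c≤d →
        a≰b (transfer ωO-tot ωO-tot (type-swap (exhausted Au At (letter-nothing u {k} n) id ic ib ia
                (match-sym {k} {t} {u} cd) (match-sym {k} {t} {u} ab))) ic id ia ib c≤d))

  module _ (k : ℕ) (s : Trace) {X : Set} (h : ∀ r → r < k → X) where

    indexed : ∀ p → marks s k p ≡ true → X
    indexed p m = let (r , l , _) = marks⇒letter s k m in h r l

    indexed-letter : ∀ {r p} (l : r < k) → letter s r ≡ just p → ∀ m → indexed p m ≡ h r l
    indexed-letter {r} {p} l e m = by (marks⇒letter s k m)
      where
      by : (w : Σ ℕ λ r' → r' < k × letter s r' ≡ just p) → h (proj₁ w) (proj₁ (proj₂ w)) ≡ h r l
      by (r' , l' , e') with letter-injective s {r} {r'} e e'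
      ... | refl = cong (h r) (<-irrelevant l' l)

  -- Two traces linked to s are compared through a placement of s whose letter k lies strictly in between.
  module _ {k : ℕ} {s t u : Trace} (As : Alive s k) (At : Alive t k) (st : Linked k s t) (su : Linked k s u)
           {e₀ : Fin (ar s) → ℕ} {a₀ : Fin (ar t) → ℕ} (ie₀ : Inc ωO e₀) (ia₀ : Inc ωO a₀) (m₀ : Match k s t e₀ a₀) where

    open Linked

    between : ∀ {i j} → letter t k ≡ just i → letter u k ≡ just j →
              ∀ {a b} → Inc ωO a → Inc ωO b → Match k t u a b → a i < b j → ¬ Leq ωO (sg u) b (sg t) a
    between {i} {j} li' lj' {a} {b} ia ib ab ai<bj b≤a = s≰t (⊑-trans TU S B A s≤u (proj₁ (emb-Leq ib ia) b≤a))
      where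
      l = Linked.i st
      ll = Linked.li st
      i≡ : Linked.j st ≡ i
      i≡ = just-injective (trans (sym (Linked.lj st)) li')
      j≡ : Linked.j su ≡ j
      j≡ = just-injective (trans (sym (Linked.lj su)) lj')
      l≡ : Linked.i su ≡ l
      l≡ = just-injective (trans (sym (Linked.li su)) ll)
      image : ∀ p → marks s k p ≡ true → Σ ℕ λ r → r < k × letter s r ≡ just p × Σ (Fin (ar t)) λ q → letter t r ≡ just q
      image p m = let (r , x , e) = marks⇒letter s k m in r , x , e , At r x
      h : ∀ r → r < k → ℕ
      h r x = a (proj₁ (At r x))
      pick : ∀ p → marks s k p ≡ true ⊎ marks s k p ≡ false → ℕ
      pick p (inj₁ m) = indexed k s h p m
      -- A default that squeezing never reads, since f is consulted on the marks only.
      pick p (inj₂ _) = 0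
      f : Fin (ar s) → ℕ
      f p = pick p (bool s (marks s k p))
      f-mark : ∀ {r p q} → r < k → letter s r ≡ just p → letter t r ≡ just q → f p ≡ a q
      f-mark {r} {p} {q} x e d = go (bool s (marks s k p))
        where
        go : (c : marks s k p ≡ true ⊎ marks s k p ≡ false) → pick p c ≡ a q
        go (inj₁ m) = trans (indexed-letter k s h {r} x e m) (cong a (just-injective (trans (sym (proj₂ (At r x))) d)))
        go (inj₂ n) with trans (sym (letter⇒marks s {r} e k x)) n
        ... | ()
      mono : ∀ p q → marks s k p ≡ true → marks s k q ≡ true → toℕ p < toℕ q → f p < f q
      mono p q mp mq x = by (image p mp) (image q mq)
        where
        by : (Σ ℕ λ r → r < k × letter s r ≡ just p × Σ (Fin (ar t)) λ q → letter t r ≡ just q) →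
             (Σ ℕ λ r → r < k × letter s r ≡ just q × Σ (Fin (ar t)) λ q → letter t r ≡ just q) → f p < f q
        by (r , y , e , p' , d) (r' , y' , e' , q' , d') =
          subst₂ _<_ (sym (f-mark y e d)) (sym (f-mark y' e' d'))
            (ltN ia p' q' (inc⁻ ia₀ p' q' (subst₂ _<_ (m₀ r y p p' e d) (m₀ r' y' q q' e' d') (ltN ie₀ p q x))))
      below : ∀ p → marks s k p ≡ true → toℕ p < toℕ l → 3 * f p + 1 < 3 * a i + 2
      below p m x = by (image p m)
        where
        by : (Σ ℕ λ r → r < k × letter s r ≡ just p × Σ (Fin (ar t)) λ q → letter t r ≡ just q) → 3 * f p + 1 < 3 * a i + 2
        by (r , y , e , p' , d) = subst (λ z → 3 * z + 1 < 3 * a i + 2) (sym (f-mark y e d))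
          (digits 2 (s≤s z≤n) (ltN ia p' i (subst (λ z → toℕ p' < toℕ z) i≡ (proj₁ (coh st r y p p' e d) x))))
      above : ∀ p → marks s k p ≡ true → toℕ l < toℕ p → 3 * a i + 2 < 3 * f p + 1
      above p m x = by (image p m)
        where
        by : (Σ ℕ λ r → r < k × letter s r ≡ just p × Σ (Fin (ar t)) λ q → letter t r ≡ just q) → 3 * a i + 2 < 3 * f p + 1
        by (r , y , e , p' , d) = subst (λ z → 3 * a i + 2 < 3 * z + 1) (sym (f-mark y e d)) (digits 2 ≤-refl (ltN ia i p' gtr))
          where
          gtr : toℕ i < toℕ p'
          gtr with <-cmp (toℕ i) (toℕ p')
          ... | tri< z _ _ = z
          ... | tri> _ _ z = ⊥-elim (<-asym x (proj₂ (coh st r y p p' e d) (subst (λ w → toℕ p' < toℕ w) (sym i≡) z)))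
          ... | tri≈ _ z _ with toℕ-injective z
          ... | refl = ⊥-elim (<-irrefl (letter-injective t {r} {k} d li') y)
      -- The value lies strictly between 3 a i + 1 and 3 b j + 1, the letters k of t and u, so the
      -- two ties give A < S < B.
      sq-s = sq s k ll f (3 * a i + 2)
      is = sq-inc s k ll f (3 * a i + 2) below above mono
      S A B : BarElt D U
      S = place s sq-s is
      A = place t (emb a) (emb-inc ia)
      B = place u (emb b) (emb-inc ib)
      sq-at : ∀ {r p q} → r < k → letter s r ≡ just p → letter t r ≡ just q → sq-s p ≡ emb a q
      sq-at {r} x e d = trans (sq-mark s k ll f (3 * a i + 2) (letter⇒marks s {r} e k x)) (cong (λ z → at (3 * z + 1)) (f-mark x e d))
      s≰t : ¬ S ⊑ A
      s≰t = tie->A (tie st) TU is (emb-inc ia) (λ r x p q e d → ≡⇒≈ TU (sq-at x e d))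
              (subst₂ (Lt U) (cong (emb a) (sym i≡)) (sym (sq-letter s k ll f (3 * a i + 2))) (at-≺ (+-monoʳ-< (3 * a i) ≤-refl)))
      s≤u : S ⊑ B
      s≤u = ⊏⇒⊑ TU S B (tie-<A (tie su) TU is (emb-inc ib)
              (λ r x p q e d → ≡⇒≈ TU (trans (sq-at x e (proj₂ (At r x)))
                  (cong (λ z → at (3 * z + 1)) (ab r x _ q (proj₂ (At r x)) d))))
              (subst₂ (Lt U) (trans (sym (sq-letter s k ll f (3 * a i + 2))) (cong sq-s (sym l≡))) (cong (emb b) (sym j≡))
                (at-≺ (digits 2 ≤-refl ai<bj))))

  module _ {A B : Ord} (h : OrdEmb A B) where

    open OrdEmb h

    emb-Inc : ∀ {n} {a : Fin n → Car A} → Inc A a → Inc B (fun ∘ a)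
    emb-Inc ia i j l = let (p , q) = ia i j l in mono p , λ z → q (OrdEmb.refl h z)

    emb-SameType : ∀ {n m} (a : Fin n → Car A) (b : Fin m → Car A) → SameType A B a b (fun ∘ a) (fun ∘ b)
    emb-SameType a b = record { fwd = λ i j → mono , OrdEmb.refl h ; bwd = λ i j → mono , OrdEmb.refl h }

  ⊏⇒BarLt : ∀ {A} → Tot A → (x y : BarElt D A) → x ⊏ y → BarLt D A x y
  ⊏⇒BarLt T x y l = ⊑⇒Bar T {x} {y} (⊏⇒⊑ T x y l) , λ r → l (Bar⇒⊑ {x = y} {x} r)

  BarLt⇒⊏ : ∀ {A} → Tot A → (x y : BarElt D A) → BarLt D A x y → x ⊏ y
  BarLt⇒⊏ T x y (_ , n) r = n (⊑⇒Bar T {y} {x} r)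

  barWF-emb : ∀ {A B} → Tot A → Tot B → OrdEmb A B → BarWF D B → BarWF D A
  barWF-emb {A} {B} S T h wf (s , desc) = wf ((λ n → barMap h (s n)) , λ n → ⊏⇒BarLt T _ _ λ r →
    BarLt⇒⊏ S (s (suc n)) (s n) (desc n)
      (transfer T S (type-sym (emb-SameType h (el (s n)) (el (s (suc n)))))
        (emb-Inc h (el-inc (s n))) (emb-Inc h (el-inc (s (suc n)))) (el-inc (s n)) (el-inc (s (suc n))) r))

  ωO+ : OrdEmb (onePlus natO) ωO
  ωO+ = record { fun = f ; mono = λ {x} {y} → mo x y ; refl = λ {x} {y} → re x y }
    where
    f : Maybe (Σ ℕ λ _ → ⊤) → ℕ
    f nothing = 0
    f (just (x , _)) = suc x
    mo : ∀ x y → Le (onePlus natO) x y → f x ≤ f y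
    mo nothing y l = z≤n
    mo (just x) (just y) l = s≤s l
    re : ∀ x y → f x ≤ f y → Le (onePlus natO) x y
    re nothing y l = tt
    re (just x) (just y) (s≤s l) = l

  barWF-U : BarWF D ω² → BarWF D U
  barWF-U = barWF-emb TU (lex-tot ωO-tot ωO-tot) (lexMap ωO+ idω)

  linkedA : ∀ {k t u} → Alive t k → Alive u k → ¬ Dominates k t u → ∀ {A} (T : Tot A)
            {a : Fin (ar t) → Car A} {b : Fin (ar u) → Car A} → Inc A a → Inc A b → MatchA A k t u a b →
            Leq A (sg u) b (sg t) a → ¬ Leq A (sg t) a (sg u) b → Linked k t u
  linkedA At Au nd T ia ib m b≤a a≰b =
    linked At Au nd ia' ib' (λ r l p q e d → let (x , y) = type-≈ st (m r l p q e d) in ≤-antisym x y)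
      (transfer T ωO-tot (type-swap st) ib ia ib' ia' b≤a)
      (λ h → a≰b (transfer ωO-tot T (type-sym st) ia' ib' ia ib h))
    where
    st = toN-type T ia ib
    ia' = toN₁-inc T ia ib
    ib' = toN₂-inc T ia ib

  -- Limits of the letters along a descending sequence

  max< : ∀ k {P : ℕ → ℕ → Set} → (∀ r → r < k → Σ ℕ (P r)) → ℕ
  max< zero h = 0
  max< (suc k) h = proj₁ (h k ≤-refl) ⊔ max< k (λ r l → h r (m≤n⇒m≤1+n l))

  max<-upper : ∀ k {P : ℕ → ℕ → Set} (h : ∀ r → r < k → Σ ℕ (P r)) → ∀ r (l : r < k) → proj₁ (h r l) ≤ max< k h
  max<-upper (suc k) {P} h r l = go (m≤n⇒m<n∨m≡n l)
    where
    go : suc r < suc k ⊎ suc r ≡ suc k → proj₁ (h r l) ≤ max< (suc k) h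
    go (inj₁ (s≤s l')) = ≤-trans (subst (λ z → proj₁ (h r z) ≤ max< k (λ r l → h r (m≤n⇒m≤1+n l))) (<-irrelevant _ l)
                            (max<-upper k (λ r l → h r (m≤n⇒m≤1+n l)) r l')) (m≤n⊔m _ _)
    go (inj₂ refl) = subst (λ z → proj₁ (h k l) ≤ proj₁ (h k z) ⊔ max< k (λ r l → h r (m≤n⇒m≤1+n l))) (<-irrelevant l _) (m≤m⊔n _ _)

  below-rec : (P : ℕ → Set) → (∀ k → (∀ r → r < k → P r) → P k) → ∀ k → P k
  below-rec P step k = step k (go k)
    where
    go : ∀ k r → r < k → P r
    go (suc k) r (s≤s l) = step r (λ r' l' → go k r' (<-≤-trans l' l))

  module Sequence {A : Ord} (T : Tot A) (s : ℕ → BarElt D A) (desc : ∀ n → BarLt D A (s (suc n)) (s n))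
                  (wf : BarWF D ω²) where

    tr : ℕ → Trace
    tr n = traceOf (s n)

    step⊏ : ∀ n → s (suc n) ⊏ s n
    step⊏ n = BarLt⇒⊏ T (s (suc n)) (s n) (desc n)

    s-⊏ : ∀ {n m} → n < m → s m ⊏ s n
    s-⊏ {n} {suc m} (s≤s l) r =
      [ (λ n<m → s-⊏ n<m (⊑-trans T (s n) (s (suc m)) (s m) r (⊏⇒⊑ T (s (suc m)) (s m) (step⊏ m))))
      , (λ { refl → step⊏ m r }) ]′ (m≤n⇒m<n∨m≡n l)

    Letters : ℕ → ℕ → Set
    Letters k N = ∀ t → N ≤ t → Σ (Fin (len (s t))) λ p → letter (tr t) k ≡ just p

    value : ∀ k {N} → Letters k N → ∀ t → N ≤ t → Car A
    value k L t l = el (s t) (proj₁ (L t l))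

    -- Isolates the single fact that the ω-model has to contribute; the construction of limits is
    -- purely combinatorial.
    Stable : Set
    Stable = ∀ k N (L : Letters k N) →
      (∀ t t' (l : N ≤ t) (l' : N ≤ t') → t < t' → Le A (value k L t' l') (value k L t l)) →
      Σ ℕ λ N' → Σ (N ≤ N') λ l₀ → ∀ t (l : N ≤ t) → N' ≤ t → Eqv A (value k L t l) (value k L N' l₀)

    record Limit (k N : ℕ) : Set where
      field
        x       : Car A
        letters : Letters k N
        limit-≈ : ∀ t (l : N ≤ t) → Eqv A (value k letters t l) x
        tied    : ∀ t t' → N ≤ t → N ≤ t' → ∀ {i j} → letter (tr t) k ≡ just i → letter (tr t') k ≡ just j →
                  Tied k (tr t) (tr t') i j

    open Limit

    module Step (k : ℕ) (IH : ∀ r → r < k → Σ ℕ (Limit r)) (stable : Stable) where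

      N₀ = max< k IH

      low : ∀ {t} → N₀ ≤ t → ∀ r (l : r < k) → proj₁ (IH r l) ≤ t
      low le r l = ≤-trans (max<-upper k IH r l) le

      alive : ∀ t → N₀ ≤ t → Alive (tr t) k
      alive t le r l = letters (proj₂ (IH r l)) t (low le r l)

      matches : ∀ t t' → N₀ ≤ t → N₀ ≤ t' → MatchA A k (tr t) (tr t') (el (s t)) (el (s t'))
      matches t t' le le' r l p q e d = ≈-trans T (at-x t le p e) (≈-sym A (at-x t' le' q d))
        where
        at-x : ∀ t → N₀ ≤ t → ∀ p → letter (tr t) r ≡ just p → Eqv A (el (s t) p) (x (proj₂ (IH r l)))
        at-x t le p e = subst (λ z → Eqv A (el (s t) z) (x (proj₂ (IH r l))))
          (just-injective (trans (sym (proj₂ (letters (proj₂ (IH r l)) t (low le r l)))) e))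
          (limit-≈ (proj₂ (IH r l)) t (low le r l))

      -- A chain of dominating traces would give a descending sequence over ω² after squeezing.
      module _ (next : ∀ n → N₀ ≤ n → Σ ℕ λ m → n < m × Dominates k (tr n) (tr m)) where

        private
          c : ℕ → Σ ℕ (N₀ ≤_)
          c zero = N₀ , ≤-refl
          c (suc l) = let (n , le) = c l ; (m , less , _) = next n le in m , ≤-trans le (<⇒≤ less)

          -- Letter r gets its place in the trace at N₀ as common value; as the letters have
          -- settled, their order is the same in all members of the chain.
          h : ∀ r → r < k → Σ ℕ λ _ → ⊤
          h r l = toℕ (proj₁ (alive N₀ ≤-refl r l)) , tt

          v : ∀ n p → marks (tr n) k p ≡ true → Σ ℕ λ _ → ⊤
          v n = indexed k (tr n) h

          v-letter : ∀ n {r p} (l : r < k) → letter (tr n) r ≡ just p → ∀ m → v n p m ≡ h r l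
          v-letter n {r} = indexed-letter k (tr n) h {r}

          sq-c : ∀ n → Fin (len (s n)) → Car U
          sq-c n = squeeze (marks (tr n) k) {natO} (v n)

          sq-c-inc : ∀ n → N₀ ≤ n → Inc U (sq-c n)
          sq-c-inc n le = squeeze-inc (marks (tr n) k) {natO} (v n) λ p q mp mq l →
            go mp mq l (marks⇒letter (tr n) k mp) (marks⇒letter (tr n) k mq)
            where
            go : ∀ {p q} mp mq → toℕ p < toℕ q → (Σ ℕ λ r → r < k × letter (tr n) r ≡ just p) →
                 (Σ ℕ λ r → r < k × letter (tr n) r ≡ just q) → Lt (onePlus natO) (just (v n p mp)) (just (v n q mq))
            go {p} {q} mp mq l (r , y , e) (r' , y' , e') =
              subst₂ (λ a b → Lt (onePlus natO) (just a) (just b)) (sym (v-letter n {r} y e mp)) (sym (v-letter n {r'} y' e' mq))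
                (<⇒≺ω (inc-≺⁻ A (el-inc (s N₀)) T (proj₁ a₀) (proj₁ b₀)
                  (≼-≺-trans T (proj₂ (matches n N₀ le ≤-refl r y p (proj₁ a₀) e (proj₂ a₀)))
                    (≺-≼-trans T (el-inc (s n) p q l) (proj₁ (matches n N₀ le ≤-refl r' y' q (proj₁ b₀) e' (proj₂ b₀)))))))
              where
              a₀ = alive N₀ ≤-refl r y
              b₀ = alive N₀ ≤-refl r' y'

          q : ℕ → BarElt D U
          q l = place (tr (proj₁ (c l))) (sq-c (proj₁ (c l))) (sq-c-inc _ (proj₂ (c l)))

          sq-c-letter : ∀ n {r p} (l : r < k) → letter (tr n) r ≡ just p → sq-c n p ≡ (just (h r l) , 0)
          sq-c-letter n {r} l e = trans (squeeze-main (marks (tr n) k) {natO} (v n) (letter⇒marks (tr n) {r} e k l))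
                                    (cong (λ z → just z , 0) (v-letter n {r} l e _))

          q-desc : ∀ l → q (suc l) ⊏ q l
          q-desc l = dominatesA (proj₂ (proj₂ (next _ (proj₂ (c l))))) TU (sq-c-inc _ (proj₂ (c l))) (sq-c-inc _ (proj₂ (c (suc l))))
            (λ r y a b e d → ≡⇒≈ TU (trans (sq-c-letter (proj₁ (c l)) {r} y e) (sym (sq-c-letter (proj₁ (c (suc l))) {r} y d))))

        no-chain : ⊥
        no-chain = barWF-U wf (q , λ l → ⊏⇒BarLt TU (q (suc l)) (q l) (q-desc l))

      -- Otherwise every trace from N₀ on would dominate a later one, which yields the excluded
      -- chain.
      pivotal : Σ ℕ λ n → N₀ ≤ n × (∀ m → n < m → ¬ Dominates k (tr n) (tr m))
      pivotal = by-contra λ h → no-chain λ n le → by-contra λ h' →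
        h (n , le , λ m less d → h' (m , less , d))

      n* = proj₁ pivotal
      N₁ : ℕ
      N₁ = suc n*

      N₀≤ : ∀ {t} → N₁ ≤ t → N₀ ≤ t
      N₀≤ l = ≤-trans (proj₁ (proj₂ pivotal)) (<⇒≤ l)

      -- The pivot excludes domination, and the descent from s n* to s t supplies the strict
      -- comparison.
      link : ∀ t → N₁ ≤ t → Linked k (tr n*) (tr t)
      link t l = linkedA (alive n* le) (alive t (N₀≤ l)) (proj₂ (proj₂ pivotal) t l) T (el-inc (s n*)) (el-inc (s t))
        (matches n* t le (N₀≤ l)) (⊏⇒⊑ T (s t) (s n*) (s-⊏ l)) (s-⊏ l)
        where le = proj₁ (proj₂ pivotal)

      letters₁ : Letters k N₁
      letters₁ t l = _ , Linked.lj (link t l)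

      -- Links with the pivot become ties between later traces by `between`; the settled letters of
      -- s n* and s t provide its sample matching.
      tie₁ : ∀ t t' → N₁ ≤ t → N₁ ≤ t' → ∀ {i j} → letter (tr t) k ≡ just i → letter (tr t') k ≡ just j →
             Tied k (tr t) (tr t') i j
      tie₁ t t' l l' li lj = record
        { tie-< = λ {a} {b} ia ib m → btw t t' l l' li lj ia ib m
        ; tie-> = λ {a} {b} ia ib m → btw t' t l' l lj li ib ia (match-sym {k} {tr t} {tr t'} m) }
        where
        le = proj₁ (proj₂ pivotal)
        btw : ∀ t t' → N₁ ≤ t → N₁ ≤ t' → ∀ {i j} → letter (tr t) k ≡ just i → letter (tr t') k ≡ just j →
              ∀ {a b} → Inc ωO a → Inc ωO b → Match k (tr t) (tr t') a b → a i < b j → ¬ Leq ωO (sg (tr t')) b (sg (tr t)) a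
        btw t t' l l' li lj ia ib m =
          between (alive n* le) (alive t (N₀≤ l)) (link t l) (link t' l')
            (toN₁-inc T (el-inc (s n*)) (el-inc (s t))) (toN₂-inc T (el-inc (s n*)) (el-inc (s t)))
            (λ r y p q e d → let (u , w) = type-≈ (toN-type T (el-inc (s n*)) (el-inc (s t))) (matches n* t le (N₀≤ l) r y p q e d)
                             in ≤-antisym u w)
            li lj ia ib m

      -- By the tie, a larger letter k at the later time would make the later element larger.
      weakly-descending : ∀ t t' (l : N₁ ≤ t) (l' : N₁ ≤ t') → t < t' → Le A (value k letters₁ t' l') (value k letters₁ t l)
      weakly-descending t t' l l' less = by-contra λ nle →
        tie-<A (tie₁ t t' l l' (proj₂ (letters₁ t l)) (proj₂ (letters₁ t' l'))) T (el-inc (s t)) (el-inc (s t'))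
          (matches t t' (N₀≤ l) (N₀≤ l')) (⋠⇒≺ T nle) (⊏⇒⊑ T (s t') (s t) (s-⊏ less))

      limit : Σ ℕ (Limit k)
      limit = by (stable k N₁ letters₁ weakly-descending)
        where
        by : (Σ ℕ λ N' → Σ (N₁ ≤ N') λ l₀ → ∀ t (l : N₁ ≤ t) → N' ≤ t → Eqv A (value k letters₁ t l) (value k letters₁ N' l₀)) →
             Σ ℕ (Limit k)
        by (N' , l₀ , c) = N' , record
          { x = value k letters₁ N' l₀
          ; letters = λ t l → letters₁ t (≤-trans l₀ l)
          ; limit-≈ = λ t l → c t (≤-trans l₀ l) l
          ; tied = λ t t' l l' → tie₁ t t' (≤-trans l₀ l) (≤-trans l₀ l') }

    limits : Stable → ∀ k → Σ ℕ (Limit k)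
    limits st = below-rec _ (λ k IH → Step.limit k IH st)

  -- The permutations π^L

  count : (ℕ → Set) → ℕ → ℕ
  count P zero = 0
  count P (suc n) with dec (P n)
  ... | yes _ = suc (count P n)
  ... | no _  = count P n

  count-mono : ∀ {P Q : ℕ → Set} n → (∀ r → r < n → P r → Q r) → count P n ≤ count Q n
  count-mono zero h = z≤n
  count-mono {P} {Q} (suc n) h with dec (P n) | dec (Q n)
  ... | yes _ | yes _ = s≤s (count-mono n (λ r l → h r (m≤n⇒m≤1+n l)))
  ... | yes p | no q  = ⊥-elim (q (h n ≤-refl p))
  ... | no _  | yes _ = m≤n⇒m≤1+n (count-mono n (λ r l → h r (m≤n⇒m≤1+n l)))
  ... | no _  | no _  = count-mono n (λ r l → h r (m≤n⇒m≤1+n l))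

  count-strict : ∀ {P Q : ℕ → Set} n → (∀ r → r < n → P r → Q r) → ∀ r → r < n → Q r → ¬ P r → count P n < count Q n
  count-strict {P} {Q} (suc n) h r l q np with dec (P n) | dec (Q n) | m≤n⇒m<n∨m≡n (s≤s⁻¹ l)
  ... | yes p | no q' | _ = ⊥-elim (q' (h n ≤-refl p))
  ... | yes _ | yes _ | inj₁ l' = s≤s (count-strict n (λ r l → h r (m≤n⇒m≤1+n l)) r l' q np)
  ... | no _  | no _  | inj₁ l' = count-strict n (λ r l → h r (m≤n⇒m≤1+n l)) r l' q np
  ... | no _  | yes _ | inj₁ l' = m≤n⇒m≤1+n (count-strict n (λ r l → h r (m≤n⇒m≤1+n l)) r l' q np)
  ... | yes p | yes _ | inj₂ refl = ⊥-elim (np p)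
  ... | no _  | yes _ | inj₂ refl = s≤s (count-mono n (λ r l → h r (m≤n⇒m≤1+n l)))
  ... | no _  | no q' | inj₂ refl = ⊥-elim (q' q)

  count-all : ∀ n → count (λ _ → ⊤) n ≡ n
  count-all zero = refl
  count-all (suc n) with dec ⊤
  ... | yes _ = cong suc (count-all n)
  ... | no h  = ⊥-elim (h tt)

  module Permutation (L : LinOrdℕ) (total : ∀ n → elem L n) where

    private
      Less : ℕ → ℕ → Set
      Less i r = rel L r i × ¬ rel L i r

    rank-value : ∀ n (i : Fin n) → count (Less (toℕ i)) n < n
    rank-value n i = subst (count (Less (toℕ i)) n <_) (count-all n)
      (count-strict {Less (toℕ i)} {λ _ → ⊤} n (λ _ _ _ → tt) (toℕ i) (toℕ<n i) tt (λ (p , q) → q p))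

    -- The permutation π^L, realised by counting the L-predecessors among the first n numbers.
    rank : ∀ n → Fin n → Fin n
    rank n i = fromℕ< (rank-value n i)

    rank-perm : ∀ n → IsPermL L n (rank n)
    rank-perm n i j = subst₂ (λ u v → Iff (u ≤ v) (rel L (toℕ i) (toℕ j))) (sym (toℕ-fromℕ< (rank-value n i))) (sym (toℕ-fromℕ< (rank-value n j)))
      ( (λ l → by-contra λ n' → <⇒≱ (strictly n') l)
      , (λ l → count-mono {Less (toℕ i)} {Less (toℕ j)} n λ r _ (p , q) → rel-trans L p l , λ z → q (rel-trans L l z)))
      where
      strictly : ¬ rel L (toℕ i) (toℕ j) → count (Less (toℕ j)) n < count (Less (toℕ i)) n
      strictly n' = count-strict {Less (toℕ j)} {Less (toℕ i)} n (λ r _ (p , q) → rel-trans L p ji , λ z → q (rel-trans L ji z))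
        (toℕ j) (toℕ<n j) (ji , n') (λ (p , q) → q p)
        where
        ji : rel L (toℕ j) (toℕ i)
        ji = [ (λ x → ⊥-elim (n' x)) , (λ x → x) ]′ (rel-total L (total (toℕ i)) (total (toℕ j)))

    perm-injective : ∀ {n π} → IsPermL L n π → ∀ {i j} → π i ≡ π j → i ≡ j
    perm-injective h {i} {j} e = toℕ-injective (rel-antisym L (proj₁ (h i j) (≤-reflexive (cong toℕ e)))
                                                               (proj₁ (h j i) (≤-reflexive (cong toℕ (sym e)))))

    perm-surjective : ∀ {n π} → IsPermL L n π → ∀ v → Σ (Fin n) λ i → π i ≡ v
    perm-surjective {suc n} {π} h v = by-contra λ no →
      1+n≰n (injective⇒≤ {f = λ i → punchOut {i = v} {j = π i} (λ e → no (i , sym e))}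
        (λ {i} {j} e → perm-injective {suc n} {π} h (punchOut-injective {i = v} _ _ e)))

    -- Composing ρ with the inverse of π gives an increasing self-map of `Fin n`, which never falls
    -- below the identity.
    perm-≤ : ∀ {n π ρ} → IsPermL L n π → IsPermL L n ρ → ∀ i → toℕ (π i) ≤ toℕ (ρ i)
    perm-≤ {n} {π} {ρ} h k i = subst (λ z → toℕ (π i) ≤ toℕ (ρ z)) (perm-injective {n} {π} h (proj₂ (back (π i)))) (inc-≥ g g-inc (π i))
      where
      back = perm-surjective {n} {π} h
      g : Fin n → Fin n
      g v = ρ (proj₁ (back v))
      g-inc : IncF g
      g-inc v w l = ≰⇒> λ le → <⇒≱ l (subst₂ (λ x y → toℕ x ≤ toℕ y) (proj₂ (back w)) (proj₂ (back v))
        (proj₂ (h _ _) (proj₁ (k _ _) le)))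

    perm-unique : ∀ {n π ρ} → IsPermL L n π → IsPermL L n ρ → ∀ i → π i ≡ ρ i
    perm-unique {n} {π} {ρ} h k i = toℕ-injective (≤-antisym (perm-≤ {n} {π} {ρ} h k i) (perm-≤ {n} {ρ} {π} k h i))

  module _ (α : LinOrdℕ) where

    Ltℕ-trichotomy : ∀ {x y} → elem α x → elem α y → x ≢ y → Ltℕ α x y ⊎ Ltℕ α y x
    Ltℕ-trichotomy ex ey ne = [ (λ p → inj₁ (p , ne)) , (λ p → inj₂ (p , λ e → ne (sym e))) ]′ (rel-total α ex ey)

    Same : ∀ {k l} → (Fin k → ℕ) → (Fin l → ℕ) → ℕ → Set
    Same {k} {l} u v t = ∀ (i : Fin k) (i' : Fin l) → toℕ i ≡ toℕ i' → toℕ i < t → u i ≡ v i'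

    -- Linearity is what allows an order-preserving η to reflect the order as well.
    lex-trichotomy : ∀ {k l} (u : Fin k → ℕ) (v : Fin l → ℕ) → (∀ i → elem α (u i)) → (∀ i → elem α (v i)) →
                     LexLt α u v ⊎ LexLt α v u ⊎ (k ≡ l × (∀ i i' → toℕ i ≡ toℕ i' → u i ≡ v i'))
    lex-trichotomy {k} {l} u v eu ev = go (dec (Same u v (k ⊓ l)))
      where
      Trichotomy = LexLt α u v ⊎ LexLt α v u ⊎ (k ≡ l × (∀ i i' → toℕ i ≡ toℕ i' → u i ≡ v i'))
      bounded : ∀ (i : Fin k) (i' : Fin l) → toℕ i ≡ toℕ i' → toℕ i < k ⊓ l
      bounded i i' e = ⊓-pres-m< (toℕ<n i) (subst (_< l) (sym e) (toℕ<n i'))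
      differ : (Σ ℕ λ t → t < k ⊓ l × Same u v t × ¬ Same u v (suc t)) → Trichotomy
      differ (t , t< , same , nsame) =
        [ (λ p → inj₁ (inj₁ (i , j , e , p , λ x y xy x<i → same x y xy (subst (toℕ x <_) ei x<i))))
        , (λ p → inj₂ (inj₁ (inj₁ (j , i , sym e , p , λ y x yx y<j →
               sym (same x y (sym yx) (subst₂ _<_ yx (toℕ-fromℕ< t<l) y<j)))))) ]′
        (Ltℕ-trichotomy (eu i) (ev j) ne)
        where
        t<k = ≤-trans t< (m⊓n≤m k l)
        t<l = ≤-trans t< (m⊓n≤n k l)
        i = fromℕ< t<k
        j = fromℕ< t<l
        ei = toℕ-fromℕ< t<k
        e : toℕ i ≡ toℕ j
        e = trans ei (sym (toℕ-fromℕ< t<l))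
        ne : u i ≢ v j
        ne q = nsame λ x y xy x<t → [ same x y xy
          , (λ x≡t → subst₂ (λ a b → u a ≡ v b) (toℕ-injective (trans ei (sym x≡t)))
                         (toℕ-injective (trans (sym e) (trans ei (trans (sym x≡t) xy)))) q) ]′ (m≤n⇒m<n∨m≡n (s≤s⁻¹ x<t))
      go : Dec (Same u v (k ⊓ l)) → Trichotomy
      go (no n) = differ (first-failure (Same u v) (k ⊓ l) (λ _ _ _ ()) n)
      go (yes same) with <-cmp k l
      ... | tri< k<l _ _ = inj₁ (inj₂ (k<l , λ i i' e → same i i' e (bounded i i' e)))
      ... | tri> _ _ l<k = inj₂ (inj₁ (inj₂ (l<k , λ i i' e → sym (same i' i (sym e) (bounded i' i (sym e))))))
      ... | tri≈ _ k≡l _ = inj₂ (inj₂ (k≡l , λ i i' e → same i i' e (bounded i i' e)))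

  module _ {n : ℕ} (M : Fin n → Bool) where

    squeeze-cong : ∀ {α : LinOrdℕ} {v v' : ∀ p → M p ≡ true → Σ ℕ (elem α)} →
                   (∀ p m → proj₁ (v p m) ≡ proj₁ (v' p m)) → ∀ p → Le (ω1+ α) (squeeze M {α} v p) (squeeze M {α} v' p)
    squeeze-cong {α} {v} {v'} h p = inj₂ ((go (prev M (suc (toℕ p))) , go' (prev M (suc (toℕ p)))) , ≤-refl)
      where
      re : ∀ {x y : ℕ} → elem α x → x ≡ y → rel α x y
      re e refl = rel-refl α e
      go : ∀ {k} (w : Prev M k) → Le (onePlus α) (tag M {α} v w) (tag M {α} v' w)
      go (none _) = tt
      go (some q m _ _) = re (proj₂ (v q m)) (h q m)
      go' : ∀ {k} (w : Prev M k) → Le (onePlus α) (tag M {α} v' w) (tag M {α} v w)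
      go' (none _) = tt
      go' (some q m _ _) = re (proj₂ (v' q m)) (sym (h q m))

    squeeze-map : ∀ {α β : LinOrdℕ} (f : LinEmb α β) (v : ∀ p → M p ≡ true → Σ ℕ (elem α)) p →
                  squeeze M {β} (λ q m → LinEmb.fn f (proj₁ (v q m)) , LinEmb.fn-elem f (proj₂ (v q m))) p
                  ≡ OrdEmb.fun (ω1+map f) (squeeze M {α} v p)
    squeeze-map {α} {β} f v p = cong (_, offset M (M p) (toℕ p)) (go (prev M (suc (toℕ p))))
      where
      go : ∀ {k} (w : Prev M k) →
           tag M {β} (λ q m → LinEmb.fn f (proj₁ (v q m)) , LinEmb.fn-elem f (proj₂ (v q m))) w
           ≡ OrdEmb.fun (onePlusMap f) (tag M {α} v w)
      go (none _) = refl
      go (some q m _ _) = refl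

  -- The thread of a descending sequence

  module ThreadOf {A : Ord} (T : Tot A) (s : ℕ → BarElt D A) (desc : ∀ n → BarLt D A (s (suc n)) (s n))
                  (wf : BarWF D ω²) (lim : ∀ k → Σ ℕ (Sequence.Limit T s desc wf k)) where

    open Sequence T s desc wf using (tr; Limit)
    open Limit

    N : ℕ → ℕ
    N k = proj₁ (lim k)

    X : ℕ → Car A
    X k = x (proj₂ (lim k))

    letter-≈ : ∀ r t → N r ≤ t → ∀ {p} → letter (tr t) r ≡ just p → Eqv A (el (s t) p) (X r)
    letter-≈ r t l e = subst (λ z → Eqv A (el (s t) z) (X r))
      (just-injective (trans (sym (proj₂ (letters (proj₂ (lim r)) t l))) e)) (limit-≈ (proj₂ (lim r)) t l)

    -- At a stage past both limits, equal limits sit at one position of one element, and a position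
    -- carries one letter index. This gives antisymmetry of L.
    X-injective : ∀ {i j} → Eqv A (X i) (X j) → i ≡ j
    X-injective {i} {j} e = letter-injective (tr t) {i} {j} (proj₂ li)
      (subst (λ z → letter (tr t) j ≡ just z) (sym same) (proj₂ lj))
      where
      t = N i ⊔ N j
      li = letters (proj₂ (lim i)) t (m≤m⊔n (N i) (N j))
      lj = letters (proj₂ (lim j)) t (m≤n⊔m (N i) (N j))
      same : proj₁ li ≡ proj₁ lj
      same = inc-≈⁻ A (el-inc (s t)) (proj₁ li) (proj₁ lj)
        (≈-trans T (letter-≈ i t (m≤m⊔n (N i) (N j)) (proj₂ li))
          (≈-trans T e (≈-sym A (letter-≈ j t (m≤n⊔m (N i) (N j)) (proj₂ lj)))))

    L : LinOrdℕ
    L = record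
      { elem = λ _ → ⊤ ; rel = λ i j → Le A (X i) (X j) ; rel-elem = λ _ → tt , tt
      ; rel-refl = λ _ → ≼-refl T ; rel-antisym = λ p q → X-injective (p , q)
      ; rel-trans = ≼-trans T ; rel-total = λ _ _ → ≼-total T _ _ }

    open Permutation L (λ _ → tt)

    -- Past the limits of letters 0 to k inclusive: words of length k prescribe only the first k,
    -- but a longer word is compared with them at letter k.
    stage : ℕ → ℕ
    stage k = max< (suc k) (λ r _ → lim r)

    stage-≥ : ∀ {r k} → r ≤ k → N r ≤ stage k
    stage-≥ {r} {k} l = max<-upper (suc k) (λ r _ → lim r) r (s≤s l)

    τ : ℕ → Trace
    τ k = tr (stage k)

    τ-letter : ∀ {r k} → r ≤ k → Σ (Fin (ar (τ k))) λ p → letter (τ k) r ≡ just p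
    τ-letter {r} {k} l = letters (proj₂ (lim r)) (stage k) (stage-≥ l)

    -- The values at this stage already agree with the limits, so the places of letters in the trace
    -- follow L. Words increasing along L therefore fit the trace.
    τ-order : ∀ {k r r' p q} → r ≤ k → r' ≤ k → letter (τ k) r ≡ just p → letter (τ k) r' ≡ just q →
              toℕ p < toℕ q → Lt A (X r) (X r')
    τ-order {k} {r} {r'} {p} {q} l l' e d less =
      ≼-≺-trans T (proj₂ (letter-≈ r (stage k) (stage-≥ l) e))
        (≺-≼-trans T (el-inc (s (stage k)) p q less) (proj₁ (letter-≈ r' (stage k) (stage-≥ l') d)))

    module _ {α : LinOrdℕ} where

      Word : ℕ → Set
      Word k = ∀ r → r < k → Σ ℕ (elem α)

      Word-inc : ∀ {k} → Word k → Set
      Word-inc {k} w = ∀ r r' (l : r < k) (l' : r' < k) → Lt A (X r) (X r') → Lt (onePlus α) (just (w r l)) (just (w r' l'))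

      spot : ∀ k → Word k → Fin (ar (τ k)) → Car (ω1+ α)
      spot k w = squeeze (marks (τ k) k) {α} (indexed k (τ k) w)

      spot-letter : ∀ k (w : Word k) {r p} (l : r < k) → letter (τ k) r ≡ just p → spot k w p ≡ (just (w r l) , 0)
      spot-letter k w {r} {p} l e = trans (squeeze-main (marks (τ k) k) {α} (indexed k (τ k) w) m)
        (cong (λ z → just z , 0) (indexed-letter k (τ k) w {r} l e m))
        where m = letter⇒marks (τ k) {r} e k l

      spot-inc : ∀ k (w : Word k) → Word-inc w → Inc (ω1+ α) (spot k w)
      spot-inc k w wi = squeeze-inc (marks (τ k) k) {α} (indexed k (τ k) w) λ p q mp mq less →
        go (marks⇒letter (τ k) k mp) (marks⇒letter (τ k) k mq) mp mq less
        where
        go : ∀ {p q} → (Σ ℕ λ r → r < k × letter (τ k) r ≡ just p) → (Σ ℕ λ r → r < k × letter (τ k) r ≡ just q) →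
             ∀ mp mq → toℕ p < toℕ q →
             Lt (onePlus α) (just (indexed k (τ k) w p mp)) (just (indexed k (τ k) w q mq))
        go (r , l , e) (r' , l' , e') mp mq less =
          subst₂ (λ a b → Lt (onePlus α) (just a) (just b))
            (sym (indexed-letter k (τ k) w {r} l e mp)) (sym (indexed-letter k (τ k) w {r'} l' e' mq))
            (wi r r' l l' (τ-order (<⇒≤ l) (<⇒≤ l') e e' less))

      elt : ∀ k (w : Word k) → Word-inc w → BarElt D (ω1+ α)
      elt k w wi = place (τ k) (spot k w) (spot-inc k w wi)

      elt-cong : ∀ k (w w' : Word k) (wi : Word-inc w) (wi' : Word-inc w') →
                 (∀ r l → proj₁ (w r l) ≡ proj₁ (w' r l)) → elt k w wi ⊑ elt k w' wi'
      elt-cong k w w' wi wi' h = Leq-mono (ω1+-tot α) (spot-inc k w wi) (spot-inc k w' wi') (trace-mem (τ k))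
        (squeeze-cong (marks (τ k) k) {α} (λ p m → let (r , l , _) = marks⇒letter (τ k) k m in h r l))

      just-≈ : ∀ {a b : Σ ℕ (elem α)} → proj₁ a ≡ proj₁ b → Eqv (onePlus α) (just a) (just b)
      just-≈ {a , e} {.a , d} refl = rel-refl α e , rel-refl α e

      just-≈0 : ∀ {a b : Σ ℕ (elem α)} → proj₁ a ≡ proj₁ b → Eqv (ω1+ α) (just a , 0) (just b , 0)
      just-≈0 {a} {b} e = let (p , q) = just-≈ {a} {b} e in inj₂ ((p , q) , z≤n) , inj₂ ((q , p) , z≤n)

      -- When the first word is a proper initial segment, letter k of τ k is not distinguished and lies right
      -- above a distinguished letter (or in ω·0), hence below ω·(1+x) for the next letter x of the second word.
      lex-less : ∀ k m (w : Word k) (w' : Word m) (wi : Word-inc w) (wi' : Word-inc w') j (j≤k : j ≤ k) (j<m : j < m) →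
                 (∀ r → r < j → ∀ l l' → proj₁ (w r l) ≡ proj₁ (w' r l')) →
                 (∀ l → Lt (onePlus α) (just (w j l)) (just (w' j j<m))) → elt k w wi ⊏ elt m w' wi'
      lex-less k m w w' wi wi' j j≤k j<m agree less =
        -- Words of different lengths use different stages; the ties hold between all late stages,
        -- so letter j still decides.
        tie-<A (tied (proj₂ (lim j)) (stage k) (stage m) (stage-≥ j≤k) (stage-≥ (<⇒≤ j<m)) (proj₂ p) (proj₂ q)) (ω1+-tot α)
          (spot-inc k w wi) (spot-inc m w' wi')
          (λ r l a b e d → subst₂ (Eqv (ω1+ α)) (sym (spot-letter k w (<-≤-trans l j≤k) e)) (sym (spot-letter m w' (<-trans l j<m) d))
              (just-≈0 {w r (<-≤-trans l j≤k)} {w' r (<-trans l j<m)} (agree r l _ _)))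
          (subst (Lt (ω1+ α) (spot k w (proj₁ p))) (sym (spot-letter m w' j<m (proj₂ q))) (go (m≤n⇒m<n∨m≡n j≤k)))
        where
        p = τ-letter {j} {k} j≤k
        q = τ-letter {j} {m} (<⇒≤ j<m)
        go : j < k ⊎ j ≡ k → Lt (ω1+ α) (spot k w (proj₁ p)) (just (w' j j<m) , 0)
        go (inj₁ j<k) = subst (λ z → Lt (ω1+ α) z (just (w' j j<m) , 0)) (sym (spot-letter k w j<k (proj₂ p)))
          (lex-≺ (onePlus α) ωO (just (w j j<k) , 0) (just (w' j j<m) , 0) (less j<k))
        go (inj₂ refl) = squeeze-below (marks (τ k) k) {α} (indexed k (τ k) w) (proj₁ p) λ q mq q≤p →
          by q mq q≤p (marks⇒letter (τ k) k mq)
          where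
          by : ∀ q mq → toℕ q ≤ toℕ (proj₁ p) → (Σ ℕ λ r → r < k × letter (τ k) r ≡ just q) →
               Lt (onePlus α) (just (indexed k (τ k) w q mq)) (just (w' k j<m))
          by q mq q≤p (r , l , e) = subst (λ z → Lt (onePlus α) (just z) (just (w' k j<m))) (sym (indexed-letter k (τ k) w {r} l e mq))
            (≼-≺-trans (onePlus-tot α) {just (w r l)} {just (w' r (<-trans l j<m))} {just (w' k j<m)}
              (proj₁ (just-≈ {w r l} {w' r (<-trans l j<m)} (agree r l l (<-trans l j<m))))
              (wi' r k (<-trans l j<m) j<m (τ-order {k} {r} {k} (<⇒≤ l) ≤-refl e (proj₂ p) q<p)))
            where
            q<p : toℕ q < toℕ (proj₁ p)
            q<p = ≤∧≢⇒< q≤p λ z → <-irrefl (letter-injective (τ k) {r} {k} e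
                    (subst (λ y → letter (τ k) k ≡ just y) (sym (toℕ-injective z)) (proj₂ p))) l

    module _ (α : LinOrdℕ) where

      word : (u : DLElt α) → Word {α} (slen u)
      word u r l = seq u i , seq-elem u i
        where i = rank (slen u) (fromℕ< l)

      word-inc : (u : DLElt α) → Word-inc {α} (word u)
      word-inc u r r' l l' (p , n) = proj₁ lt' , λ z → proj₂ lt' (rel-antisym α (proj₁ lt') z)
        where
        i = fromℕ< l
        j = fromℕ< l'
        lt' : Ltℕ α (proj₁ (word u r l)) (proj₁ (word u r' l'))
        lt' = seq-inc u (rank _ i) (rank _ j) (≰⇒> λ le →
                n (subst₂ (rel L) (toℕ-fromℕ< l') (toℕ-fromℕ< l) (proj₁ (rank-perm (slen u) j i) le)))

      η : DLElt α → BarElt D (ω1+ α)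
      η u = elt (slen u) (word u) (word-inc u)

      ranked : (u : DLElt α) → Fin (slen u) → ℕ
      ranked u i = seq u (rank (slen u) i)

      word-ranked : (u : DLElt α) (i : Fin (slen u)) {r : ℕ} (l : r < slen u) → toℕ i ≡ r → proj₁ (word u r l) ≡ ranked u i
      word-ranked u i l refl = cong (ranked u) (fromℕ<-toℕ i l)

      -- Both clauses are instances of `lex-less`; for a proper initial segment the deciding index j
      -- is the length of the shorter word.
      lex⇒⊏ : ∀ u v → LexLt α (ranked u) (ranked v) → η u ⊏ η v
      lex⇒⊏ u v (inj₁ (j , j' , e , less , same)) =
        lex-less (slen u) (slen v) (word u) (word v) (word-inc u) (word-inc v) (toℕ j) (<⇒≤ (toℕ<n j)) j<m
          (λ r r<j l l' → same (fromℕ< l) (fromℕ< l') (trans (toℕ-fromℕ< l) (sym (toℕ-fromℕ< l')))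
                            (subst (_< toℕ j) (sym (toℕ-fromℕ< l)) r<j))
          (λ l → subst₂ (λ x y → rel α x y × ¬ rel α y x) (sym (word-ranked u j l refl)) (sym (word-ranked v j' j<m (sym e)))
                   (proj₁ less , λ z → proj₂ less (rel-antisym α (proj₁ less) z)))
        where
        j<m : toℕ j < slen v
        j<m = subst (_< slen v) (sym e) (toℕ<n j')
      lex⇒⊏ u v (inj₂ (k<m , same)) =
        lex-less (slen u) (slen v) (word u) (word v) (word-inc u) (word-inc v) (slen u) ≤-refl k<m
          (λ r _ l l' → same (fromℕ< l) (fromℕ< l') (trans (toℕ-fromℕ< l) (sym (toℕ-fromℕ< l'))))
          (λ l → ⊥-elim (<-irrefl refl l))

      LexLt-cong : ∀ {k l} {u u' : Fin k → ℕ} {v v' : Fin l → ℕ} → (∀ i → u i ≡ u' i) → (∀ i → v i ≡ v' i) →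
                   LexLt α u v → LexLt α u' v'
      LexLt-cong eu ev (inj₁ (j , j' , e , less , same)) =
        inj₁ (j , j' , e , subst₂ (Ltℕ α) (eu j) (ev j') less , λ i i' d l → trans (sym (eu i)) (trans (same i i' d l) (ev i')))
      LexLt-cong eu ev (inj₂ (l , same)) = inj₂ (l , λ i i' d → trans (sym (eu i)) (trans (same i i' d) (ev i')))

      η-same : ∀ u v → slen u ≡ slen v → (∀ i i' → toℕ i ≡ toℕ i' → ranked u i ≡ ranked v i') → η v ⊑ η u
      η-same u v e h = go (slen v) (sym e) (word v) (word-inc v) λ r l l' →
        sym (h (fromℕ< l) (fromℕ< l') (trans (toℕ-fromℕ< l) (sym (toℕ-fromℕ< l'))))
        where
        go : ∀ m → m ≡ slen u → (w : Word {α} m) (wi : Word-inc {α} w) →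
             (∀ r (l : r < slen u) (l' : r < m) → proj₁ (w r l') ≡ proj₁ (word u r l)) → elt {α} m w wi ⊑ η u
        go _ refl w wi h = elt-cong (slen u) w (word u) wi (word-inc u) (λ r l → h r l l)

      η-embedding : ∀ u v → Iff (DLLt L α u v) (BarLt D (ω1+ α) (η u) (η v))
      η-embedding u v = forth , back
        where
        forth : DLLt L α u v → BarLt D (ω1+ α) (η u) (η v)
        forth (π , π' , h , h' , lex) = ⊏⇒BarLt (ω1+-tot α) (η u) (η v) (lex⇒⊏ u v (LexLt-cong
          (λ i → cong (seq u) (perm-unique {slen u} {π} {rank (slen u)} h (rank-perm (slen u)) i))
          (λ i → cong (seq v) (perm-unique {slen v} {π'} {rank (slen v)} h' (rank-perm (slen v)) i)) lex))
        back : BarLt D (ω1+ α) (η u) (η v) → DLLt L α u v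
        back b = by (lex-trichotomy α (ranked u) (ranked v) (λ i → seq-elem u _) (λ i → seq-elem v _))
          where
          by : LexLt α (ranked u) (ranked v) ⊎ LexLt α (ranked v) (ranked u)
               ⊎ (slen u ≡ slen v × (∀ i i' → toℕ i ≡ toℕ i' → ranked u i ≡ ranked v i')) → DLLt L α u v
          by (inj₁ less) = rank (slen u) , rank (slen v) , rank-perm (slen u) , rank-perm (slen v) , less
          by (inj₂ (inj₁ more)) = ⊥-elim (lex⇒⊏ v u more (Bar⇒⊑ {x = η u} {η v} (proj₁ b)))
          by (inj₂ (inj₂ (e , same))) = ⊥-elim (BarLt⇒⊏ (ω1+-tot α) (η u) (η v) b (η-same u v e same))

    -- The trace depends only on the length of the word and the offsets only on positions, so f acts
    -- on the marked values alone.
    η-natural : ∀ α β (f : LinEmb α β) (u : DLElt α) →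
                BarEq D (ω1+ β) (η β (DLmap f u)) (barMap (ω1+map f) (η α u))
    η-natural α β f u =
        ⊑⇒Bar (ω1+-tot β) {P} {Q} (Leq-mono (ω1+-tot β) (el-inc P) (el-inc Q) (sig-mem P) (λ p → proj₁ (eqv p)))
      , ⊑⇒Bar (ω1+-tot β) {Q} {P} (Leq-mono (ω1+-tot β) (el-inc Q) (el-inc P) (sig-mem P) (λ p → proj₂ (eqv p)))
      where
      P = η β (DLmap f u)
      Q = barMap (ω1+map f) (η α u)
      eqv : ∀ p → Eqv (ω1+ β) (el P p) (el Q p)
      eqv p = ≡⇒≈ (ω1+-tot β) (squeeze-map (marks (τ (slen u)) (slen u)) {α} {β} f (indexed (slen u) (τ (slen u)) (word α u)) p)

    hasThread : HasThread D
    hasThread = L , (λ _ → tt) , record { η = η ; η-emb = η-embedding ; η-nat = η-natural }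

  -- Codes of elements and the oracle

  tri-mono : ∀ {a b} → a ≤ b → tri a ≤ tri b
  tri-mono z≤n = z≤n
  tri-mono (s≤s l) = s≤s (+-mono-≤ l (tri-mono l))

  pair-< : ∀ {m n m' n'} → m + n < m' + n' → pair m n < pair m' n'
  pair-< {m} {n} {m'} {n'} l = begin-strict
    tri (m + n) + n         <⟨ +-monoʳ-< (tri (m + n)) (s≤s (m≤n+m n m)) ⟩
    tri (m + n) + suc (m + n) ≡⟨ +-comm (tri (m + n)) _ ⟩
    tri (suc (m + n))       ≤⟨ tri-mono l ⟩
    tri (m' + n')           ≤⟨ m≤m+n _ n' ⟩
    tri (m' + n') + n'      ∎
    where open ≤-Reasoning

  pair-injective : ∀ m n m' n' → pair m n ≡ pair m' n' → m ≡ m' × n ≡ n'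
  pair-injective m n m' n' e with <-cmp (m + n) (m' + n')
  ... | tri< l _ _ = ⊥-elim (<-irrefl e (pair-< {m} {n} {m'} {n'} l))
  ... | tri> _ _ l = ⊥-elim (<-irrefl (sym e) (pair-< {m'} {n'} {m} {n} l))
  ... | tri≈ _ d _ = +-cancelʳ-≡ n m m' (trans d (cong (m' +_) (sym n≡))) , n≡
    where
    n≡ : n ≡ n'
    n≡ = +-cancelˡ-≡ (tri (m + n)) n n' (trans e (cong (λ z → tri z + n') (sym d)))

  codeFn-injective : ∀ {k l} (u : Fin k → ℕ) (v : Fin l → ℕ) → codeFn u ≡ codeFn v →
                     k ≡ l × (∀ i j → toℕ i ≡ toℕ j → u i ≡ v j)
  codeFn-injective {zero} {zero} u v e = refl , λ ()
  codeFn-injective {suc k} {suc l} u v e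
    with pair-injective (u zero) _ (v zero) _ (suc-injective e)
  ... | h , t with codeFn-injective (u ∘ suc) (v ∘ suc) t
  ... | k≡l , r = cong suc k≡l , λ { zero zero _ → h ; (suc i) (suc j) d → r i j (suc-injective d) }

  fromDec : ∀ {P : Set} → Dec P → (P → ℕ) → ℕ
  fromDec (yes p) f = f p
  fromDec (no _) f = 0

  fromDec-spec : ∀ {P : Set} (d : Dec P) (f : P → ℕ) {n} → P → (∀ p → f p ≡ n) → fromDec d f ≡ n
  fromDec-spec (yes p) f _ h = h p
  fromDec-spec (no n) f p h = ⊥-elim (n p)

  IsPair : ℕ → Set
  IsPair c = Σ ℕ λ m → Σ ℕ λ n → c ≡ pair m n

  -- Unpairing by excluded middle, with default 0 off the range of `pair`; programs obtain its
  -- values from the oracle.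
  fst snd : ℕ → ℕ
  fst c = fromDec (dec (IsPair c)) proj₁
  snd c = fromDec (dec (IsPair c)) (proj₁ ∘ proj₂)

  fst-pair : ∀ m n → fst (pair m n) ≡ m
  fst-pair m n = fromDec-spec (dec (IsPair (pair m n))) _ (m , n , refl)
    λ (m' , n' , e) → sym (proj₁ (pair-injective m n m' n' e))

  snd-pair : ∀ m n → snd (pair m n) ≡ n
  snd-pair m n = fromDec-spec (dec (IsPair (pair m n))) _ (m , n , refl)
    λ (m' , n' , e) → sym (proj₂ (pair-injective m n m' n' e))

  -- The value at letter k of the element of D̄(X) with code c; it does not depend on X.
  Decoding : ℕ → ℕ → Set
  Decoding k c = Σ Trace λ t → Σ (Fin (ar t) → ℕ) λ u → Σ (Fin (ar t)) λ p →
                 letter t k ≡ just p × c ≡ pair (sg t) (codeFn u)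

  letterValue : ℕ → ℕ → ℕ
  letterValue k c = fromDec (dec (Decoding k c)) (λ (t , u , p , _) → u p)

  -- A code determines σ and the number of points, hence the trace and its letter k, so all
  -- decodings give the same value.
  letterValue-spec : ∀ k (t : Trace) (u : Fin (ar t) → ℕ) p → letter t k ≡ just p →
                     letterValue k (pair (sg t) (codeFn u)) ≡ u p
  letterValue-spec k t u p e = fromDec-spec (dec (Decoding k (pair (sg t) (codeFn u)))) _ (t , u , p , e , refl) unique
    where
    match : ∀ (t t' : Trace) (u : Fin (ar t) → ℕ) (u' : Fin (ar t') → ℕ) p p' → letter t k ≡ just p → letter t' k ≡ just p' →
            sg t ≡ sg t' → ar t ≡ ar t' → (∀ i j → toℕ i ≡ toℕ j → u i ≡ u' j) → u' p' ≡ u p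
    match record { ar = a ; sg = g } record { ar = .a ; sg = .g } u u' p p' e e' refl refl h =
      sym (h p p' (cong toℕ (just-injective (trans (sym e) e'))))
    unique : ∀ (d : Decoding k (pair (sg t) (codeFn u))) → (λ ((t , u , p , _) : Decoding k (pair (sg t) (codeFn u))) → u p) d ≡ u p
    unique (t' , u' , p' , e' , c) =
      let (s≡ , c≡) = pair-injective (sg t) (codeFn u) (sg t') (codeFn u') c
          (a≡ , h) = codeFn-injective u u' c≡
      in match t t' u u' p p' e e' s≡ a≡ h

  -- Everything noncomputable about D goes into the oracle; the programs below only search and iterate.
  answer : ℕ → ℕ → ℕ
  answer 0 e = fst e
  answer 1 e = snd e
  answer 2 e = letterValue (fst e) (snd e)
  answer _ e = b2n (fst e ≡ᵇ snd e)

  Φ : ℕ → ℕ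
  Φ z = answer (fst z) (snd z)

  -- The graph of `Φ`, from which unbounded search recovers the function.
  Oracle : ℕ → Bool
  Oracle c = Φ (fst c) ≡ᵇ snd c

  Φ-pair : ∀ q e → Φ (pair q e) ≡ answer q e
  Φ-pair q e = cong₂ answer (fst-pair q e) (snd-pair q e)

  IsGraph : (ℕ → ℕ) → (ℕ → Bool) → Set
  IsGraph f G = ∀ n m → G (pair n m) ≡ (f n ≡ᵇ m)

  Oracle-graph : IsGraph Φ Oracle
  Oracle-graph n m = cong₂ (λ x y → Φ x ≡ᵇ y) (fst-pair n m) (snd-pair n m)

  -- Programs

  join-even : ∀ X Y n → join X Y (n + n) ≡ X n
  join-even X Y zero = refl
  join-even X Y (suc n) rewrite +-suc n n = join-even (X ∘ suc) (Y ∘ suc) n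

  join-odd : ∀ X Y n → join X Y (suc (n + n)) ≡ Y n
  join-odd X Y zero = refl
  join-odd X Y (suc n) rewrite +-suc n n = join-odd (X ∘ suc) (Y ∘ suc) n

  ≡ᵇ-refl : ∀ n → (n ≡ᵇ n) ≡ true
  ≡ᵇ-refl zero = refl
  ≡ᵇ-refl (suc n) = ≡ᵇ-refl n

  ≡ᵇ-≢ : ∀ {m n} → m ≢ n → (m ≡ᵇ n) ≡ false
  ≡ᵇ-≢ {m} {n} ne = go (m ≡ᵇ n) (≡ᵇ⇒≡ m n)
    where
    go : ∀ b → (T b → m ≡ n) → b ≡ false
    go false _ = refl
    go true h = ⊥-elim (ne (h _))

  module Computable (O : ℕ → Bool) where

    Comp : ∀ k → (Vec ℕ k → ℕ) → Set
    Comp k F = Σ (Prog k) λ p → ∀ xs → Eval O p xs (F xs)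

    -- A wrapper rather than an abbreviation, so that f can be inferred from the type.
    record Comp₁ (f : ℕ → ℕ) : Set where
      constructor unary
      field comp : Comp 1 λ xs → f (lookup xs zero)

    record Comp₂ (f : ℕ → ℕ → ℕ) : Set where
      constructor binary
      field comp : Comp 2 λ xs → f (lookup xs zero) (lookup xs (suc zero))

    cast : ∀ {k F G} → (∀ xs → F xs ≡ G xs) → Comp k F → Comp k G
    cast h (p , e) = p , λ xs → subst (Eval O p xs) (h xs) (e xs)

    proj : ∀ {k} (i : Fin k) → Comp k (λ xs → lookup xs i)
    proj i = pproj i , λ xs → eproj

    app₁ : ∀ {k f F} → Comp₁ f → Comp k F → Comp k (λ xs → f (F xs))
    app₁ (unary (p , e)) (q , d) = pcomp p (q ∷ []) , λ xs → ecomp (d xs ∷ []) (e _)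

    app₂ : ∀ {k f F G} → Comp₂ f → Comp k F → Comp k G → Comp k (λ xs → f (F xs) (G xs))
    app₂ (binary (p , e)) (q , d) (r , c) = pcomp p (q ∷ r ∷ []) , λ xs → ecomp (d xs ∷ c xs ∷ []) (e _)

    successor : Comp₁ suc
    successor = unary (psuc , λ { (x ∷ []) → esuc })

    const : ∀ {k} n → Comp k (λ _ → n)
    const zero = pzero , λ xs → ezero
    const (suc n) = app₁ successor (const n)

    oracle : Comp₁ (b2n ∘ O)
    oracle = unary (porc , λ { (x ∷ []) → eorc })

    iterate : ℕ → (ℕ → ℕ → ℕ) → ℕ → ℕ
    iterate c f zero = c
    iterate c f (suc n) = f n (iterate c f n)

    recursion : ∀ {f} c → Comp₂ f → Comp₁ (iterate c f)
    recursion {f} c (binary (p , e)) = unary (prec (proj₁ base) p , λ { (n ∷ []) → go n })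
      where
      base : Comp 0 (λ _ → c)
      base = const c
      go : ∀ n → Eval O (prec (proj₁ base) p) (n ∷ []) (iterate c f n)
      go zero = erec0 (proj₂ base [])
      go (suc n) = erecS (go n) (e _)

    addition : Comp₂ _+_
    addition = binary (prec (pproj zero) (pcomp psuc (pproj (suc zero) ∷ [])) , λ { (m ∷ n ∷ []) → go m n })
      where
      go : ∀ m n → Eval O (prec (pproj zero) (pcomp psuc (pproj (suc zero) ∷ []))) (m ∷ n ∷ []) (m + n)
      go zero n = erec0 eproj
      go (suc m) n = erecS (go m n) (ecomp (eproj ∷ []) esuc)

    minimization : ∀ (f : ℕ → ℕ → ℕ) (z : ℕ → ℕ) → Comp₂ f → (∀ n → f (z n) n ≡ 0) →
                   (∀ n i → i < z n → f i n ≡ 1) → Comp₁ z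
    minimization f z (binary (p , e)) h₀ h₁ = unary (pmu p , λ { (n ∷ []) →
      emu (subst (Eval O p _) (h₀ n) (e (z n ∷ n ∷ [])))
          (λ i l → 0 , subst (Eval O p _) (h₁ n i l) (e (i ∷ n ∷ []))) })

    negation : Comp₁ (iterate 1 (λ _ _ → 0))
    negation = recursion 1 (binary (const 0))

    triangle : Comp₁ (iterate 0 (λ n y → suc n + y))
    triangle = recursion 0 (binary (app₂ addition (app₁ successor (proj zero)) (proj (suc zero))))

    triangle≡tri : ∀ n → iterate 0 (λ n y → suc n + y) n ≡ tri n
    triangle≡tri zero = refl
    triangle≡tri (suc n) = cong (suc n +_) (triangle≡tri n)

    pairing : Comp₂ pair
    pairing = binary (app₂ addition (cast (λ xs → triangle≡tri (lookup xs zero + lookup xs (suc zero)))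
      (app₁ triangle (app₂ addition (proj zero) (proj (suc zero))))) (proj (suc zero)))

    double : Comp₁ (λ n → n + n)
    double = unary (app₂ addition (proj zero) (proj zero))

    -- Minimization looks for the value 0, whereas membership in a graph is the value 1; `negation`
    -- exchanges them.
    fromGraph : ∀ {f G} → IsGraph f G → Comp₁ (b2n ∘ G) → Comp₁ f
    fromGraph {f} {G} g c = minimization (λ m n → iterate 1 (λ _ _ → 0) (b2n (G (pair n m)))) f
      (binary (app₁ negation (app₁ c (app₂ pairing (proj (suc zero)) (proj zero)))))
      (λ n → cong (iterate 1 (λ _ _ → 0) ∘ b2n) (trans (g n (f n)) (≡ᵇ-refl (f n))))
      (λ n i l → cong (iterate 1 (λ _ _ → 0) ∘ b2n) (trans (g n i) (≡ᵇ-≢ (λ e → <-irrefl (sym e) l))))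

  least : (P : ℕ → Set) → Σ ℕ P → Σ ℕ λ z → P z × (∀ i → i < z → ¬ P i)
  least P (d , pd) = go (first-failure (λ t → ∀ i → i < t → ¬ P i) (suc d) (λ _ ()) (λ h → h d ≤-refl pd))
    where
    go : (Σ ℕ λ t → t < suc d × (∀ i → i < t → ¬ P i) × ¬ (∀ i → i < suc t → ¬ P i)) → Σ ℕ λ z → P z × (∀ i → i < z → ¬ P i)
    go (t , _ , before , nb) = t , by-contra (λ np → nb λ i l pi →
      [ (λ i<t → before i i<t pi) , (λ { refl → np pi }) ]′ (m<1+n⇒m<n∨m≡n l)) , before

  -- Descending sequences inside an ω-model

  module Model (M : (ℕ → Bool) → Set) (ω : IsOmegaModelRCA₀ M) (MO : M Oracle) where

    open IsOmegaModelRCA₀ ω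

    -- From a code sequence c in M: if the k-th letters of c N, c (N + 1), … change infinitely often, then M
    -- contains the sequence of the successive changes.
    module _ (c : ℕ → ℕ) (cM : FunIn M c) (k N : ℕ) where

      private
        C = proj₁ cM
        g : ℕ → ℕ
        g n = letterValue k (c (N + n))

      module _ (change : ∀ i → Σ ℕ λ d → g (i + suc d) ≢ g i) where

        private
          open Computable (join C Oracle)

          -- The delay is d + 1, so that each search moves strictly forward.
          Change : ℕ → ℕ → Set
          Change i d = g (i + suc d) ≢ g i

          wait : ℕ → ℕ
          wait i = proj₁ (least (Change i) (change i))

          cC : Comp₁ c
          cC = fromGraph {G = C} (proj₂ (proj₂ cM)) (unary (cast (λ xs → cong b2n (join-even C Oracle (lookup xs zero))) (app₁ oracle (app₁ double (proj zero)))))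

          cΦ : Comp₁ Φ
          cΦ = fromGraph {G = Oracle} Oracle-graph (unary (cast (λ xs → cong b2n (join-odd C Oracle (lookup xs zero))) (app₁ oracle (app₁ successor (app₁ double (proj zero))))))

          query : ∀ {j F} q → Comp j F → Comp j (λ xs → answer q (F xs))
          query q cF = cast (λ xs → Φ-pair q _) (app₁ cΦ (app₂ pairing (const q) cF))

          cg : Comp₁ g
          cg = unary (cast (λ xs → cong₂ letterValue (fst-pair k _) (snd-pair k _))
                 (query 2 (app₂ pairing (const k) (app₁ cC (app₂ addition (const N) (proj zero))))))

          equality : Comp₂ (λ x y → b2n (x ≡ᵇ y))
          equality = binary (cast (λ xs → cong₂ (λ x y → b2n (x ≡ᵇ y)) (fst-pair (lookup xs zero) (lookup xs (suc zero)))
                                                               (snd-pair (lookup xs zero) (lookup xs (suc zero))))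
                       (query 3 (app₂ pairing (proj zero) (proj (suc zero)))))

          cwait : Comp₁ wait
          cwait = minimization (λ d i → b2n (g (i + suc d) ≡ᵇ g i)) wait
            (binary (app₂ equality
              (app₁ cg (app₂ addition (proj (suc zero)) (app₁ successor (proj zero)))) (app₁ cg (proj (suc zero)))))
            (λ i → cong b2n (≡ᵇ-≢ (proj₁ (proj₂ (least (Change i) (change i))))))
            (λ i d l → cong b2n (trans (cong (_≡ᵇ g i) (by-contra (proj₂ (proj₂ (least (Change i) (change i))) d l))) (≡ᵇ-refl (g i))))

        index : ℕ → ℕ
        index zero = 0
        index (suc n) = index n + suc (wait (index n))

        private
          cindex : Comp₁ index
          cindex = unary (cast (λ xs → same (lookup xs zero)) (app₁
            (recursion 0 (binary (app₂ addition (proj (suc zero)) (app₁ successor (app₁ cwait (proj (suc zero)))))))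
            (proj zero)))
            where
            same : ∀ n → iterate 0 (λ _ y → y + suc (wait y)) n ≡ index n
            same zero = refl
            same (suc n) = cong (λ y → y + suc (wait y)) (same n)

        changes : ℕ → ℕ
        changes n = g (index n)

        changes-≢ : ∀ n → changes (suc n) ≢ changes n
        changes-≢ n = proj₁ (proj₂ (least (Change (index n)) (change (index n))))

        -- The graph is computed from C and the oracle, so M contains it by closure under joins and
        -- Turing reducibility.
        changes∈M : FunIn M changes
        changes∈M = Z , down-closed Z (join C Oracle) program (join-closed C Oracle (proj₁ (proj₂ cM)) MO)
                  , λ n m → cong₂ (λ x y → changes x ≡ᵇ y) (fst-pair n m) (snd-pair n m)
          where
          Z : ℕ → Bool
          Z e = changes (fst e) ≡ᵇ snd e
          cZ : Comp 1 (λ xs → b2n (Z (lookup xs zero)))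
          cZ = app₂ equality (app₁ cg (app₁ cindex (query 0 (proj zero)))) (query 1 (proj zero))
          program : Z ≤T join C Oracle
          program = proj₁ cZ , λ n → proj₂ cZ (n ∷ [])

    module _ (X : ℕ → Bool) (lin : IsLinOrdCode X) (wfX : WFinM M X)
             (s : ℕ → BarElt D (ordX X)) (sM : FunIn M (λ n → codeBarX {D} {X} (s n)))
             (desc : ∀ n → BarLt D (ordX X) (s (suc n)) (s n)) (wf : BarWF D ω²) where

      ordX-tot : Tot (ordX X)
      ordX-tot = record
        { ≼-refl = λ {x} → proj₂ x
        ; ≼-trans = λ {x} {y} {z} → proj₁ (proj₂ (proj₂ lin)) (proj₁ x) (proj₁ y) (proj₁ z)
        ; ≼-total = λ x y → proj₂ (proj₂ (proj₂ lin)) (proj₁ x) (proj₁ y) (proj₂ x) (proj₂ y) }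

      private
        c : ℕ → ℕ
        c n = codeBarX {D} {X} (s n)

        open module Seq = Sequence ordX-tot s desc wf

      -- Weak descent between successive changes, which differ by construction, is strict descent;
      -- membership of the changes in M then contradicts `wfX`.
      stable : Stable
      stable k N L dec-L = by-contra λ unstable →
        let module W = Unstable unstable in
        wfX (changes c sM k N W.change , changes∈M c sM k N W.change , W.in-field , λ n → W.descends n , changes-≢ c sM k N W.change n)
        where
        module Unstable (unstable : ¬ (Σ ℕ λ N' → Σ (N ≤ N') λ l₀ → ∀ t (l : N ≤ t) → N' ≤ t →
                                        Eqv (ordX X) (value k L t l) (value k L N' l₀))) where
          val-k : ∀ n → Car (ordX X)
          val-k n = value k L (N + n) (m≤m+n N n)
          g-spec : ∀ n → letterValue k (c (N + n)) ≡ proj₁ (val-k n)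
          g-spec n = letterValue-spec k (tr (N + n)) (λ i → proj₁ (el (s (N + n)) i)) _ (proj₂ (L (N + n) (m≤m+n N n)))
          value-cong : ∀ {t t'} (l : N ≤ t) (l' : N ≤ t') → t ≡ t' → value k L t l ≡ value k L t' l'
          value-cong l l' refl = cong (value k L _) (≤-irrelevant l l')
          change : ∀ i → Σ ℕ λ d → letterValue k (c (N + (i + suc d))) ≢ letterValue k (c (N + i))
          change i = by-contra λ never → unstable (N + i , m≤m+n N i , λ t l l' →
            ≡⇒≈ ordX-tot {value k L t l} {val-k i} (by never t l (m≤n⇒∃[o]m+o≡n l')))
            where
            by : ¬ (Σ ℕ λ d → letterValue k (c (N + (i + suc d))) ≢ letterValue k (c (N + i))) →
                 ∀ t (l : N ≤ t) → (Σ ℕ λ o → N + i + o ≡ t) → value k L t l ≡ val-k i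
            by never t l (zero , e) = value-cong l _ (trans (sym e) (+-identityʳ (N + i)))
            by never t l (suc d , e) = trans (value-cong l (m≤m+n N (i + suc d)) (trans (sym e) (+-assoc N i (suc d))))
              (Σ-≡ (trans (sym (g-spec (i + suc d))) (trans (by-contra (λ ne → never (d , ne))) (g-spec i))))
              where
              Σ-≡ : ∀ {x y : Σ ℕ (fieldX X)} → proj₁ x ≡ proj₁ y → x ≡ y
              Σ-≡ {a , p} {.a , q} refl = cong (a ,_) (uip p q)
          idx = index c sM k N change
          in-field : ∀ n → fieldX X (changes c sM k N change n)
          in-field n = subst (fieldX X) (sym (g-spec (idx n))) (proj₂ (val-k (idx n)))
          descends : ∀ n → relX X (changes c sM k N change (suc n)) (changes c sM k N change n)
          descends n = subst₂ (relX X) (sym (g-spec (idx (suc n)))) (sym (g-spec (idx n)))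
            (dec-L (N + idx n) (N + idx (suc n)) (m≤m+n N (idx n)) (m≤m+n N (idx (suc n)))
              (+-monoʳ-< N (m<m+n (idx n) (s≤s z≤n))))

      thread : HasThread D
      thread = ThreadOf.hasThread ordX-tot s desc wf (limits stable)

  -- Deciding first whether a thread exists makes Y uniform: without one, `Oracle` works for all
  -- models at once, because a counterexample in any of them would produce a thread.
  dilator-or-thread : BarWF D ω² → RCA₀⊨ωDilator D ⊎ HasThread D
  dilator-or-thread wf = go (dec (HasThread D))
    where
    go : Dec (HasThread D) → RCA₀⊨ωDilator D ⊎ HasThread D
    go (yes th) = inj₂ th
    go (no nth) = inj₁ (Oracle , λ M ω _ MO X _ lin wfX (s , sM , desc) → nth (Model.thread M ω MO X lin wfX s sM desc wf))

theorem3p6 : (lem : ∀ {ℓ} → ExcludedMiddle ℓ) → (D : Predilator) →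
    BarWF D ω² → RCA₀⊨ωDilator D ⊎ HasThread D
theorem3p6 = Priorities.dilator-or-thread
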